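{- Weighted-throughput maximization with active-time budget $K$ on proper intervals, with $n$ jobs and capacity $m$ per slot, can be solved exactly in $(nK)^{O(m)}$ time. In particular, the problem is $\mathrm{XP}$-solvable for the parameter $m$, with running time polynomial in $n$ and (the numeric value of) $K$ for each fixed $m$.
   Context: Weighted-throughput active-time scheduling: an instance consists of a set of $n$ jobs $J=\{1,\dots,n\}$, where job $j$ has an integer release time $r_j$, an integer deadline $d_j$, a positive integer processing time $p_j$ and a nonnegative weight $w_j$; a positive integer capacity $m$; and an integer active-time budget $K$. Time is partitioned into discrete integer slots, and the window of $j$ is the set of slots $W_j=[r_j,d_j]=\{r_j,\dots,d_j\}$. A schedule assigns to each slot $t$ a set $A(t)\subseteq J$ of at most $m$ jobs processed in $t$ (each receiving one unit), with jobs only processed inside their windows; jobs may be preempted at slot boundaries. A slot $t$ is active if $A(t)\neq\emptyset$; at most $K$ slots may be active. A job $j$ is completed if it receives $p_j$ units of processing in slots of $W_j$. The objective is to maximize the total weight of completed jobs. The instance is on proper intervals if no job window strictly contains another (equal windows are allowed).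
   Formalization: The nonnegative job weights are taken to be rational numbers rather than arbitrary nonnegative reals. -}

module Defs where

open import Data.Bool using (Bool; true; false; if_then_else_)
open import Data.Fin using (Fin; toℕ)
open import Data.Fin.Subset using (Subset; Nonempty; ∣_∣) renaming (_∈_ to _∈ₛ_)
open import Data.Fin.Subset.Properties using () renaming (_∈?_ to _∈ₛ?_)
open import Data.Integer as ℤ using (ℤ; +_; 0ℤ; 1ℤ)
import Data.Integer.Properties as ℤ
open import Data.List using (List; []; _∷_; allFin; filter; foldr; length; map; tabulate; upTo)
open import Data.List.Membership.Propositional using (_∈_)
open import Data.List.Relation.Unary.All using (All; []; _∷_; lookup)
open import Data.Nat as ℕ using (ℕ; zero; suc)
open import Data.Product using (Σ-syntax; ∃-syntax; _×_; _,_; proj₁; proj₂)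
open import Data.Product.Properties using (≡-dec)
open import Data.Rational as ℚ using (ℚ; 0ℚ)
import Data.Vec as Vec
open import Level using (0ℓ)
open import Relation.Nullary using (¬_; Dec; does)
open import Relation.Unary using (Pred; _⊂_)

open import Data.List.Membership.DecPropositional (≡-dec ℤ._≟_ ℤ._≟_) using (_∈?_)

-- Negative integers are sent to 0.
clamp : ℤ → ℕ
clamp i = ℤ.∣ 0ℤ ℤ.⊔ i ∣

------------------------------------------------------------------------
-- Weighted-throughput active-time scheduling

record Instance : Set where
  field
    n    : ℕ
    r d  : Fin n → ℤ
    p    : Fin n → ℕ
    w    : Fin n → ℚ
    m    : ℕ
    K    : ℕ
    p>0  : ∀ j → 0 ℕ.< p j
    w≥0  : ∀ j → 0ℚ ℚ.≤ w j
    m>0  : 0 ℕ.< m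

  Window : Fin n → Pred ℤ 0ℓ
  Window j t = r j ℤ.≤ t × t ℤ.≤ d j

  -- The elements of Window j, each listed once.
  slots : Fin n → List ℤ
  slots j = map (λ k → r j ℤ.+ + k) (upTo (clamp (d j ℤ.- r j ℤ.+ 1ℤ)))

  ProperIntervals : Set
  ProperIntervals = ∀ i j → ¬ (Window i ⊂ Window j)

  Schedule : Set
  Schedule = ℤ → Subset n

  Active : Schedule → Pred ℤ 0ℓ
  Active A t = Nonempty (A t)

  record Feasible (A : Schedule) : Set where
    field
      capacity : ∀ t → ∣ A t ∣ ℕ.≤ m
      window   : ∀ t j → j ∈ₛ A t → Window j t
      budget   : ∃[ S ] (length S ℕ.≤ K × (∀ t → Active A t → t ∈ S))

  units : Schedule → Fin n → ℕ
  units A j = length (filter (λ t → j ∈ₛ? A t) (slots j))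

  Completed : Schedule → Pred (Fin n) 0ℓ
  Completed A j = p j ℕ.≤ units A j

  completed? : ∀ A j → Dec (Completed A j)
  completed? A j = p j ℕ.≤? units A j

  throughput : Schedule → ℚ
  throughput A = foldr ℚ._+_ 0ℚ (map w (filter (completed? A) (allFin n)))

  Optimal : Schedule → Set
  Optimal A = Feasible A × (∀ B → Feasible B → throughput B ℚ.≤ throughput A)

------------------------------------------------------------------------
-- Model of computation: a simply typed call-by-value functional language
-- with immutable data. Evaluating any term former costs one step, plus the
-- steps of the subterms evaluated. Values are passed by reference and a
-- closure captures an environment whose length is fixed by the program, so
-- a unit-cost RAM simulates each step in constant time. The only arithmetic
-- is addition, subtraction and comparison, so unit cost does not hide
-- superpolynomial bit work.

infixr 6 _⊗_
infixr 5 _⇒_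

data Ty : Set where
  int rat bool : Ty
  _⊗_ _⇒_      : Ty → Ty → Ty
  list         : Ty → Ty

Ctx : Set
Ctx = List Ty

data Tm (Γ : Ctx) : Ty → Set where
  var        : ∀ {A} → A ∈ Γ → Tm Γ A
  lam        : ∀ {A B} → Tm (A ∷ Γ) B → Tm Γ (A ⇒ B)
  app        : ∀ {A B} → Tm Γ (A ⇒ B) → Tm Γ A → Tm Γ B
  intLit     : ℤ → Tm Γ int
  intAdd     : Tm Γ int → Tm Γ int → Tm Γ int
  intSub     : Tm Γ int → Tm Γ int → Tm Γ int
  intLeq     : Tm Γ int → Tm Γ int → Tm Γ bool
  ratLit     : ℚ → Tm Γ rat
  ratAdd     : Tm Γ rat → Tm Γ rat → Tm Γ rat
  ratLeq     : Tm Γ rat → Tm Γ rat → Tm Γ bool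
  boolLit    : Bool → Tm Γ bool
  ite        : ∀ {A} → Tm Γ bool → Tm Γ A → Tm Γ A → Tm Γ A
  pair       : ∀ {A B} → Tm Γ A → Tm Γ B → Tm Γ (A ⊗ B)
  fst        : ∀ {A B} → Tm Γ (A ⊗ B) → Tm Γ A
  snd        : ∀ {A B} → Tm Γ (A ⊗ B) → Tm Γ B
  nil        : ∀ {A} → Tm Γ (list A)
  cons       : ∀ {A} → Tm Γ A → Tm Γ (list A) → Tm Γ (list A)
  -- listCase xs z f: z if xs is empty, else f with head and tail bound.
  listCase   : ∀ {A B} → Tm Γ (list A) → Tm Γ B → Tm (A ∷ list A ∷ Γ) B → Tm Γ B
  -- listFold xs z f: right fold, f with element and accumulator bound.
  listFold   : ∀ {A B} → Tm Γ (list A) → Tm Γ B → Tm (A ∷ B ∷ Γ) B → Tm Γ B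
  -- iter k z f: iterate f on z, max(k,0) times.
  iter       : ∀ {A} → Tm Γ int → Tm Γ A → Tm (A ∷ Γ) A → Tm Γ A

Costed : Set → Set
Costed X = X × ℕ

return : ∀ {X} → X → Costed X
return x = x , 0

infixl 1 _>>=_

_>>=_ : ∀ {X Y} → Costed X → (X → Costed Y) → Costed Y
(x , a) >>= f = proj₁ (f x) , a ℕ.+ proj₂ (f x)

tick : ∀ {X} → Costed X → Costed X
tick (x , a) = x , suc a

⟦_⟧ : Ty → Set
⟦ int ⟧    = ℤ
⟦ rat ⟧    = ℚ
⟦ bool ⟧   = Bool
⟦ A ⊗ B ⟧  = ⟦ A ⟧ × ⟦ B ⟧
⟦ A ⇒ B ⟧  = ⟦ A ⟧ → Costed ⟦ B ⟧
⟦ list A ⟧ = List ⟦ A ⟧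

Env : Ctx → Set
Env = All ⟦_⟧

iterate : ∀ {X} → ℕ → (X → Costed X) → X → Costed X
iterate zero    f x = return x
iterate (suc k) f x = f x >>= iterate k f

-- Loop iterations need no charge of their own: every evaluation of a loop
-- body costs at least one step.
eval : ∀ {Γ A} → Tm Γ A → Env Γ → Costed ⟦ A ⟧
eval (var x)          ρ = tick (return (lookup ρ x))
eval (lam b)          ρ = tick (return (λ v → eval b (v ∷ ρ)))
eval (app f a)        ρ = tick (eval f ρ >>= λ g → eval a ρ >>= λ v → g v)
eval (intLit i)       ρ = tick (return i)
eval (intAdd a b)     ρ = tick (eval a ρ >>= λ i → eval b ρ >>= λ j → return (i ℤ.+ j))
eval (intSub a b)     ρ = tick (eval a ρ >>= λ i → eval b ρ >>= λ j → return (i ℤ.- j))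
eval (intLeq a b)     ρ = tick (eval a ρ >>= λ i → eval b ρ >>= λ j → return (does (i ℤ.≤? j)))
eval (ratLit q)       ρ = tick (return q)
eval (ratAdd a b)     ρ = tick (eval a ρ >>= λ x → eval b ρ >>= λ y → return (x ℚ.+ y))
eval (ratLeq a b)     ρ = tick (eval a ρ >>= λ x → eval b ρ >>= λ y → return (does (x ℚ.≤? y)))
eval (boolLit b)      ρ = tick (return b)
eval (ite c a b)      ρ = tick (eval c ρ >>= λ t → if t then eval a ρ else eval b ρ)
eval (pair a b)       ρ = tick (eval a ρ >>= λ x → eval b ρ >>= λ y → return (x , y))
eval (fst a)          ρ = tick (eval a ρ >>= λ x → return (proj₁ x))
eval (snd a)          ρ = tick (eval a ρ >>= λ x → return (proj₂ x))
eval nil              ρ = tick (return [])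
eval (cons a b)       ρ = tick (eval a ρ >>= λ x → eval b ρ >>= λ xs → return (x ∷ xs))
eval (listCase a z f) ρ = tick (eval a ρ >>= λ where
                                  []       → eval z ρ
                                  (x ∷ xs) → eval f (x ∷ xs ∷ ρ))
eval (listFold a z f) ρ = tick (eval a ρ >>= λ xs →
                                  foldr (λ x acc → acc >>= λ y → eval f (x ∷ y ∷ ρ)) (eval z ρ) xs)
eval (iter k z f)     ρ = tick (eval k ρ >>= λ i → eval z ρ >>= λ x →
                                  iterate (clamp i) (λ y → eval f (y ∷ ρ)) x)

------------------------------------------------------------------------
-- Algorithms for the scheduling problem

-- Release time, deadline, processing time, weight.
jobTy : Ty
jobTy = int ⊗ int ⊗ int ⊗ rat

-- Inputs: the list of jobs, the capacity m and the budget K.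
-- Output: a list of pairs (t , j), meaning that job j is processed in slot t.
-- Jobs are numbered from 0 in input order.
Program : Set
Program = Tm (list jobTy ∷ int ∷ int ∷ []) (list (int ⊗ int))

module _ (P : Program) (I : Instance) where
  open Instance I

  input : Env (list jobTy ∷ int ∷ int ∷ [])
  input = tabulate (λ j → r j , d j , + p j , w j) ∷ + m ∷ + K ∷ []

  output : List (ℤ × ℤ)
  output = proj₁ (eval P input)

  steps : ℕ
  steps = proj₂ (eval P input)

  outputSchedule : Schedule
  outputSchedule t = Vec.tabulate (λ j → does ((t , + toℕ j) ∈? output))

-- P returns an optimal schedule of every instance on proper intervals,
-- within T steps.
SolvesProperWithin : Program → (Instance → ℕ) → Set
SolvesProperWithin P T =
  ∀ I → Instance.ProperIntervals I →
  Instance.Optimal I (outputSchedule P I) × steps P I ℕ.≤ T I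

-- XP for the parameter m, where the budget K counts by its numeric value.
XPSolvable : Set
XPSolvable =
  Σ[ P ∈ Program ] Σ[ f ∈ (ℕ → ℕ) ] Σ[ g ∈ (ℕ → ℕ) ]
    SolvesProperWithin P
      (λ I → let open Instance I in f m ℕ.* (1 ℕ.+ n ℕ.+ K) ℕ.^ g m)

{-# OPTIONS --safe #-}

-- Order the jobs by release time, ties broken by index; on proper intervals
-- this also orders the deadlines. Processing the earliest jobs first is not
-- optimal, since a job without slack may have to overtake others. But moving
-- units of earlier jobs forward makes a schedule canonical: if a precedes b,
-- then no slot with b but not a comes before a slot with a but not b. At any
-- moment of a canonical schedule with at most c = min(m, n) jobs per slot,
-- finished jobs precede the jobs that have yet to start, and by double
-- counting at most 4c jobs are partially processed. So the remaining work of
-- all jobs is determined by that of the partial ones and by the last finished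
-- job. Shifting slots to the left moreover puts every active slot at some
-- r_j + i with i < K. This leaves (n K)^O(m) states, and a table of the best
-- continuation of every state, improved K - 1 times, yields an optimum.

module Submission where

open import Defs
open import Data.Bool using (Bool; true; false; if_then_else_)
import Data.Bool.Properties as Bool
open import Data.Empty using (⊥; ⊥-elim)
open import Data.Fin as Fin using (Fin; zero; suc; toℕ)
import Data.Fin.Properties as Fin
open import Data.Fin.Subset using (Subset; ∣_∣) renaming (_∈_ to _∈ₛ_)
open import Data.Fin.Subset.Properties using () renaming (_∈?_ to _∈ₛ?_)
open import Data.Integer as ℤ using (ℤ; 0ℤ; 1ℤ)
import Data.Integer.Properties as ℤ
open import Data.Integer.Tactic.RingSolver using (solve-∀)
open import Data.List using (List; []; _∷_; _++_; allFin; deduplicate; filter; foldr; length; map; tabulate)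
import Data.List.Properties as List
open import Data.List.Membership.Propositional using (_∈_)
open import Data.List.Membership.Propositional.Properties
  using (∈-++⁺ˡ; ∈-++⁺ʳ; ∈-++⁻; ∈-allFin; ∈-deduplicate⁺; ∈-deduplicate⁻; ∈-filter⁺; ∈-filter⁻; ∈-map⁺; ∈-map⁻; ∈-tabulate⁺; ∈-tabulate⁻; ∈-upTo⁺; ∈-∃++)
open import Data.List.Relation.Binary.Permutation.Propositional using (↭-sym; ↭⇒↭ₛ)
open import Data.List.Relation.Binary.Permutation.Propositional.Properties using (∈-resp-↭)
open import Data.List.Relation.Unary.All as All using (All; []; _∷_)
open import Data.List.Relation.Unary.AllPairs as AP using (AllPairs; []; _∷_)
import Data.List.Relation.Unary.AllPairs.Properties as AllPairs
open import Data.List.Relation.Unary.Any using (here; there)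
open import Data.List.Relation.Unary.Sorted.TotalOrder.Properties using (Sorted⇒AllPairs)
open import Data.List.Relation.Unary.Unique.Propositional using (Unique)
import Data.List.Relation.Unary.Unique.Propositional.Properties as Unique
open import Data.Nat
  using (ℕ; zero; suc; _+_; _*_; _∸_; _^_; _⊓_; _⊔_; _≤_; _<_; z≤n; s≤s; >-nonZero)
open import Data.Nat.Induction using (<-wellFounded)
import Data.Nat.Properties as ℕ
open import Data.Nat.Solver using (module +-*-Solver)
open import Data.Product using (Σ-syntax; ∃-syntax; _×_; _,_; proj₁; proj₂)
open import Data.Product.Properties using (≡-dec)
open import Data.Rational as ℚ using (ℚ; 0ℚ)
import Data.Rational.Properties as ℚ
open import Data.Sum using (_⊎_; inj₁; inj₂)
open import Data.Unit using (⊤; tt)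
import Data.Vec as Vec
import Data.Vec.Properties as Vec
open import Function using (_∘_; id)
open import Induction.WellFounded using (Acc; acc)
open import Relation.Binary using (tri<; tri≈; tri>)
open import Relation.Binary.PropositionalEquality
open import Relation.Nullary using (¬_; Dec; does; yes; no; _×-dec_)
open import Relation.Nullary.Decidable using (dec-true; dec-false)
open import Relation.Unary using (Decidable)

import Algebra.Properties.AbelianGroup ℤ.+-0-abelianGroup as ℤGroup
import Algebra.Properties.CommutativeMonoid.Sum ℕ.+-0-commutativeMonoid as Σℕ
import Algebra.Properties.CommutativeMonoid.Sum ℚ.+-0-commutativeMonoid as Σℚ
open import Data.List.Relation.Binary.Permutation.Setoid.Properties (setoid ℤ) using (Unique-resp-↭)
open import Data.List.Relation.Unary.Unique.DecPropositional.Properties ℤ._≟_ using (deduplicate-!)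
open import Data.List.Sort ℤ.≤-decTotalOrder using (sort; sort-↭; sort-↗)
open import Data.List.Membership.DecPropositional (≡-dec ℤ._≟_ ℤ._≟_) using (_∈?_)

-- A first-order language with cost bounds

-- The two halves of optimality use different classes of schedules. Every run found in the table
-- decodes to a feasible schedule, canonical or not, and a state absent from the table merely ends a
-- run. Only the schedules that compete for the optimum are made canonical, and only for these must
-- all visited states be shown to lie in the finite universe. Hence the program never tests
-- canonicity or reachability: it enumerates everything that short tuples describe.
--
-- The universe has at most (1 + n (K + 1))^(4 c + 2) states, because a state is fixed by up to 4 c
-- + 1 entries and one clock value, each taken from the same n (K + 1) options. The initial state
-- lies before all release times, thus outside the universe, and takes the last of the K rounds for
-- itself.
--
-- The time bound concerns terms of a fixed language that are too large to unfold. So each routine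
-- is written in a fragment where the cost is a polynomial in a common bound N on all iteration
-- counts, and is replaced by a specification before it is used in the next one.

data Op₀ : Ty → Set where
  intC  : ℤ → Op₀ int
  ratC  : ℚ → Op₀ rat
  boolC : Bool → Op₀ bool
  nilC  : ∀ {A} → Op₀ (list A)

data Op₁ : Ty → Ty → Set where
  fstC : ∀ {A B} → Op₁ (A ⊗ B) A
  sndC : ∀ {A B} → Op₁ (A ⊗ B) B

data Op₂ : Ty → Ty → Ty → Set where
  addC subC : Op₂ int int int
  leqC      : Op₂ int int bool
  addQC     : Op₂ rat rat rat
  leqQC     : Op₂ rat rat bool
  pairC     : ∀ {A B} → Op₂ A B (A ⊗ B)
  consC     : ∀ {A} → Op₂ A (list A) (list A)

-- The first-order fragment in which the algorithm is written: closures only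
-- occur as local definitions, so programs denote plain Agda functions and
-- their cost is controlled by the number of loop iterations alone.
data Code : Ctx → Ty → Set where
  var  : ∀ {Γ A} → A ∈ Γ → Code Γ A
  con  : ∀ {Γ A} → Op₀ A → Code Γ A
  un   : ∀ {Γ A B} → Op₁ A B → Code Γ A → Code Γ B
  bin  : ∀ {Γ A B C} → Op₂ A B C → Code Γ A → Code Γ B → Code Γ C
  ite  : ∀ {Γ A} → Code Γ bool → Code Γ A → Code Γ A → Code Γ A
  fold : ∀ {Γ A B} → Code Γ (list A) → Code Γ B → Code (A ∷ B ∷ Γ) B → Code Γ B
  loop : ∀ {Γ A} → Code Γ int → Code Γ A → Code (A ∷ Γ) A → Code Γ A
  bind : ∀ {Γ A B} → Code Γ A → Code (A ∷ Γ) B → Code Γ B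
  wk   : ∀ {Γ A B} → Code Γ B → Code (A ∷ Γ) B
  call : ∀ {Γ Δ A} → Code Δ A → All (_∈ Γ) Δ → Code Γ A

⟦_⟧₀ : ∀ {A} → Op₀ A → ⟦ A ⟧
⟦ intC i ⟧₀  = i
⟦ ratC q ⟧₀  = q
⟦ boolC b ⟧₀ = b
⟦ nilC ⟧₀    = []

⟦_⟧₁ : ∀ {A B} → Op₁ A B → ⟦ A ⟧ → ⟦ B ⟧
⟦ fstC ⟧₁ = proj₁
⟦ sndC ⟧₁ = proj₂

⟦_⟧₂ : ∀ {A B C} → Op₂ A B C → ⟦ A ⟧ → ⟦ B ⟧ → ⟦ C ⟧
⟦ addC ⟧₂ i j  = i ℤ.+ j
⟦ subC ⟧₂ i j  = i ℤ.- j
⟦ leqC ⟧₂ i j  = does (i ℤ.≤? j)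
⟦ addQC ⟧₂ x y = x ℚ.+ y
⟦ leqQC ⟧₂ x y = does (x ℚ.≤? y)
⟦ pairC ⟧₂ x y = x , y
⟦ consC ⟧₂ x y = x ∷ y

iterateᵖ : ∀ {X : Set} → ℕ → (X → X) → X → X
iterateᵖ zero    f x = x
iterateᵖ (suc k) f x = iterateᵖ k f (f x)

val : ∀ {Γ A} → Code Γ A → Env Γ → ⟦ A ⟧
val (var x)      ρ = All.lookup ρ x
val (con o)      ρ = ⟦ o ⟧₀
val (un o a)     ρ = ⟦ o ⟧₁ (val a ρ)
val (bin o a b)  ρ = ⟦ o ⟧₂ (val a ρ) (val b ρ)
val (ite c a b)  ρ = if val c ρ then val a ρ else val b ρ
val (fold a z f) ρ = foldr (λ x y → val f (x ∷ y ∷ ρ)) (val z ρ) (val a ρ)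
val (loop k z f) ρ = iterateᵖ (clamp (val k ρ)) (λ y → val f (y ∷ ρ)) (val z ρ)
val (bind a b)   ρ = val b (val a ρ ∷ ρ)
val (wk b)       (_ ∷ ρ) = val b ρ
val (call c xs)  ρ = val c (All.map (All.lookup ρ) xs)

Renaming : Ctx → Ctx → Set
Renaming Δ Γ = ∀ {A} → A ∈ Δ → A ∈ Γ

lift : ∀ {Δ Γ A} → Renaming Δ Γ → Renaming (A ∷ Δ) (A ∷ Γ)
lift σ (here e)  = here e
lift σ (there x) = there (σ x)

compile₀ : ∀ {Γ A} → Op₀ A → Tm Γ A
compile₀ (intC i)  = intLit i
compile₀ (ratC q)  = ratLit q
compile₀ (boolC b) = boolLit b
compile₀ nilC      = nil

compile₁ : ∀ {Γ A B} → Op₁ A B → Tm Γ A → Tm Γ B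
compile₁ fstC = fst
compile₁ sndC = snd

compile₂ : ∀ {Γ A B C} → Op₂ A B C → Tm Γ A → Tm Γ B → Tm Γ C
compile₂ addC  = intAdd
compile₂ subC  = intSub
compile₂ leqC  = intLeq
compile₂ addQC = ratAdd
compile₂ leqQC = ratLeq
compile₂ pairC = pair
compile₂ consC = cons

-- `wk` and `call` leave no trace in the term: they only compose the renaming. A called routine is
-- inlined, so a call costs no more than its body.
compile : ∀ {Δ Γ A} → Code Δ A → Renaming Δ Γ → Tm Γ A
compile (var x)      σ = var (σ x)
compile (con o)      σ = compile₀ o
compile (un o a)     σ = compile₁ o (compile a σ)
compile (bin o a b)  σ = compile₂ o (compile a σ) (compile b σ)
compile (ite c a b)  σ = ite (compile c σ) (compile a σ) (compile b σ)
compile (fold a z f) σ = listFold (compile a σ) (compile z σ) (compile f (lift (lift σ)))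
compile (loop k z f) σ = iter (compile k σ) (compile z σ) (compile f (lift σ))
compile (bind a b)   σ = app (lam (compile b (lift σ))) (compile a σ)
compile (wk b)       σ = compile b (σ ∘ there)
compile (call c xs)  σ = compile c (σ ∘ All.lookup xs)

infixl 6 _⊕_
infixr 7 ↻_

-- Polynomials in one unknown N; ↻ multiplies by N.
data Poly : Set where
  𝟏   : Poly
  _⊕_ : Poly → Poly → Poly
  ↻_  : Poly → Poly

⟦_⟧ᵖ : Poly → ℕ → ℕ
⟦ 𝟏 ⟧ᵖ     N = 1
⟦ p ⊕ q ⟧ᵖ N = ⟦ p ⟧ᵖ N + ⟦ q ⟧ᵖ N
⟦ ↻ p ⟧ᵖ   N = N * ⟦ p ⟧ᵖ N

size deg : Poly → ℕ
size 𝟏       = 1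
size (p ⊕ q) = size p + size q
size (↻ p)   = size p
deg 𝟏       = 0
deg (p ⊕ q) = deg p ⊔ deg q
deg (↻ p)   = suc (deg p)

poly-bound : ∀ p N → 1 ≤ N → ⟦ p ⟧ᵖ N ≤ size p * N ^ deg p
poly-bound 𝟏 N _ = s≤s z≤n
poly-bound (p ⊕ q) (suc N) 1≤N = ℕ.≤-trans
  (ℕ.+-mono-≤ (poly-bound p (suc N) 1≤N) (poly-bound q (suc N) 1≤N))
  (ℕ.≤-trans
    (ℕ.+-mono-≤
      (ℕ.*-monoʳ-≤ (size p) (ℕ.^-monoʳ-≤ (suc N) (ℕ.m≤m⊔n (deg p) (deg q))))
      (ℕ.*-monoʳ-≤ (size q) (ℕ.^-monoʳ-≤ (suc N) (ℕ.m≤n⊔m (deg p) (deg q)))))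
    (ℕ.≤-reflexive (sym (ℕ.*-distribʳ-+ (suc N ^ deg (p ⊕ q)) (size p) (size q)))))
poly-bound (↻ p) N 1≤N = ℕ.≤-trans (ℕ.*-monoʳ-≤ N (poly-bound p N 1≤N))
  (ℕ.≤-reflexive (solve 3 (λ n s e → n :* (s :* e) := s :* (n :* e)) refl N (size p) (N ^ deg p)))
  where open +-*-Solver

-- This bound looks at no data: both branches of a conditional are charged, and a loop multiplies
-- its body by N. The two extra steps of `bind` are the application and the abstraction to which it
-- compiles.
cost : ∀ {Γ A} → Code Γ A → Poly
cost (var x)      = 𝟏
cost (con o)      = 𝟏
cost (un o a)     = 𝟏 ⊕ cost a
cost (bin o a b)  = 𝟏 ⊕ (cost a ⊕ cost b)
cost (ite c a b)  = 𝟏 ⊕ (cost c ⊕ (cost a ⊕ cost b))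
cost (fold a z f) = 𝟏 ⊕ (cost a ⊕ (cost z ⊕ ↻ cost f))
cost (loop k z f) = 𝟏 ⊕ (cost k ⊕ (cost z ⊕ ↻ cost f))
cost (bind a b)   = 𝟏 ⊕ (𝟏 ⊕ (cost a ⊕ cost b))
cost (wk b)       = cost b
cost (call c xs)  = cost c

-- A loop body has to be safe only at the iterates, since some loops of the algorithm run through
-- their own state, which grows. No fold iterates over its accumulator, so there the obligations can
-- range over all accumulators.
IterSafe : ∀ {X : Set} → (X → Set) → (X → X) → ℕ → X → Set
IterSafe S f zero    x = ⊤
IterSafe S f (suc k) x = S x × IterSafe S f k (f x)

-- The obligation that all loops of a program run at most N times, followed by
-- the obligation R of the rest of the program.
obl : ∀ {Γ A} → ℕ → Code Γ A → Env Γ → Set → Set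

record Safe {Γ A} (N : ℕ) (c : Code Γ A) (ρ : Env Γ) : Set where
  inductive
  constructor safe
  field obligations : obl N c ρ ⊤

obl N (var x)      ρ R = R
obl N (con o)      ρ R = R
obl N (un o a)     ρ R = obl N a ρ R
obl N (bin o a b)  ρ R = obl N a ρ (obl N b ρ R)
obl N (ite c a b)  ρ R = obl N c ρ (obl N a ρ (obl N b ρ R))
obl N (fold a z f) ρ R = obl N a ρ (obl N z ρ
  ((length (val a ρ) ≤ N × (∀ x → x ∈ val a ρ → ∀ y → obl N f (x ∷ y ∷ ρ) ⊤)) × R))
obl N (loop k z f) ρ R = obl N k ρ (obl N z ρ
  ((clamp (val k ρ) ≤ N ×
    IterSafe (λ y → obl N f (y ∷ ρ) ⊤) (λ y → val f (y ∷ ρ)) (clamp (val k ρ)) (val z ρ)) × R))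
obl N (bind a b)   ρ R = obl N a ρ (obl N b (val a ρ ∷ ρ) R)
obl N (wk b)       (_ ∷ ρ) R = obl N b ρ R
obl N (call c xs)  ρ R = Safe N c (All.map (All.lookup ρ) xs) × R

-- Correctness and cost of compilation

_⊢_≈_ : ∀ {Δ Γ} → Renaming Δ Γ → Env Γ → Env Δ → Set
σ ⊢ ρ′ ≈ ρ = ∀ {A} (x : A ∈ _) → All.lookup ρ′ (σ x) ≡ All.lookup ρ x

≈-lift : ∀ {Δ Γ A} {σ : Renaming Δ Γ} {ρ′ ρ} {u v : ⟦ A ⟧} →
         u ≡ v → σ ⊢ ρ′ ≈ ρ → lift σ ⊢ (u ∷ ρ′) ≈ (v ∷ ρ)
≈-lift e h (here refl) = e
≈-lift e h (there x)   = h x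

lookup-map : ∀ {Γ Δ} (ρ : Env Γ) (xs : All (_∈ Γ) Δ) {A} (x : A ∈ Δ) →
             All.lookup (All.map (All.lookup ρ) xs) x ≡ All.lookup ρ (All.lookup xs x)
lookup-map ρ (_ ∷ xs) (here refl) = refl
lookup-map ρ (_ ∷ xs) (there x)   = lookup-map ρ xs x

≈-call : ∀ {Δ Γ Θ} {σ : Renaming Δ Γ} {ρ′ ρ} (xs : All (_∈ Δ) Θ) → σ ⊢ ρ′ ≈ ρ →
         (σ ∘ All.lookup xs) ⊢ ρ′ ≈ All.map (All.lookup ρ) xs
≈-call {ρ = ρ} xs h x = trans (h (All.lookup xs x)) (sym (lookup-map ρ xs x))

foldr-value : ∀ {X Y : Set} (f : X → Y → Costed Y) (z : Costed Y) (g : X → Y → Y) {z′ : Y} →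
              (∀ x {y y′} → y ≡ y′ → proj₁ (f x y) ≡ g x y′) → proj₁ z ≡ z′ → ∀ xs →
              proj₁ (foldr (λ x acc → acc >>= f x) z xs) ≡ foldr g z′ xs
foldr-value f z g hf hz []       = hz
foldr-value f z g hf hz (x ∷ xs) = hf x (foldr-value f z g hf hz xs)

iterate-value : ∀ {X : Set} (f : X → Costed X) (g : X → X) →
                (∀ {y y′} → y ≡ y′ → proj₁ (f y) ≡ g y′) → ∀ k {x x′} → x ≡ x′ →
                proj₁ (iterate k f x) ≡ iterateᵖ k g x′
iterate-value f g h zero    e = e
iterate-value f g h (suc k) e = iterate-value f g h k (h e)

op₀-eval : ∀ {Γ A} (o : Op₀ A) (ρ : Env Γ) → eval (compile₀ o) ρ ≡ (⟦ o ⟧₀ , 1)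
op₀-eval (intC x)  ρ = refl
op₀-eval (ratC x)  ρ = refl
op₀-eval (boolC x) ρ = refl
op₀-eval nilC      ρ = refl

op₁-eval : ∀ {Γ A B} (o : Op₁ A B) (a : Tm Γ A) ρ →
           eval (compile₁ o a) ρ ≡ (⟦ o ⟧₁ (proj₁ (eval a ρ)) , suc (proj₂ (eval a ρ) + 0))
op₁-eval fstC a ρ = refl
op₁-eval sndC a ρ = refl

op₂-eval : ∀ {Γ A B C} (o : Op₂ A B C) (a : Tm Γ A) (b : Tm Γ B) ρ → eval (compile₂ o a b) ρ ≡
           (⟦ o ⟧₂ (proj₁ (eval a ρ)) (proj₁ (eval b ρ)) , suc (proj₂ (eval a ρ) + (proj₂ (eval b ρ) + 0)))
op₂-eval addC  a b ρ = refl
op₂-eval subC  a b ρ = refl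
op₂-eval leqC  a b ρ = refl
op₂-eval addQC a b ρ = refl
op₂-eval leqQC a b ρ = refl
op₂-eval pairC a b ρ = refl
op₂-eval consC a b ρ = refl

compile-value : ∀ {Δ Γ A} (c : Code Δ A) (σ : Renaming Δ Γ) {ρ′ : Env Γ} {ρ : Env Δ} → σ ⊢ ρ′ ≈ ρ →
                proj₁ (eval (compile c σ) ρ′) ≡ val c ρ
compile-value (var x)  σ h = h x
compile-value (con o)  σ h = cong proj₁ (op₀-eval o _)
compile-value (un o a) σ {ρ′} {ρ} h = trans (cong proj₁ (op₁-eval o (compile a σ) _)) (cong ⟦ o ⟧₁ (compile-value a σ {ρ′} {ρ} h))
compile-value (bin o a b) σ {ρ′} {ρ} h = trans (cong proj₁ (op₂-eval o (compile a σ) (compile b σ) _))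
  (cong₂ ⟦ o ⟧₂ (compile-value a σ {ρ′} {ρ} h) (compile-value b σ {ρ′} {ρ} h))
compile-value (ite c a b) σ {ρ′} {ρ} h rewrite sym (compile-value c σ {ρ′} {ρ} h) =
  branch (proj₁ (eval (compile c σ) ρ′))
  where
  branch : ∀ t → proj₁ (if t then eval (compile a σ) ρ′ else eval (compile b σ) ρ′) ≡
                 (if t then val a ρ else val b ρ)
  branch true  = compile-value a σ {ρ′} {ρ} h
  branch false = compile-value b σ {ρ′} {ρ} h
compile-value (fold a z f) σ {ρ′} {ρ} h rewrite sym (compile-value a σ {ρ′} {ρ} h) =
  foldr-value _ _ _ (λ x e → compile-value f (lift (lift σ))
                               (≈-lift {σ = lift σ} {_ ∷ ρ′} {_ ∷ ρ} refl (≈-lift {σ = σ} {ρ′} {ρ} e h)))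
              (compile-value z σ {ρ′} {ρ} h) (proj₁ (eval (compile a σ) ρ′))
compile-value (loop k z f) σ {ρ′} {ρ} h rewrite sym (compile-value k σ {ρ′} {ρ} h) =
  iterate-value _ _ (λ e → compile-value f (lift σ) (≈-lift {σ = σ} {ρ′} {ρ} e h))
                (clamp (proj₁ (eval (compile k σ) ρ′))) (compile-value z σ {ρ′} {ρ} h)
compile-value (bind a b) σ {ρ′} {ρ} h =
  compile-value b (lift σ) (≈-lift {σ = σ} {ρ′} {ρ} (compile-value a σ {ρ′} {ρ} h) h)
compile-value (wk b) σ {ρ = _ ∷ _} h = compile-value b (σ ∘ there) (h ∘ there)
compile-value (call c xs) σ {ρ′} {ρ} h = compile-value c (σ ∘ All.lookup xs) (≈-call {σ = σ} {ρ′} {ρ} xs h)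

foldr-cost : ∀ {X Y : Set} (f : X → Y → Costed Y) (z : Costed Y) {F : ℕ} xs →
             (∀ x → x ∈ xs → ∀ y → proj₂ (f x y) ≤ F) →
             proj₂ (foldr (λ x acc → acc >>= f x) z xs) ≤ proj₂ z + length xs * F
foldr-cost f z []       h = ℕ.m≤m+n _ 0
foldr-cost f z {F} (x ∷ xs) h = ℕ.≤-trans
  (ℕ.+-mono-≤ (foldr-cost f z xs (λ x i → h x (there i))) (h x (here refl) _))
  (ℕ.≤-reflexive (solve 3 (λ a b c → a :+ b :+ c := a :+ (c :+ b)) refl (proj₂ z) (length xs * F) F))
  where open +-*-Solver

iterate-cost : ∀ {X : Set} (S : X → Set) (f : X → Costed X) (g : X → X) {F : ℕ} →
               (∀ {y y′} → y ≡ y′ → proj₁ (f y) ≡ g y′) → (∀ {y y′} → y ≡ y′ → S y′ → proj₂ (f y) ≤ F) →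
               ∀ k {x x′} → x ≡ x′ → IterSafe S g k x′ → proj₂ (iterate k f x) ≤ k * F
iterate-cost S f g hv hc zero    e _       = z≤n
iterate-cost S f g hv hc (suc k) e (s , t) = ℕ.+-mono-≤ (hc e s) (iterate-cost S f g hv hc k (hv e) t)

-- The obligations are in continuation form: a subterm consumes its own and hands on the rest as
-- `R`. Values enter through `compile-value`, because the iteration counts of the compiled loops
-- have to be those of the denotation, about which the obligations speak.
compile-cost : ∀ {Δ Γ A R} N (c : Code Δ A) (σ : Renaming Δ Γ) {ρ′ : Env Γ} {ρ : Env Δ} → σ ⊢ ρ′ ≈ ρ →
               obl N c ρ R → proj₂ (eval (compile c σ) ρ′) ≤ ⟦ cost c ⟧ᵖ N × R
compile-cost N (var x) σ h o = ℕ.≤-refl , o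
compile-cost N (con k) σ {ρ′} h o = ℕ.≤-reflexive (cong proj₂ (op₀-eval k ρ′)) , o
compile-cost N (un k a) σ {ρ′} {ρ} h o with compile-cost N a σ {ρ′} {ρ} h o
... | ca , r = ℕ.≤-trans (ℕ.≤-reflexive (trans (cong proj₂ (op₁-eval k (compile a σ) ρ′))
                                           (cong suc (ℕ.+-identityʳ _)))) (s≤s ca) , r
compile-cost N (bin k a b) σ {ρ′} {ρ} h o with compile-cost N a σ {ρ′} {ρ} h o
... | ca , o₁ with compile-cost N b σ {ρ′} {ρ} h o₁
... | cb , r = ℕ.≤-trans (ℕ.≤-reflexive (cong proj₂ (op₂-eval k (compile a σ) (compile b σ) ρ′)))
                 (s≤s (ℕ.+-mono-≤ ca (ℕ.≤-trans (ℕ.≤-reflexive (ℕ.+-identityʳ _)) cb))) , r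
compile-cost N (ite c a b) σ {ρ′} {ρ} h o with compile-cost N c σ {ρ′} {ρ} h o
... | cc , o₁ with compile-cost N a σ {ρ′} {ρ} h o₁
... | ca , o₂ with compile-cost N b σ {ρ′} {ρ} h o₂
... | cb , r = s≤s (ℕ.+-mono-≤ cc (branch (proj₁ (eval (compile c σ) ρ′)))) , r
  where
  branch : ∀ t → proj₂ (if t then eval (compile a σ) ρ′ else eval (compile b σ) ρ′) ≤
                 ⟦ cost a ⟧ᵖ N + ⟦ cost b ⟧ᵖ N
  branch true  = ℕ.≤-trans ca (ℕ.m≤m+n _ _)
  branch false = ℕ.≤-trans cb (ℕ.m≤n+m _ (⟦ cost a ⟧ᵖ N))
compile-cost N (fold a z f) σ {ρ′} {ρ} h o with compile-cost N a σ {ρ′} {ρ} h o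
... | ca , o₁ with compile-cost N z σ {ρ′} {ρ} h o₁
... | cz , (len , body) , r rewrite sym (compile-value a σ {ρ′} {ρ} h) =
  s≤s (ℕ.+-mono-≤ ca (ℕ.≤-trans
    (foldr-cost _ (eval (compile z σ) ρ′) (proj₁ (eval (compile a σ) ρ′)) (λ x i y →
      proj₁ (compile-cost N f (lift (lift σ))
        (≈-lift {σ = lift σ} {y ∷ ρ′} {y ∷ ρ} refl (≈-lift {σ = σ} {ρ′} {ρ} refl h)) (body x i y))))
    (ℕ.+-mono-≤ cz (ℕ.*-monoˡ-≤ (⟦ cost f ⟧ᵖ N) len)))) , r
compile-cost N (loop k z f) σ {ρ′} {ρ} h o with compile-cost N k σ {ρ′} {ρ} h o
... | ck , o₁ with compile-cost N z σ {ρ′} {ρ} h o₁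
... | cz , (len , body) , r rewrite sym (compile-value k σ {ρ′} {ρ} h) =
  s≤s (ℕ.+-mono-≤ ck (ℕ.+-mono-≤ cz (ℕ.≤-trans
    (iterate-cost (λ y → obl N f (y ∷ ρ) ⊤) _ (λ y → val f (y ∷ ρ))
      (λ e → compile-value f (lift σ) (≈-lift {σ = σ} {ρ′} {ρ} e h))
      (λ e s → proj₁ (compile-cost N f (lift σ) (≈-lift {σ = σ} {ρ′} {ρ} e h) s))
      (clamp (proj₁ (eval (compile k σ) ρ′))) (compile-value z σ {ρ′} {ρ} h) body)
    (ℕ.*-monoˡ-≤ (⟦ cost f ⟧ᵖ N) len)))) , r
compile-cost N (bind a b) σ {ρ′} {ρ} h o with compile-cost N a σ {ρ′} {ρ} h o
... | ca , o₁ with compile-cost N b (lift σ) (≈-lift {σ = σ} {ρ′} {ρ} (compile-value a σ {ρ′} {ρ} h) h) o₁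
... | cb , r = s≤s (s≤s (ℕ.+-mono-≤ ca cb)) , r
compile-cost N (wk b) σ {ρ = _ ∷ _} h o = compile-cost N b (σ ∘ there) (h ∘ there) o
compile-cost N (call c xs) σ {ρ′} {ρ} h (o , r) =
  proj₁ (compile-cost N c (σ ∘ All.lookup xs) (≈-call {σ = σ} {ρ′} {ρ} xs h) (Safe.obligations o)) , r

module _ {Γ : Ctx} where

  pattern i0 = here refl
  pattern i1 = there i0
  pattern i2 = there i1
  pattern i3 = there i2
  pattern i4 = there i3
  pattern i5 = there i4
  pattern i6 = there i5

  v0 : ∀ {A} → Code (A ∷ Γ) A
  v0 = var i0

  v1 : ∀ {A B} → Code (A ∷ B ∷ Γ) B
  v1 = var i1

  v2 : ∀ {A B C} → Code (A ∷ B ∷ C ∷ Γ) C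
  v2 = var i2

  v3 : ∀ {A B C D} → Code (A ∷ B ∷ C ∷ D ∷ Γ) D
  v3 = var i3

  int# : ℤ → Code Γ int
  int# i = con (intC i)

  yes# no# : Code Γ bool
  yes# = con (boolC true)
  no#  = con (boolC false)

  nil# : ∀ {A} → Code Γ (list A)
  nil# = con nilC

  infixr 5 _∷#_
  infixr 4 _,#_
  infix 6 _≤#_ _≡#_
  infixl 7 _+#_ _-#_

  _∷#_ : ∀ {A} → Code Γ A → Code Γ (list A) → Code Γ (list A)
  _∷#_ = bin consC

  _,#_ : ∀ {A B} → Code Γ A → Code Γ B → Code Γ (A ⊗ B)
  _,#_ = bin pairC

  fst# : ∀ {A B} → Code Γ (A ⊗ B) → Code Γ A
  fst# = un fstC

  snd# : ∀ {A B} → Code Γ (A ⊗ B) → Code Γ B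
  snd# = un sndC

  _+#_ _-#_ : Code Γ int → Code Γ int → Code Γ int
  _+#_ = bin addC
  _-#_ = bin subC

  _≤#_ _≡#_ : Code Γ int → Code Γ int → Code Γ bool
  _≤#_ = bin leqC
  a ≡# b = ite (a ≤# b) (b ≤# a) no#

-- The algorithm

indexedTy optionTy tupleTy stateTy valueTy tableTy : Ty
indexedTy = int ⊗ jobTy
optionTy  = indexedTy ⊗ int
tupleTy   = list optionTy
stateTy   = int ⊗ tupleTy
valueTy   = rat ⊗ list (int ⊗ int)
tableTy   = list (stateTy ⊗ valueTy)

module _ {Γ : Ctx} where

  index# release# deadline# size# : Code Γ indexedTy → Code Γ int
  index# j    = fst# j
  release# j  = fst# (snd# j)
  deadline# j = fst# (snd# (snd# j))
  size# j     = fst# (snd# (snd# (snd# j)))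

  weight# : Code Γ indexedTy → Code Γ rat
  weight# j = snd# (snd# (snd# (snd# j)))

  before# : Code Γ indexedTy → Code Γ indexedTy → Code Γ bool
  before# i j = ite (release# i ≤# release# j)
                  (ite (release# j ≤# release# i) (index# i +# int# 1ℤ ≤# index# j) yes#)
                  no#

  worthless# : Code Γ valueTy
  worthless# = con (ratC 0ℚ) ,# nil#

memberC : Code (indexedTy ∷ tupleTy ∷ []) bool
memberC = fold v1 no# (ite (index# (fst# v0) ≡# index# v2) yes# v1)

-- A tuple describes a state by listing the partial jobs and, with remaining
-- work 0, the last finished job; other jobs before the latter are closed.
remainingC : Code (indexedTy ∷ tupleTy ∷ []) int
remainingC =
  fold v1
    (fold v1 (size# v0)
      (ite (snd# v0 ≤# int# 0ℤ) (ite (before# v2 (fst# v0)) (int# 0ℤ) v1) v1))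
    (ite (index# (fst# v0) ≡# index# v2) (snd# v0) v1)

-- An option `(j , c)` is used in two ways: as an entry of a tuple, c is the remaining work of j;
-- here it stands for the time r_j + c.
stateC : Code (optionTy ∷ tupleTy ∷ list indexedTy ∷ []) stateTy
stateC = (release# (fst# v0) +# snd# v0) ,#
         fold v2 nil# ((v0 ,# call remainingC (i0 ∷ i3 ∷ [])) ∷# v1)

-- Arguments: previous active slot, jobs processed next.
nextSlotC : Code (int ∷ tupleTy ∷ []) int
nextSlotC = fold v1 (v0 +# int# 1ℤ) (ite (v1 ≤# release# (fst# v0)) (release# (fst# v0)) v1)

-- In a canonical schedule an unprocessed job before a finishing one never runs
-- again. Clearing its remaining work keeps the number of states small.
closesC : Code (indexedTy ∷ tupleTy ∷ tupleTy ∷ []) bool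
closesC = fold v1 no#
  (ite (bind (fst# v0) (call memberC (i0 ∷ i5 ∷ [])))
    (ite (snd# v0 ≤# int# 1ℤ) (ite (before# v2 (fst# v0)) yes# v1) v1)
    v1)

successorC : Code (int ∷ tupleTy ∷ tupleTy ∷ []) stateTy
successorC = v0 ,# fold v1 nil#
  ((fst# v0 ,#
    ite (bind (fst# v0) (call memberC (i0 ∷ i5 ∷ [])))
      (snd# v0 -# int# 1ℤ)
      (ite (bind (fst# v0) (call closesC (i0 ∷ i4 ∷ i5 ∷ []))) (int# 0ℤ) (snd# v0)))
   ∷# v1)

validC : Code (int ∷ tupleTy ∷ tupleTy ∷ []) bool
validC = fold v1 yes#
  (ite (bind (fst# v0) (call memberC (i0 ∷ i5 ∷ [])))
    (ite (int# 1ℤ ≤# snd# v0) (ite (v2 ≤# deadline# (fst# v0)) v1 no#) no#)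
    v1)

-- A weight is paid together with the last unit of its job, when the remaining work is 1; `validC`
-- rules out processing a job with no work left.
gainC : Code (tupleTy ∷ tupleTy ∷ []) rat
gainC = fold v0 (con (ratC 0ℚ))
  (ite (bind (fst# v0) (call memberC (i0 ∷ i4 ∷ [])))
    (ite (snd# v0 ≤# int# 1ℤ) (bin addQC (weight# (fst# v0)) v1) v1)
    v1)

-- The fragment cannot traverse two lists in step, hence the nested folds. Containment in one
-- direction is enough, as the states in question list every job exactly once.
sameStateC : Code (stateTy ∷ stateTy ∷ []) bool
sameStateC = ite (fst# v0 ≡# fst# v1)
  (fold (snd# v0) yes#
    (ite (fold (snd# v3) no#
           (ite (index# (fst# v0) ≡# index# (fst# v2)) (ite (snd# v0 ≡# snd# v2) yes# v1) v1))
      v1 no#))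
  no#

-- States missing from the table get the empty continuation, which is sound.
lookupC : Code (tableTy ∷ stateTy ∷ []) valueTy
lookupC = fold v0 worthless#
  (ite (bind (fst# v0) (call sameStateC (i0 ∷ i4 ∷ []))) (snd# v0) v1)

-- Arguments: next slot, remaining work, jobs processed next, table.
continueC : Code (int ∷ tupleTy ∷ tupleTy ∷ tableTy ∷ []) valueTy
continueC = ite (call validC (i0 ∷ i1 ∷ i2 ∷ []))
  (bind (bind (call successorC (i0 ∷ i1 ∷ i2 ∷ [])) (call lookupC (i4 ∷ i0 ∷ [])))
    (bin addQC (call gainC (i2 ∷ i3 ∷ [])) (fst# v0) ,#
     fold v3 (snd# v0) ((v3 ,# index# (fst# v0)) ∷# v1)))
  worthless#

candidateC : Code (tableTy ∷ stateTy ∷ tupleTy ∷ []) valueTy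
candidateC =
  bind (bind (fst# v1) (call nextSlotC (i0 ∷ i3 ∷ [])))
    (bind (snd# v2) (call continueC (i1 ∷ i0 ∷ i4 ∷ i2 ∷ [])))

bestC : Code (tableTy ∷ list tupleTy ∷ stateTy ∷ []) valueTy
bestC = fold v1 worthless#
  (bind (call candidateC (i2 ∷ i4 ∷ i0 ∷ [])) (ite (bin leqQC (fst# v2) (fst# v0)) v0 v2))

improveWith : Code (tableTy ∷ list tupleTy ∷ stateTy ∷ []) valueTy → Code (tableTy ∷ list tupleTy ∷ []) tableTy
improveWith b = fold v0 nil#
  ((fst# v0 ,# bind (fst# v0) (call b (i3 ∷ i4 ∷ i0 ∷ []))) ∷# v1)

improveC : Code (tableTy ∷ list tupleTy ∷ []) tableTy
improveC = improveWith bestC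

longerC : Code (list tupleTy ∷ tupleTy ∷ []) (list tupleTy)
longerC = nil# ∷# fold v0 nil# (fold v3 v1 ((v0 ∷# v2) ∷# v1))

-- As longerC adds the empty tuple again, k rounds give all lengths up to k.
tuplesC : Code (tupleTy ∷ int ∷ []) (list tupleTy)
tuplesC = loop v1 (nil# ∷# nil#) (call longerC (i0 ∷ i1 ∷ []))

rangeC : Code (int ∷ []) (list int)
rangeC = loop v0 (int# 0ℤ ∷# nil#) (int# 0ℤ ∷# fold v0 nil# ((v0 +# int# 1ℤ) ∷# v1))

optionsC : Code (list indexedTy ∷ list int ∷ []) tupleTy
optionsC = fold v0 nil# (fold v3 v1 ((v2 ,# v0) ∷# v1))

countC : Code (list jobTy ∷ []) int
countC = fold v0 (int# 0ℤ) (v1 +# int# 1ℤ)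

indexC : Code (list jobTy ∷ []) (list indexedTy)
-- A right fold meets the last job first, so the counter starts at n - 1 and runs down.
indexC = fst# (fold v0 (nil# ,# (call countC (i0 ∷ []) -# int# 1ℤ))
                (((snd# v1 ,# v0) ∷# fst# v1) ,# (snd# v1 -# int# 1ℤ)))

earliestC : Code (list indexedTy ∷ int ∷ []) int
earliestC = fold v0 v1 (ite (release# v0 ≤# v1) (release# v0) v1)

-- The clock names the previous active slot, and the next slot is strictly later. One less than the
-- earliest release time therefore permits a start at that release time.
initialC : Code (list indexedTy ∷ int ∷ []) stateTy
initialC = (call earliestC (i0 ∷ i1 ∷ []) -# int# 1ℤ) ,# fold v0 nil# ((v0 ,# size# v0) ∷# v1)

universeC : Code (tupleTy ∷ list tupleTy ∷ list indexedTy ∷ []) tableTy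
universeC = fold v0 nil#
  (fold v3 v1 ((call stateC (i2 ∷ i0 ∷ i6 ∷ []) ,# worthless#) ∷# v1))

-- Arguments: table, sets of jobs, initial state, budget.
runWith : Code (tableTy ∷ list tupleTy ∷ []) tableTy → Code (tableTy ∷ list tupleTy ∷ stateTy ∷ []) valueTy →
          Code (tableTy ∷ list tupleTy ∷ stateTy ∷ int ∷ []) (list (int ⊗ int))
runWith i b = bind (loop (v3 -# int# 1ℤ) v0 (call i (i0 ∷ i2 ∷ [])))
                (snd# (call b (i0 ∷ i2 ∷ i3 ∷ [])))

runC : Code (tableTy ∷ list tupleTy ∷ stateTy ∷ int ∷ []) (list (int ⊗ int))
runC = runWith improveC bestC

-- Arguments: options, capacity, jobs, budget, some release time.
solveWith : Code (tupleTy ∷ int ∷ []) (list tupleTy) →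
            Code (tupleTy ∷ list tupleTy ∷ list indexedTy ∷ []) tableTy →
            Code (list indexedTy ∷ int ∷ []) stateTy →
            Code (tableTy ∷ list tupleTy ∷ stateTy ∷ int ∷ []) (list (int ⊗ int)) →
            Code (tupleTy ∷ int ∷ list indexedTy ∷ int ∷ int ∷ []) (list (int ⊗ int))
solveWith tup uni ini run =
  bind (bind (v1 +# v1 +# (v1 +# v1) +# int# 1ℤ)
         (bind (call tup (i1 ∷ i0 ∷ [])) (call uni (i2 ∷ i0 ∷ i4 ∷ []))))
    (bind (call tup (i1 ∷ i2 ∷ []))
      (bind (call ini (i4 ∷ i6 ∷ []))
        (call run (i2 ∷ i1 ∷ i0 ∷ i6 ∷ []))))

solveC : Code (tupleTy ∷ int ∷ list indexedTy ∷ int ∷ int ∷ []) (list (int ⊗ int))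
solveC = solveWith tuplesC universeC initialC runC

-- Arguments: some release time, jobs, capacity, budget.
mainWith : Code (list jobTy ∷ []) (list indexedTy) → Code (int ∷ []) (list int) →
           Code (list indexedTy ∷ list int ∷ []) tupleTy → Code (list jobTy ∷ []) int →
           Code (tupleTy ∷ int ∷ list indexedTy ∷ int ∷ int ∷ []) (list (int ⊗ int)) →
           Code (int ∷ list jobTy ∷ int ∷ int ∷ []) (list (int ⊗ int))
mainWith idx rng opt cnt slv =
  bind (call idx (i1 ∷ []))
    (bind (bind (call rng (i4 ∷ [])) (call opt (i1 ∷ i0 ∷ [])))
      (bind (bind (call cnt (i3 ∷ [])) (ite (var i5 ≤# v0) (var i5) v0))
        (call slv (i1 ∷ i0 ∷ i2 ∷ i6 ∷ i3 ∷ []))))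

mainC : Code (int ∷ list jobTy ∷ int ∷ int ∷ []) (list (int ⊗ int))
mainC = mainWith indexC rangeC optionsC countC solveC

bodyCtx mainCtx : Ctx
bodyCtx = int ∷ jobTy ∷ list jobTy ∷ list jobTy ∷ int ∷ int ∷ []
mainCtx = int ∷ list jobTy ∷ int ∷ int ∷ []

-- The minimum of the release times needs a seed, supplied by the first job. No jobs and no budget
-- are answered by the empty schedule; in particular K - 1 rounds make sense in the remaining case.
programWith : Tm bodyCtx (list (int ⊗ int)) → Program
programWith body = listCase (var i0) nil
  (ite (intLeq (var i4) (intLit 0ℤ)) nil (app (lam body) (fst (var i0))))

bodyWith : Code mainCtx (list (int ⊗ int)) →
           Tm bodyCtx (list (int ⊗ int))
bodyWith c = compile (call c (i0 ∷ i3 ∷ i4 ∷ i5 ∷ [])) id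

ι : Bool → ℕ
ι false = 0
ι true  = 1

-- Canonical schedules

false≢true : false ≢ true
false≢true ()

sum-mono : ∀ {n} {f g : Fin n → ℕ} → (∀ j → f j ≤ g j) → Σℕ.sum f ≤ Σℕ.sum g
sum-mono {zero}  h = z≤n
sum-mono {suc n} h = ℕ.+-mono-≤ (h zero) (sum-mono (h ∘ suc))

sum-mono-< : ∀ {n} {f g : Fin n → ℕ} → (∀ j → f j ≤ g j) → ∀ i → f i < g i → Σℕ.sum f < Σℕ.sum g
sum-mono-< h zero    l = ℕ.+-mono-<-≤ l (sum-mono (h ∘ suc))
sum-mono-< h (suc i) l = ℕ.+-mono-≤-< (h zero) (sum-mono-< (h ∘ suc) i l)

sumℚ-mono : ∀ {n} {f g : Fin n → ℚ} → (∀ j → f j ℚ.≤ g j) → Σℚ.sum f ℚ.≤ Σℚ.sum g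
sumℚ-mono {zero}  h = ℚ.≤-refl
sumℚ-mono {suc n} h = ℚ.+-mono-≤ (h zero) (sumℚ-mono (h ∘ suc))

sum-*ʳ : ∀ {n} (f : Fin n → ℕ) c → Σℕ.sum (λ j → f j * c) ≡ Σℕ.sum f * c
sum-*ʳ {zero}  f c = refl
sum-*ʳ {suc n} f c = trans (cong (f zero * c +_) (sum-*ʳ (f ∘ suc) c)) (sym (ℕ.*-distribʳ-+ c (f zero) _))

sum-*ˡ : ∀ {n} (f : Fin n → ℕ) c → Σℕ.sum (λ j → c * f j) ≡ c * Σℕ.sum f
sum-*ˡ f c = trans (Σℕ.sum-cong-≗ (λ j → ℕ.*-comm c (f j))) (trans (sum-*ʳ f c) (ℕ.*-comm _ c))

δ : ∀ {n} → Fin n → Fin n → Bool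
δ i j = does (i Fin.≟ j)

δ-refl : ∀ {n} (i : Fin n) → δ i i ≡ true
δ-refl i with i Fin.≟ i
... | yes _ = refl
... | no ¬e = ⊥-elim (¬e refl)

δ-true : ∀ {n} {i j : Fin n} → δ i j ≡ true → i ≡ j
δ-true {i = i} {j} h with i Fin.≟ j
... | yes e = e

δ-suc : ∀ {n} (i j : Fin n) → δ (suc i) (suc j) ≡ δ i j
δ-suc i j with i Fin.≟ j
... | yes _ = refl
... | no _  = refl

sum-zero : ∀ {n} {f : Fin n → ℕ} → (∀ j → f j ≡ 0) → Σℕ.sum f ≡ 0
sum-zero {n} h = trans (Σℕ.sum-cong-≗ h) (Σℕ.sum-replicate-zero n)

sum-δ : ∀ {n} (i : Fin n) (f : Fin n → ℕ) → Σℕ.sum (λ j → ι (δ i j) * f j) ≡ f i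
sum-δ zero f = trans (cong₂ _+_ (ℕ.+-identityʳ (f zero)) (sum-zero {f = λ j → ι (δ zero (suc j)) * f (suc j)} (λ _ → refl))) (ℕ.+-identityʳ _)
sum-δ (suc i) f = trans (Σℕ.sum-cong-≗ (λ j → cong (λ b → ι b * f (suc j)) (δ-suc i j))) (sum-δ i (f ∘ suc))

JobSet : ℕ → Set
JobSet n = Fin n → Bool

weigh : ∀ {n} → (Fin n → ℕ) → JobSet n → ℕ
weigh f A = Σℕ.sum (λ j → ι (A j) * f j)

∥_∥ : ∀ {n} → JobSet n → ℕ
∥ A ∥ = weigh (λ _ → 1) A

∥∥-sum : ∀ {n} (A : JobSet n) → ∥ A ∥ ≡ Σℕ.sum (ι ∘ A)
∥∥-sum A = Σℕ.sum-cong-≗ (λ j → ℕ.*-identityʳ (ι (A j)))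

∥∥-mono : ∀ {n} {A B : JobSet n} → (∀ j → A j ≡ true → B j ≡ true) → ∥ A ∥ ≤ ∥ B ∥
∥∥-mono {A = A} {B} h = sum-mono λ j → ℕ.*-monoˡ-≤ 1 (ι-mono (A j) (B j) (h j))
  where
  ι-mono : ∀ a b → (a ≡ true → b ≡ true) → ι a ≤ ι b
  ι-mono false b h = z≤n
  ι-mono true  b h rewrite h refl = s≤s z≤n

exchange : ∀ {n} → Fin n → Fin n → JobSet n → JobSet n
exchange a b A j = if δ a j then true else if δ b j then false else A j

module _ {n} {a b : Fin n} {A : JobSet n} (a≢b : a ≢ b) (Aa : A a ≡ false) (Ab : A b ≡ true) where

  exchange-ι : ∀ j → ι (exchange a b A j) + ι (δ b j) ≡ ι (A j) + ι (δ a j)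
  exchange-ι j with a Fin.≟ j | b Fin.≟ j
  ... | yes refl | yes refl = ⊥-elim (a≢b refl)
  ... | yes refl | no _     rewrite Aa = refl
  ... | no _     | yes refl rewrite Ab = refl
  ... | no _     | no _     = refl

  -- Additive form of "remove `f b`, add `f a`", which avoids truncated subtraction.
  exchange-weigh : ∀ f → weigh f (exchange a b A) + f b ≡ weigh f A + f a
  exchange-weigh f = begin
    weigh f (exchange a b A) + f b
      ≡⟨ cong (weigh f (exchange a b A) +_) (sum-δ b f) ⟨
    weigh f (exchange a b A) + weigh f (δ b)
      ≡⟨ Σℕ.∑-distrib-+ (λ j → ι (exchange a b A j) * f j) _ ⟨
    Σℕ.sum (λ j → ι (exchange a b A j) * f j + ι (δ b j) * f j)
      ≡⟨ Σℕ.sum-cong-≗ (λ j → trans (sym (ℕ.*-distribʳ-+ (f j) (ι (exchange a b A j)) _))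
           (trans (cong (_* f j) (exchange-ι j)) (ℕ.*-distribʳ-+ (f j) (ι (A j)) _))) ⟩
    Σℕ.sum (λ j → ι (A j) * f j + ι (δ a j) * f j)
      ≡⟨ Σℕ.∑-distrib-+ (λ j → ι (A j) * f j) _ ⟩
    weigh f A + weigh f (δ a)
      ≡⟨ cong (weigh f A +_) (sum-δ a f) ⟩
    weigh f A + f a ∎
    where open ≡-Reasoning

  exchange-∥∥ : ∥ exchange a b A ∥ ≡ ∥ A ∥
  exchange-∥∥ = ℕ.+-cancelʳ-≡ 1 _ _ (exchange-weigh (λ _ → 1))

exchange-∈ : ∀ {n} {a b : Fin n} {A : JobSet n} {j} → exchange a b A j ≡ true → a ≡ j ⊎ A j ≡ true
exchange-∈ {a = a} {b} {A} {j} h with a Fin.≟ j | b Fin.≟ j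
... | yes e | _     = inj₁ e
... | no _  | no _  = inj₂ h

record StrictTotalOrderᵇ (n : ℕ) : Set where
  field
    before  : Fin n → Fin n → Bool
    irrefl  : ∀ i → before i i ≡ false
    ≺-trans : ∀ i j k → before i j ≡ true → before j k ≡ true → before i k ≡ true
    total   : ∀ i j → i ≡ j ⊎ before i j ≡ true ⊎ before j i ≡ true

  infix 4 _≺_

  _≺_ : Fin n → Fin n → Set
  i ≺ j = before i j ≡ true

  ≺⇒≢ : ∀ {i j} → i ≺ j → i ≢ j
  ≺⇒≢ {i} h refl = false≢true (trans (sym (irrefl i)) h)

  rank : Fin n → ℕ
  rank j = Σℕ.sum (λ i → ι (before i j))

  rank-mono : ∀ {a b} → a ≺ b → rank a < rank b
  rank-mono {a} {b} h = sum-mono-< pointwise a strict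
    where
    pointwise : ∀ i → ι (before i a) ≤ ι (before i b)
    pointwise i with before i a in e
    ... | false = z≤n
    ... | true  rewrite ≺-trans i a b e h = s≤s z≤n
    strict : ι (before a a) < ι (before a b)
    strict rewrite irrefl a | h = s≤s z≤n

  Tidy : JobSet n → JobSet n → Set
  Tidy A B = ∀ a b → a ≺ b → A b ≡ true → A a ≡ false → B a ≡ true → B b ≡ true

Slot : ℕ → Set
Slot n = ℤ × JobSet n

count : ∀ {n} → Fin n → List (Slot n) → ℕ
count j []            = 0
count j ((_ , A) ∷ π) = ι (A j) + count j π

module Exchange {n} (order : StrictTotalOrderᵇ n) (r d : Fin n → ℤ) where
  open StrictTotalOrderᵇ order

  Canonical : List (Slot n) → Set
  Canonical = AllPairs (λ s s′ → Tidy (proj₂ s) (proj₂ s′))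

  InWindow : Slot n → Set
  InWindow (t , A) = ∀ j → A j ≡ true → r j ℤ.≤ t × t ℤ.≤ d j

  Increasing : List (Slot n) → Set
  Increasing = AllPairs (λ s s′ → proj₁ s ℤ.< proj₁ s′)

  data Give (a b : Fin n) : List (Slot n) → List (Slot n) → Set where
    here  : ∀ {t A π} → A a ≡ true → A b ≡ false → Give a b ((t , A) ∷ π) ((t , exchange b a A) ∷ π)
    there : ∀ {s π π′} → Give a b π π′ → Give a b (s ∷ π) (s ∷ π′)

  -- One exchange: a ≺ b, and b runs without a before a runs without b.
  data Step : List (Slot n) → List (Slot n) → Set where
    here  : ∀ {a b t A π π′} → a ≺ b → A b ≡ true → A a ≡ false → Give a b π π′ →
            Step ((t , A) ∷ π) ((t , exchange a b A) ∷ π′)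
    there : ∀ {s π π′} → Step π π′ → Step (s ∷ π) (s ∷ π′)

  tidy? : ∀ A B → Tidy A B ⊎ (∃[ a ] ∃[ b ] (a ≺ b × A b ≡ true × A a ≡ false × B a ≡ true × B b ≡ false))
  tidy? A B with Fin.any? (λ a → Fin.any? (λ b → (before a b Bool.≟ true) ×-dec (A b Bool.≟ true) ×-dec
                   (A a Bool.≟ false) ×-dec (B a Bool.≟ true) ×-dec (B b Bool.≟ false)))
  ... | yes v = inj₂ v
  ... | no ¬v = inj₁ (λ a b lt Ab Aa Ba → Bool.¬-not (λ Bb → ¬v (a , b , lt , Ab , Aa , Ba , Bb)))

  tidyHead : ∀ A π → All (λ s → Tidy A (proj₂ s)) π ⊎
             (∃[ a ] ∃[ b ] ∃[ π′ ] (a ≺ b × A b ≡ true × A a ≡ false × Give a b π π′))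
  tidyHead A [] = inj₁ []
  tidyHead A ((t , B) ∷ π) with tidy? A B
  ... | inj₂ (a , b , lt , Ab , Aa , Ba , Bb) = inj₂ (a , b , _ , lt , Ab , Aa , here Ba Bb)
  ... | inj₁ ok with tidyHead A π
  ...   | inj₁ oks = inj₁ (ok ∷ oks)
  ...   | inj₂ (a , b , _ , lt , Ab , Aa , g) = inj₂ (a , b , _ , lt , Ab , Aa , there g)

  canonical? : ∀ π → Canonical π ⊎ (∃[ π′ ] Step π π′)
  canonical? [] = inj₁ []
  canonical? ((t , A) ∷ π) with tidyHead A π
  ... | inj₂ (_ , _ , _ , lt , Ab , Aa , g) = inj₂ (_ , here lt Ab Aa g)
  ... | inj₁ ok with canonical? π
  ...   | inj₁ oks     = inj₁ (ok ∷ oks)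
  ...   | inj₂ (_ , s) = inj₂ (_ , there s)

  -- Every unit contributes the rank of its job times the number of slots from its own to the end.
  -- An exchange moves the smaller rank to the earlier slot, where the factor is larger, so the sum
  -- drops and rewriting terminates.
  potential : List (Slot n) → ℕ
  potential []            = 0
  potential ((t , A) ∷ π) = weigh rank A * suc (length π) + potential π

  give-length : ∀ {a b π π′} → Give a b π π′ → length π′ ≡ length π
  give-length (here _ _) = refl
  give-length (there g)  = cong suc (give-length g)

  step-length : ∀ {π π′} → Step π π′ → length π′ ≡ length π
  step-length (here _ _ _ g) = cong suc (give-length g)
  step-length (there s)      = cong suc (step-length s)

  module _ {a b} (a≺b : a ≺ b) where

    private
      e : ℕ
      e = proj₁ (ℕ.m≤n⇒∃[o]m+o≡n (rank-mono a≺b))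

      rank-b : rank b ≡ suc e + rank a
      rank-b = trans (sym (proj₂ (ℕ.m≤n⇒∃[o]m+o≡n (rank-mono a≺b)))) (cong suc (ℕ.+-comm (rank a) e))

      gain : ∀ {A} → A a ≡ true → A b ≡ false → weigh rank (exchange b a A) ≡ weigh rank A + suc e
      gain {A} Aa Ab = ℕ.+-cancelʳ-≡ (rank a) _ _
        (trans (exchange-weigh (≺⇒≢ a≺b ∘ sym) Ab Aa rank)
          (trans (cong (weigh rank A +_) rank-b) (sym (ℕ.+-assoc (weigh rank A) (suc e) (rank a)))))

      loss : ∀ {A} → A b ≡ true → A a ≡ false → weigh rank (exchange a b A) + suc e ≡ weigh rank A
      loss {A} Ab Aa = ℕ.+-cancelʳ-≡ (rank a) _ _
        (trans (ℕ.+-assoc _ (suc e) (rank a))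
          (trans (cong (weigh rank (exchange a b A) +_) (sym rank-b)) (exchange-weigh (≺⇒≢ a≺b) Aa Ab rank)))

    -- The later slot has a factor of at most `length π`, the earlier one a factor of
    -- `suc (length π)`: what is lost here is less than what `exchange-potential` wins back.
    give-potential : ∀ {π π′} → Give a b π π′ → potential π′ ≤ potential π + suc e * length π
    give-potential (here {t} {A} {π} Aa Ab) rewrite gain {A} Aa Ab =
      ℕ.≤-reflexive (solve 4 (λ w x l q → (w :+ x) :* l :+ q := w :* l :+ q :+ x :* l) refl
        (weigh rank A) (suc e) (suc (length π)) (potential π))
      where open +-*-Solver
    give-potential (there {t , A} {π} {π′} g) rewrite give-length g = begin
      w + potential π′ ≤⟨ ℕ.+-monoʳ-≤ w (give-potential g) ⟩
      w + (potential π + suc e * length π) ≡⟨ ℕ.+-assoc w _ _ ⟨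
      w + potential π + suc e * length π ≤⟨ ℕ.+-monoʳ-≤ (w + potential π) (ℕ.*-monoʳ-≤ (suc e) (ℕ.n≤1+n _)) ⟩
      w + potential π + suc e * suc (length π)   ∎
      where
      open ℕ.≤-Reasoning
      w : ℕ
      w = weigh rank A * suc (length π)

    exchange-potential : ∀ {t A π π′} → A b ≡ true → A a ≡ false → Give a b π π′ →
                         potential ((t , exchange a b A) ∷ π′) < potential ((t , A) ∷ π)
    exchange-potential {t} {A} {π} {π′} Ab Aa g
      rewrite give-length g | sym (loss {A} Ab Aa) = begin-strict
        w * l + potential π′ ≤⟨ ℕ.+-monoʳ-≤ (w * l) (give-potential g) ⟩
        w * l + (potential π + suc e * length π) <⟨ ℕ.+-monoʳ-< (w * l) (ℕ.+-monoʳ-< (potential π) (ℕ.*-monoʳ-< (suc e) (ℕ.n<1+n (length π)))) ⟩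
        w * l + (potential π + suc e * l) ≡⟨ solve 4 (λ w x l q → w :* l :+ (q :+ x :* l) := (w :+ x) :* l :+ q) refl
                                                      w (suc e) l (potential π) ⟩
        (w + suc e) * l + potential π            ∎
      where
      open ℕ.≤-Reasoning
      open +-*-Solver
      w l : ℕ
      w = weigh rank (exchange a b A)
      l = suc (length π)

  step-potential : ∀ {π π′} → Step π π′ → potential π′ < potential π
  step-potential (here {t = t} lt Ab Aa g) = exchange-potential lt {t} Ab Aa g
  step-potential (there {t , A} {π} {π′} s) rewrite step-length s =
    ℕ.+-monoʳ-< (weigh rank A * suc (length π)) (step-potential s)

  give-count : ∀ {a b π π′} → a ≢ b → Give a b π π′ → ∀ j → count j π′ + ι (δ a j) ≡ count j π + ι (δ b j)
  give-count {a} {b} a≢b (here {t} {A} {π} Aa Ab) j = begin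
    ι (exchange b a A j) + count j π + ι (δ a j) ≡⟨ shuffle (ι (exchange b a A j)) (count j π) (ι (δ a j)) ⟩
    ι (exchange b a A j) + ι (δ a j) + count j π ≡⟨ cong (_+ count j π) (exchange-ι (a≢b ∘ sym) Ab Aa j) ⟩
    ι (A j) + ι (δ b j) + count j π ≡⟨ shuffle (ι (A j)) (ι (δ b j)) (count j π) ⟩
    ι (A j) + count j π + ι (δ b j)              ∎
    where
    open ≡-Reasoning
    open +-*-Solver
    shuffle : ∀ x y z → x + y + z ≡ x + z + y
    shuffle = solve 3 (λ x y z → x :+ y :+ z := x :+ z :+ y) refl
  give-count a≢b (there {t , A} g) j =
    trans (ℕ.+-assoc (ι (A j)) _ _) (trans (cong (ι (A j) +_) (give-count a≢b g j)) (sym (ℕ.+-assoc (ι (A j)) _ _)))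

  step-count : ∀ {π π′} → Step π π′ → ∀ j → count j π′ ≡ count j π
  step-count (here {a} {b} {t} {A} {π} {π′} lt Ab Aa g) j = ℕ.+-cancelʳ-≡ (ι (δ a j) + ι (δ b j)) _ _ (begin
    x + count j π′ + (ι (δ a j) + ι (δ b j)) ≡⟨ shuffle x (count j π′) (ι (δ a j)) (ι (δ b j)) ⟩
    x + ι (δ b j) + (count j π′ + ι (δ a j)) ≡⟨ cong₂ _+_ (exchange-ι (≺⇒≢ lt) Aa Ab j) (give-count (≺⇒≢ lt) g j) ⟩
    ι (A j) + ι (δ a j) + (count j π + ι (δ b j)) ≡⟨ solve 4 (λ x y z w → x :+ y :+ (z :+ w) := x :+ z :+ (y :+ w)) refl
                                                     (ι (A j)) (ι (δ a j)) (count j π) (ι (δ b j)) ⟩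
    ι (A j) + count j π + (ι (δ a j) + ι (δ b j)) ∎)
    where
    open ≡-Reasoning
    open +-*-Solver
    x : ℕ
    x = ι (exchange a b A j)
    shuffle : ∀ x y z w → x + y + (z + w) ≡ x + w + (y + z)
    shuffle = solve 4 (λ x y z w → x :+ y :+ (z :+ w) := x :+ w :+ (y :+ z)) refl
  step-count (there {t , A} s) j = cong (ι (A j) +_) (step-count s j)

  give-times : ∀ {a b π π′} → Give a b π π′ → map proj₁ π′ ≡ map proj₁ π
  give-times (here _ _) = refl
  give-times (there g)  = cong (_ ∷_) (give-times g)

  step-times : ∀ {π π′} → Step π π′ → map proj₁ π′ ≡ map proj₁ π
  step-times (here _ _ _ g) = cong (_ ∷_) (give-times g)
  step-times (there s)      = cong (_ ∷_) (step-times s)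

  give-size : ∀ {a b c π π′} → a ≢ b → Give a b π π′ → All (λ s → ∥ proj₂ s ∥ ≤ c) π → All (λ s → ∥ proj₂ s ∥ ≤ c) π′
  give-size {c = c} a≢b (here Aa Ab) (x ∷ xs) = subst (_≤ c) (sym (exchange-∥∥ (a≢b ∘ sym) Ab Aa)) x ∷ xs
  give-size a≢b (there g) (x ∷ xs) = x ∷ give-size a≢b g xs

  step-size : ∀ {c π π′} → Step π π′ → All (λ s → ∥ proj₂ s ∥ ≤ c) π → All (λ s → ∥ proj₂ s ∥ ≤ c) π′
  step-size {c} (here lt Ab Aa g) (x ∷ xs) =
    subst (_≤ c) (sym (exchange-∥∥ (≺⇒≢ lt) Aa Ab)) x ∷ give-size (≺⇒≢ lt) g xs
  step-size (there s) (x ∷ xs) = x ∷ step-size s xs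

  module _ (agreeable : ∀ {i j t} → i ≺ j → r j ℤ.≤ t → t ℤ.≤ d j → r i ℤ.≤ r j × d i ℤ.≤ d j) where

    -- Agreeable windows are needed here: b moves to a slot u > t of a, and u ≤ d_a ≤ d_b. The
    -- second conclusion, t ≤ d_a, holds because a was allowed at u; it is what lets a move to t.
    give-window : ∀ {a b t π π′} → a ≺ b → r b ℤ.≤ t → t ℤ.≤ d b → All (λ s → t ℤ.< proj₁ s) π →
                  Give a b π π′ → All InWindow π → All InWindow π′ × t ℤ.≤ d a
    give-window {a} {b} {t} lt rb db (t<u ∷ _) (here {u} {A} Aa Ab) (wn ∷ wns) =
      (λ j h → new j (exchange-∈ {b = a} {A = A} h)) ∷ wns , ℤ.≤-trans (ℤ.<⇒≤ t<u) (proj₂ (wn a Aa))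
      where
      new : ∀ j → b ≡ j ⊎ A j ≡ true → r j ℤ.≤ u × u ℤ.≤ d j
      new j (inj₁ refl) = ℤ.≤-trans rb (ℤ.<⇒≤ t<u) ,
                            ℤ.≤-trans (proj₂ (wn a Aa)) (proj₂ (agreeable lt rb db))
      new j (inj₂ h)    = wn j h
    give-window lt rb db (_ ∷ ts) (there g) (wn ∷ wns) with give-window lt rb db ts g wns
    ... | wns′ , da = wn ∷ wns′ , da

    step-window : ∀ {π π′} → Step π π′ → Increasing π → All InWindow π → All InWindow π′
    step-window (here {a} {b} {t} {A} lt Ab Aa g) (ts ∷ _) (wn ∷ wns)
      with give-window lt (proj₁ (wn b Ab)) (proj₂ (wn b Ab)) ts g wns
    ... | wns′ , da = (λ j h → new j (exchange-∈ {b = b} {A = A} h)) ∷ wns′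
      where
      new : ∀ j → a ≡ j ⊎ A j ≡ true → r j ℤ.≤ t × t ℤ.≤ d j
      new j (inj₁ refl) = ℤ.≤-trans (proj₁ (agreeable lt (proj₁ (wn b Ab)) (proj₂ (wn b Ab)))) (proj₁ (wn b Ab)) , da
      new j (inj₂ h)    = wn j h
    step-window (there s) (_ ∷ inc) (wn ∷ wns) = wn ∷ step-window s inc wns

    increasing-times : ∀ {π π′ : List (Slot n)} → map proj₁ π′ ≡ map proj₁ π → Increasing π → Increasing π′
    increasing-times {π} {π′} e inc = AllPairs.map⁻ (subst (AllPairs ℤ._<_) (sym e) (AllPairs.map⁺ inc))

    record Rearranged (c : ℕ) (π π′ : List (Slot n)) : Set where
      field
        canonical  : Canonical π′
        increasing : Increasing π′
        windows    : All InWindow π′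
        sizes      : All (λ s → ∥ proj₂ s ∥ ≤ c) π′
        times      : map proj₁ π′ ≡ map proj₁ π
        counts     : ∀ j → count j π′ ≡ count j π

    -- Exchanges are applied until none is possible. They change neither the times nor the number of
    -- units of a job, so the budget and the set of completed jobs survive.
    canonicalise : ∀ c π → Increasing π → All InWindow π → All (λ s → ∥ proj₂ s ∥ ≤ c) π →
                   ∃[ π′ ] Rearranged c π π′
    canonicalise c π = go π (<-wellFounded (potential π))
      where
      go : ∀ π → Acc _<_ (potential π) → Increasing π → All InWindow π → All (λ s → ∥ proj₂ s ∥ ≤ c) π →
           ∃[ π′ ] Rearranged c π π′
      go π (acc rs) inc wn sz with canonical? π
      ... | inj₁ can = π , record { canonical = can ; increasing = inc ; windows = wn ; sizes = sz
                                  ; times = refl ; counts = λ _ → refl }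
      ... | inj₂ (π₁ , s) with go π₁ (rs (step-potential s)) (increasing-times (step-times s) inc)
                                 (step-window s inc wn) (step-size s sz)
      ...   | π₂ , R = π₂ , record { Rearranged R
                                   ; times = trans (Rearranged.times R) (step-times s)
                                   ; counts = λ j → trans (Rearranged.counts R j) (step-count s j) }

-- Denotations of the step functions

does⁻ : ∀ {P : Set} (P? : Dec P) → does P? ≡ true → P
does⁻ (yes p) _ = p

does⁺ : ∀ {P : Set} (P? : Dec P) → P → does P? ≡ true
does⁺ P? p = dec-true P? p

if-true : ∀ {X : Set} {b} {x y : X} → b ≡ true → (if b then x else y) ≡ x
if-true refl = refl

if-false : ∀ {X : Set} {b} {x y : X} → b ≡ false → (if b then x else y) ≡ y
if-false refl = refl

if-and : ∀ {a b} → (if a then b else false) ≡ true → a ≡ true × b ≡ true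
if-and {true} h = refl , h

infix 5 _==_

_==_ : ℤ → ℤ → Bool
i == j = if does (i ℤ.≤? j) then does (j ℤ.≤? i) else false

==-sound : ∀ {i j} → i == j ≡ true → i ≡ j
==-sound {i} {j} h with i ℤ.≤? j
... | yes i≤j = ℤ.≤-antisym i≤j (does⁻ (j ℤ.≤? i) h)

==-refl : ∀ i → i == i ≡ true
==-refl i = trans (if-true (does⁺ (i ℤ.≤? i) ℤ.≤-refl)) (does⁺ (i ℤ.≤? i) ℤ.≤-refl)

==-false : ∀ {i j} → i ≢ j → i == j ≡ false
==-false {i} {j} i≢j = Bool.¬-not (λ h → i≢j (==-sound h))

==-toℕ : ∀ {n} (i j : Fin n) → (ℤ.+ toℕ i == ℤ.+ toℕ j) ≡ δ i j
==-toℕ i j with i Fin.≟ j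
... | yes refl = ==-refl (ℤ.+ toℕ i)
... | no i≢j   = ==-false (i≢j ∘ Fin.toℕ-injective ∘ ℤ.+-injective)

-- The loop bodies of `validC` and `closesC`, with the accumulator y at several leaves. The
-- equations below collect these leaves into one test, the form that the fold lemmas expect.
allStep anyStep : Bool → Bool → Bool → Bool → Bool
allStep a b c y = if a then (if b then (if c then y else false) else false) else y
anyStep a b c y = if a then (if b then (if c then true else y) else y) else y

allStep-≡ : ∀ a b c y → allStep a b c y ≡ (if allStep a b c true then y else false)
allStep-≡ true  true  true  y = refl
allStep-≡ true  true  false y = refl
allStep-≡ true  false _     y = refl
allStep-≡ false _     _     y = refl

anyStep-≡ : ∀ a b c y → anyStep a b c y ≡ (if anyStep a b c false then true else y)
anyStep-≡ true  true  true  y = refl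
anyStep-≡ true  true  false y = refl
anyStep-≡ true  false _     y = refl
anyStep-≡ false _     _     y = refl

module _ {X : Set} (f : X → Bool → Bool) (good : X → Bool) where

  any-fold⁺ : (∀ x y → f x y ≡ (if good x then true else y)) →
              ∀ {x xs} → x ∈ xs → good x ≡ true → foldr f false xs ≡ true
  any-fold⁺ h {xs = x ∷ xs} (here refl) g = trans (h x _) (if-true g)
  any-fold⁺ h {xs = x ∷ xs} (there i) g with good x | h x (foldr f false xs)
  ... | true  | e = e
  ... | false | e = trans e (any-fold⁺ h i g)

  any-fold⁻ : (∀ x y → f x y ≡ (if good x then true else y)) →
              ∀ xs → foldr f false xs ≡ true → ∃[ x ] (x ∈ xs × good x ≡ true)
  any-fold⁻ h (x ∷ xs) t with good x in e | h x (foldr f false xs)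
  ... | true  | _  = x , here refl , e
  ... | false | e′ with any-fold⁻ h xs (trans (sym e′) t)
  ...   | y , i , g = y , there i , g

  all-fold⁺ : (∀ x y → f x y ≡ (if good x then y else false)) →
              ∀ xs → (∀ x → x ∈ xs → good x ≡ true) → foldr f true xs ≡ true
  all-fold⁺ h []       g = refl
  all-fold⁺ h (x ∷ xs) g =
    trans (h x _) (trans (if-true (g x (here refl))) (all-fold⁺ h xs (λ y i → g y (there i))))

  all-fold⁻ : (∀ x y → f x y ≡ (if good x then y else false)) →
              ∀ xs → foldr f true xs ≡ true → ∀ x → x ∈ xs → good x ≡ true
  all-fold⁻ h (x ∷ xs) t y i with good x in e | h x (foldr f true xs)
  all-fold⁻ h (x ∷ xs) t y (here refl) | true | e′ = e
  all-fold⁻ h (x ∷ xs) t y (there i) | true | e′ = all-fold⁻ h xs (trans (sym e′) t) y i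
  all-fold⁻ h (x ∷ xs) t y i | false | e′ = ⊥-elim (false≢true (trans (sym e′) t))

foldr-cons : ∀ {X Y : Set} (h : X → Y) xs → foldr (λ x ys → h x ∷ ys) [] xs ≡ map h xs
foldr-cons h []       = refl
foldr-cons h (x ∷ xs) = cong (h x ∷_) (foldr-cons h xs)

foldr-tabulate-sum : ∀ {n} {X : Set} (f : X → ℚ → ℚ) (g : Fin n → X) (c : Fin n → ℚ) →
                     (∀ j y → f (g j) y ≡ c j ℚ.+ y) → foldr f 0ℚ (tabulate g) ≡ Σℚ.sum c
foldr-tabulate-sum {zero}  f g c h = refl
foldr-tabulate-sum {suc n} f g c h =
  trans (h zero _) (cong (c zero ℚ.+_) (foldr-tabulate-sum f (g ∘ suc) (c ∘ suc) (h ∘ suc)))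

Tuple State Value Table : Set
Tuple = ⟦ tupleTy ⟧
State = ⟦ stateTy ⟧
Value = ⟦ valueTy ⟧
Table = ⟦ tableTy ⟧

-- From here on the step functions are used only through the equations proved in the blocks that
-- unfold them, which keeps the nested denotations from being expanded.
opaque
  slotAfter : State → Tuple → ℤ
  slotAfter (t , _) A = val nextSlotC (t ∷ A ∷ [])

  valid : State → Tuple → Bool
  valid u A = val validC (slotAfter u A ∷ proj₂ u ∷ A ∷ [])

  successor : State → Tuple → State
  successor u A = val successorC (slotAfter u A ∷ proj₂ u ∷ A ∷ [])

  gain : State → Tuple → ℚ
  gain u A = val gainC (proj₂ u ∷ A ∷ [])

  sameState : State → State → Bool
  sameState u v = val sameStateC (u ∷ v ∷ [])

  lookup : Table → State → Value
  lookup T u = val lookupC (T ∷ u ∷ [])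

  best : Table → List Tuple → State → Value
  best T As u = val bestC (T ∷ As ∷ u ∷ [])

emitSlot : ℤ → Tuple → List (ℤ × ℤ) → List (ℤ × ℤ)
emitSlot t A out = foldr (λ x acc → (t , proj₁ (proj₁ x)) ∷ acc) out A

emit : List (ℤ × Tuple) → List (ℤ × ℤ)
emit []            = []
emit ((t , A) ∷ π) = emitSlot t A (emit π)

worthless : Value
worthless = 0ℚ , []

better : Value → Value → Value
better v w = if does (proj₁ v ℚ.≤? proj₁ w) then w else v

better-cases : ∀ v w → better v w ≡ v ⊎ better v w ≡ w
better-cases v w with does (proj₁ v ℚ.≤? proj₁ w)
... | true  = inj₂ refl
... | false = inj₁ refl

better-≥ˡ : ∀ v w → proj₁ v ℚ.≤ proj₁ (better v w)
better-≥ˡ v w with does (proj₁ v ℚ.≤? proj₁ w) in e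
... | true  = does⁻ (proj₁ v ℚ.≤? proj₁ w) e
... | false = ℚ.≤-refl

better-≥ʳ : ∀ v w → proj₁ w ℚ.≤ proj₁ (better v w)
better-≥ʳ v w with does (proj₁ v ℚ.≤? proj₁ w) in e
... | true  = ℚ.≤-refl
... | false = ℚ.<⇒≤ (ℚ.≰⇒> λ le → false≢true (trans (sym e) (does⁺ (proj₁ v ℚ.≤? proj₁ w) le)))

opaque
  unfolding slotAfter

  candidate : Table → State → Tuple → Value
  candidate T u A = val candidateC (T ∷ u ∷ A ∷ [])

  candidate-valid : ∀ T u A → valid u A ≡ true → candidate T u A ≡
    (gain u A ℚ.+ proj₁ (lookup T (successor u A)) ,
     emitSlot (slotAfter u A) A (proj₂ (lookup T (successor u A))))
  candidate-valid T u A v = if-true v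

  candidate-invalid : ∀ T u A → valid u A ≡ false → candidate T u A ≡ worthless
  candidate-invalid T u A v = if-false v

  lookup-[] : ∀ u → lookup [] u ≡ worthless
  lookup-[] u = refl

  lookup-∷ : ∀ e T u → lookup (e ∷ T) u ≡ (if sameState (proj₁ e) u then proj₂ e else lookup T u)
  lookup-∷ e T u = refl

  best-[] : ∀ T u → best T [] u ≡ worthless
  best-[] T u = refl

  best-∷ : ∀ T A As u → best T (A ∷ As) u ≡ better (best T As u) (candidate T u A)
  best-∷ T A As u = refl

-- Step functions on the states of an instance

module Spec (I : Instance) where
  open Instance I

  job : Fin n → ⟦ indexedTy ⟧
  job j = ℤ.+ toℕ j , r j , d j , ℤ.+ p j , w j

  entry : Fin n × ℕ → ⟦ optionTy ⟧
  entry (j , c) = job j , ℤ.+ c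

  jobs : List ⟦ indexedTy ⟧
  jobs = tabulate job

  encode : (Fin n → ℕ) → Tuple
  encode R = tabulate (λ j → entry (j , R j))

  tuple : List (Fin n × ℕ) → Tuple
  tuple = map entry

  before : Fin n → Fin n → Bool
  before i j = val (before# v0 v1) (job i ∷ job j ∷ [])

  _≺′_ : Fin n → Fin n → Set
  i ≺′ j = r i ℤ.< r j ⊎ (r i ≡ r j × toℕ i < toℕ j)

  before⁻ : ∀ i j → before i j ≡ true → i ≺′ j
  before⁻ i j h with r i ℤ.≤? r j
  ... | yes i≤j with r j ℤ.≤? r i
  ...   | no  j≰i = inj₁ (ℤ.≰⇒> j≰i)
  ...   | yes j≤i = inj₂ (ℤ.≤-antisym i≤j j≤i ,
      subst (_≤ toℕ j) (ℕ.+-comm (toℕ i) 1) (ℤ.drop‿+≤+ (does⁻ (ℤ.+ (toℕ i + 1) ℤ.≤? ℤ.+ toℕ j) h)))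

  before⁺ : ∀ i j → i ≺′ j → before i j ≡ true
  before⁺ i j (inj₁ lt) =
    trans (if-true (does⁺ (r i ℤ.≤? r j) (ℤ.<⇒≤ lt))) (if-false (dec-false (r j ℤ.≤? r i) (ℤ.<⇒≱ lt)))
  before⁺ i j (inj₂ (e , lt)) =
    trans (if-true (does⁺ (r i ℤ.≤? r j) (ℤ.≤-reflexive e)))
      (trans (if-true (does⁺ (r j ℤ.≤? r i) (ℤ.≤-reflexive (sym e))))
        (does⁺ (ℤ.+ (toℕ i + 1) ℤ.≤? ℤ.+ toℕ j) (ℤ.+≤+ (subst (_≤ toℕ j) (ℕ.+-comm 1 (toℕ i)) lt))))

  order : StrictTotalOrderᵇ n
  order = record { before = before ; irrefl = irr ; ≺-trans = tr ; total = tot }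
    where
    irr : ∀ i → before i i ≡ false
    irr i = Bool.¬-not λ h → absurd (before⁻ i i h)
      where
      absurd : ¬ (i ≺′ i)
      absurd (inj₁ lt)       = ℤ.<-irrefl refl lt
      absurd (inj₂ (_ , lt)) = ℕ.<-irrefl refl lt
    tr : ∀ i j k → before i j ≡ true → before j k ≡ true → before i k ≡ true
    tr i j k a b = before⁺ i k (compose (before⁻ i j a) (before⁻ j k b))
      where
      compose : i ≺′ j → j ≺′ k → i ≺′ k
      compose (inj₁ x) (inj₁ y) = inj₁ (ℤ.<-trans x y)
      compose (inj₁ x) (inj₂ (e , _)) = inj₁ (subst (r i ℤ.<_) e x)
      compose (inj₂ (e , _)) (inj₁ y) = inj₁ (subst (ℤ._< r k) (sym e) y)
      compose (inj₂ (e , x)) (inj₂ (e′ , y)) = inj₂ (trans e e′ , ℕ.<-trans x y)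
    tot : ∀ i j → i ≡ j ⊎ before i j ≡ true ⊎ before j i ≡ true
    tot i j with ℤ.<-cmp (r i) (r j)
    ... | tri< a _ _ = inj₂ (inj₁ (before⁺ i j (inj₁ a)))
    ... | tri> _ _ c = inj₂ (inj₂ (before⁺ j i (inj₁ c)))
    ... | tri≈ _ e _ with ℕ.<-cmp (toℕ i) (toℕ j)
    ...   | tri< a _ _ = inj₂ (inj₁ (before⁺ i j (inj₂ (e , a))))
    ...   | tri≈ _ b _ = inj₁ (Fin.toℕ-injective b)
    ...   | tri> _ _ c = inj₂ (inj₂ (before⁺ j i (inj₂ (sym e , c))))

  open StrictTotalOrderᵇ order using (_≺_)

  mem : List (Fin n × ℕ) → JobSet n
  mem []            j = false
  mem ((i , c) ∷ T) j = if δ i j then true else mem T j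

  mem-∈ : ∀ {T j c} → (j , c) ∈ T → mem T j ≡ true
  mem-∈ {(i , _) ∷ T} (here refl) = if-true (δ-refl i)
  mem-∈ {(i , _) ∷ T} {j} (there k) with δ i j
  ... | true  = refl
  ... | false = mem-∈ k

  mem-∈⁻ : ∀ T {j} → mem T j ≡ true → ∃[ c ] (j , c) ∈ T
  mem-∈⁻ ((i , c) ∷ T) {j} h with δ i j in e
  ... | true  rewrite δ-true {i = i} e = c , here refl
  ... | false with mem-∈⁻ T h
  ...   | c′ , k = c′ , there k

  memberC-mem : ∀ T j → val memberC (job j ∷ tuple T ∷ []) ≡ mem T j
  memberC-mem []            j = refl
  memberC-mem ((i , c) ∷ T) j rewrite ==-toℕ i j | memberC-mem T j = refl

  -- Only an inequality, because the enumerated tuples may list a job more than once.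
  mem-size : ∀ T → ∥ mem T ∥ ≤ length T
  mem-size []            = ℕ.≤-reflexive (sum-zero {n} (λ _ → refl))
  mem-size ((i , c) ∷ T) = begin
    ∥ mem ((i , c) ∷ T) ∥ ≤⟨ sum-mono pointwise ⟩
    Σℕ.sum (λ j → ι (δ i j) * 1 + ι (mem T j) * 1)
      ≡⟨ Σℕ.∑-distrib-+ (λ j → ι (δ i j) * 1) _ ⟩
    ∥ δ i ∥ + ∥ mem T ∥ ≡⟨ cong (_+ ∥ mem T ∥) (sum-δ i (λ _ → 1)) ⟩
    1 + ∥ mem T ∥ ≤⟨ s≤s (mem-size T) ⟩
    suc (length T)               ∎
    where
    open ℕ.≤-Reasoning
    pointwise : ∀ j → ι (mem ((i , c) ∷ T) j) * 1 ≤ ι (δ i j) * 1 + ι (mem T j) * 1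
    pointwise j with δ i j
    ... | true  = s≤s z≤n
    ... | false = ℕ.≤-refl

  Valid : ℤ → (Fin n → ℕ) → List (Fin n × ℕ) → Set
  Valid t R T = ∀ j → mem T j ≡ true → 1 ≤ R j × t ℤ.≤ d j

  private
    goodJob : ℤ → List (Fin n × ℕ) → ⟦ optionTy ⟧ → Bool → Bool
    goodJob t T x = allStep (val memberC (proj₁ x ∷ tuple T ∷ [])) (does (1ℤ ℤ.≤? proj₂ x))
                            (does (t ℤ.≤? proj₁ (proj₂ (proj₂ (proj₁ x)))))

    goodJob-≡ : ∀ t T x y → goodJob t T x y ≡ (if goodJob t T x true then y else false)
    goodJob-≡ t T x = allStep-≡ (val memberC (proj₁ x ∷ tuple T ∷ [])) (does (1ℤ ℤ.≤? proj₂ x))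
      (does (t ℤ.≤? proj₁ (proj₂ (proj₂ (proj₁ x)))))

  validC⁻ : ∀ t R T → val validC (t ∷ encode R ∷ tuple T ∷ []) ≡ true → Valid t R T
  validC⁻ t R T h j m = unpack (all-fold⁻ (goodJob t T) (λ x → goodJob t T x true) (goodJob-≡ t T) (encode R) h _
                                  (∈-tabulate⁺ j))
    where
    unpack : goodJob t T (entry (j , R j)) true ≡ true → 1 ≤ R j × t ℤ.≤ d j
    unpack g rewrite memberC-mem T j | m with if-and g
    ... | a , b = ℤ.drop‿+≤+ (does⁻ (1ℤ ℤ.≤? ℤ.+ R j) a) , does⁻ (t ℤ.≤? d j) (proj₁ (if-and b))

  validC⁺ : ∀ t R T → Valid t R T → val validC (t ∷ encode R ∷ tuple T ∷ []) ≡ true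
  validC⁺ t R T v = all-fold⁺ (goodJob t T) (λ x → goodJob t T x true) (goodJob-≡ t T) (encode R) λ x i → good x (∈-tabulate⁻ i)
    where
    good : ∀ x → ∃[ j ] x ≡ entry (j , R j) → goodJob t T x true ≡ true
    good _ (j , refl) rewrite memberC-mem T j with mem T j in e
    ... | false = refl
    ... | true  = trans (if-true (does⁺ (1ℤ ℤ.≤? ℤ.+ R j) (ℤ.+≤+ (proj₁ (v j e)))))
                    (if-true (does⁺ (t ℤ.≤? d j) (proj₂ (v j e))))

  closes : (Fin n → ℕ) → List (Fin n × ℕ) → JobSet n
  closes R T j = val closesC (job j ∷ encode R ∷ tuple T ∷ [])

  private
    closing : Fin n → List (Fin n × ℕ) → ⟦ optionTy ⟧ → Bool → Bool
    closing j T x = anyStep (val memberC (proj₁ x ∷ tuple T ∷ [])) (does (proj₂ x ℤ.≤? 1ℤ))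
                            (val (before# v0 v1) (job j ∷ proj₁ x ∷ []))

    closing-≡ : ∀ j T x y → closing j T x y ≡ (if closing j T x false then true else y)
    closing-≡ j T x = anyStep-≡ (val memberC (proj₁ x ∷ tuple T ∷ [])) (does (proj₂ x ℤ.≤? 1ℤ))
      (val (before# v0 v1) (job j ∷ proj₁ x ∷ []))

  closes⁻ : ∀ R T j → closes R T j ≡ true → ∃[ i ] (mem T i ≡ true × R i ≤ 1 × j ≺ i)
  closes⁻ R T j h with any-fold⁻ (closing j T) (λ x → closing j T x false) (closing-≡ j T) (encode R) h
  ... | x , k , g with ∈-tabulate⁻ k
  ... | i , refl = i , unpack g
    where
    unpack : closing j T (entry (i , R i)) false ≡ true → mem T i ≡ true × R i ≤ 1 × j ≺ i
    unpack g rewrite memberC-mem T i with if-and g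
    ... | a , b with if-and b
    ... | b , c = a , ℤ.drop‿+≤+ (does⁻ (ℤ.+ R i ℤ.≤? 1ℤ) b) , proj₁ (if-and c)

  closes⁺ : ∀ R T {i j} → mem T i ≡ true → R i ≤ 1 → j ≺ i → closes R T j ≡ true
  closes⁺ R T {i} {j} m le lt = any-fold⁺ (closing j T) (λ x → closing j T x false) (closing-≡ j T) (∈-tabulate⁺ i) good
    where
    good : closing j T (entry (i , R i)) false ≡ true
    good rewrite memberC-mem T i | m =
      trans (if-true (does⁺ (ℤ.+ R i ℤ.≤? 1ℤ) (ℤ.+≤+ le))) (if-true lt)

  next : (Fin n → ℕ) → List (Fin n × ℕ) → Fin n → ℕ
  next R T j = if mem T j then R j ∸ 1 else (if closes R T j then 0 else R j)

  successorC-next : ∀ {t} R T → Valid t R T →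
                    val successorC (t ∷ encode R ∷ tuple T ∷ []) ≡ (t , encode (next R T))
  successorC-next {t} R T v =
    cong (t ,_) (trans (foldr-cons _ (encode R)) (trans (List.map-tabulate _ _) (List.tabulate-cong pointwise)))
    where
    -- Validity excludes remaining work 0, for which integer subtraction and `∸` would disagree.
    pred-+ : ∀ {c} → 1 ≤ c → ℤ.+ c ℤ.- 1ℤ ≡ ℤ.+ (c ∸ 1)
    pred-+ (s≤s _) = refl
    pointwise : ∀ j → (job j , (if val memberC (job j ∷ tuple T ∷ []) then ℤ.+ R j ℤ.- 1ℤ
                  else (if closes R T j then 0ℤ else ℤ.+ R j))) ≡ entry (j , next R T j)
    pointwise j rewrite memberC-mem T j with mem T j in e | closes R T j
    ... | true  | _     = cong (job j ,_) (pred-+ (proj₁ (v j e)))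
    ... | false | true  = refl
    ... | false | false = refl

  gains : (Fin n → ℕ) → List (Fin n × ℕ) → Fin n → ℚ
  gains R T j = if mem T j then (if does (ℤ.+ R j ℤ.≤? 1ℤ) then w j else 0ℚ) else 0ℚ

  gainC-sum : ∀ R T → val gainC (encode R ∷ tuple T ∷ []) ≡ Σℚ.sum (gains R T)
  gainC-sum R T = foldr-tabulate-sum _ (λ j → entry (j , R j)) (gains R T) pointwise
    where
    pointwise : ∀ j y → (if val memberC (job j ∷ tuple T ∷ [])
                          then (if does (ℤ.+ R j ℤ.≤? 1ℤ) then w j ℚ.+ y else y) else y) ≡ gains R T j ℚ.+ y
    pointwise j y rewrite memberC-mem T j with mem T j | does (ℤ.+ R j ℤ.≤? 1ℤ)
    ... | true  | true  = refl
    ... | true  | false = sym (ℚ.+-identityˡ y)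
    ... | false | _     = sym (ℚ.+-identityˡ y)

  nextSlot : ℤ → List (Fin n × ℕ) → ℤ
  nextSlot t T = val nextSlotC (t ∷ tuple T ∷ [])

  nextSlot-> : ∀ t T → t ℤ.< nextSlot t T
  nextSlot-> t [] = ℤ.suc[i]≤j⇒i<j (ℤ.≤-reflexive (ℤ.+-comm 1ℤ t))
  nextSlot-> t ((i , c) ∷ T) with nextSlot t T ℤ.≤? r i
  ... | yes le = ℤ.<-≤-trans (nextSlot-> t T) le
  ... | no  _  = nextSlot-> t T

  nextSlot-released : ∀ t T {j} → mem T j ≡ true → r j ℤ.≤ nextSlot t T
  nextSlot-released t ((i , c) ∷ T) {j} h with nextSlot t T ℤ.≤? r i | δ i j in e
  ... | yes le | true  rewrite δ-true {i = i} e = ℤ.≤-refl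
  ... | yes le | false = ℤ.≤-trans (nextSlot-released t T h) le
  ... | no nle | true  rewrite δ-true {i = i} e = ℤ.<⇒≤ (ℤ.≰⇒> nle)
  ... | no nle | false = nextSlot-released t T h

  nextSlot-least : ∀ {t s} T → t ℤ.< s → (∀ j → mem T j ≡ true → r j ℤ.≤ s) → nextSlot t T ℤ.≤ s
  nextSlot-least {t} [] lt h = subst (ℤ._≤ _) (ℤ.+-comm 1ℤ t) (ℤ.i<j⇒suc[i]≤j lt)
  nextSlot-least {t} ((i , c) ∷ T) lt h with nextSlot t T ℤ.≤? r i
  ... | yes _ = h i (mem-∈ {(i , c) ∷ T} (here refl))
  ... | no _  = nextSlot-least T lt (λ j m → h j (weaken j m))
    where
    weaken : ∀ j → mem T j ≡ true → (if δ i j then true else mem T j) ≡ true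
    weaken j m with δ i j
    ... | true  = refl
    ... | false = m

  -- The source of the form r_j + i of all clock values: a slot either directly follows the previous
  -- one, which increases i, or is a release time, where i restarts at 0.
  nextSlot-cases : ∀ t T → nextSlot t T ≡ t ℤ.+ 1ℤ ⊎ (∃[ j ] nextSlot t T ≡ r j)
  nextSlot-cases t [] = inj₁ refl
  nextSlot-cases t ((i , c) ∷ T) with nextSlot t T ℤ.≤? r i
  ... | yes _ = inj₂ (i , refl)
  ... | no _  = nextSlot-cases t T

  WellFormed : State → Set
  WellFormed u = ∃[ R ] proj₂ u ≡ encode R

  private
    sameEntry : ⟦ optionTy ⟧ → ⟦ optionTy ⟧ → Bool
    sameEntry x y = if proj₁ (proj₁ y) == proj₁ (proj₁ x) then (if proj₂ y == proj₂ x then true else false) else false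

    sameEntry-spec : ∀ x y b → (if proj₁ (proj₁ y) == proj₁ (proj₁ x) then (if proj₂ y == proj₂ x then true else b) else b)
                     ≡ (if sameEntry x y then true else b)
    sameEntry-spec x y b with proj₁ (proj₁ y) == proj₁ (proj₁ x) | proj₂ y == proj₂ x
    ... | true  | true  = refl
    ... | true  | false = refl
    ... | false | _     = refl

    has : Tuple → ⟦ optionTy ⟧ → Bool
    has v x = foldr (λ y b → if proj₁ (proj₁ y) == proj₁ (proj₁ x) then (if proj₂ y == proj₂ x then true else b) else b) false v

    sameTuple : Tuple → Tuple → Bool
    sameTuple u v = foldr (λ x b → if has v x then b else false) true u

    sameTuple-sound : ∀ R R′ → sameTuple (encode R) (encode R′) ≡ true → ∀ j → R j ≡ R′ j
    sameTuple-sound R R′ h j with any-fold⁻ _ (sameEntry (entry (j , R j))) (sameEntry-spec (entry (j , R j))) (encode R′)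
                                     (all-fold⁻ _ (has (encode R′)) (λ x y → refl) (encode R) h (entry (j , R j)) (∈-tabulate⁺ j))
    ... | y , k , g with ∈-tabulate⁻ k
    ... | i , refl = unpack g
      where
      unpack : sameEntry (entry (j , R j)) (entry (i , R′ i)) ≡ true → R j ≡ R′ j
      unpack g rewrite ==-toℕ i j with δ i j in e | ℤ.+ R′ i == ℤ.+ R j in e′
      ... | true | true rewrite δ-true {i = i} e = ℤ.+-injective (sym (==-sound e′))

    sameTuple-refl : ∀ R → sameTuple (encode R) (encode R) ≡ true
    sameTuple-refl R = all-fold⁺ _ (has (encode R)) (λ x y → refl) (encode R) λ x k →
      any-fold⁺ _ (sameEntry x) (sameEntry-spec x) k (good x)
      where
      good : ∀ x → sameEntry x x ≡ true
      good x = trans (if-true (==-refl (proj₁ (proj₁ x)))) (if-true (==-refl (proj₂ x)))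

  opaque
    unfolding slotAfter

    sameState-sound : ∀ {u v} → WellFormed u → WellFormed v → sameState u v ≡ true → u ≡ v
    sameState-sound {t , _} {s , _} (R , refl) (R′ , refl) h with t == s in e
    ... | true = cong₂ _,_ (==-sound e)
                   (List.tabulate-cong (λ j → cong (λ c → entry (j , c)) (sameTuple-sound R R′ h j)))

    sameState-refl : ∀ {u} → WellFormed u → sameState u u ≡ true
    sameState-refl {t , _} (R , refl) = trans (if-true (==-refl t)) (sameTuple-refl R)

    successor-wellFormed : ∀ {u T} → WellFormed u → valid u (tuple T) ≡ true → WellFormed (successor u (tuple T))
    successor-wellFormed {t , _} {T} (R , refl) h =
      next R T , cong proj₂ (successorC-next R T (validC⁻ (nextSlot t T) R T h))

    slotAfter-≡ : ∀ t st T → slotAfter (t , st) (tuple T) ≡ nextSlot t T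
    slotAfter-≡ t st T = refl

    valid⁻ : ∀ t R T → valid (t , encode R) (tuple T) ≡ true → Valid (nextSlot t T) R T
    valid⁻ t R T = validC⁻ (nextSlot t T) R T

    valid⁺ : ∀ t R T → Valid (nextSlot t T) R T → valid (t , encode R) (tuple T) ≡ true
    valid⁺ t R T = validC⁺ (nextSlot t T) R T

    successor-≡ : ∀ t R T → Valid (nextSlot t T) R T →
                  successor (t , encode R) (tuple T) ≡ (nextSlot t T , encode (next R T))
    successor-≡ t R T = successorC-next R T

    gain-≡ : ∀ t R T → gain (t , encode R) (tuple T) ≡ Σℚ.sum (gains R T)
    gain-≡ t R T = gainC-sum R T

-- Correctness of the table

-- Spelled out as the nested folds of the code, so that the denotations of `longerC` and `optionsC`
-- agree with it by computation.
crossWith : ∀ {X Y Z : Set} → (X → Y → Z) → List X → List Y → List Z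
crossWith f xs ys = foldr (λ y out → foldr (λ x out′ → f x y ∷ out′) out xs) [] ys

module _ {X Y Z : Set} (f : X → Y → Z) where

  private
    row : Y → List Z → List X → List Z
    row y out xs = foldr (λ x out′ → f x y ∷ out′) out xs

    row-length : ∀ y out xs → length (row y out xs) ≡ length xs + length out
    row-length y out []       = refl
    row-length y out (x ∷ xs) = cong suc (row-length y out xs)

    row-∈⁻ : ∀ y out xs {z} → z ∈ row y out xs → (∃[ x ] (x ∈ xs × z ≡ f x y)) ⊎ z ∈ out
    row-∈⁻ y out []       k          = inj₂ k
    row-∈⁻ y out (x ∷ xs) (here e)   = inj₁ (x , here refl , e)
    row-∈⁻ y out (x ∷ xs) (there k) with row-∈⁻ y out xs k
    ... | inj₁ (x′ , i , e) = inj₁ (x′ , there i , e)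
    ... | inj₂ i            = inj₂ i

    row-∈ʳ : ∀ y {out} xs {z} → z ∈ out → z ∈ row y out xs
    row-∈ʳ y []       k = k
    row-∈ʳ y (x ∷ xs) k = there (row-∈ʳ y xs k)

    row-∈ˡ : ∀ y {out} {xs x} → x ∈ xs → f x y ∈ row y out xs
    row-∈ˡ y (here refl) = here refl
    row-∈ˡ y (there i)   = there (row-∈ˡ y i)

  crossWith-length : ∀ xs ys → length (crossWith f xs ys) ≡ length ys * length xs
  crossWith-length xs []       = refl
  crossWith-length xs (y ∷ ys) = trans (row-length y _ xs) (cong (length xs +_) (crossWith-length xs ys))

  crossWith-∈⁻ : ∀ xs ys {z} → z ∈ crossWith f xs ys → ∃[ x ] ∃[ y ] (x ∈ xs × y ∈ ys × z ≡ f x y)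
  crossWith-∈⁻ xs (y ∷ ys) k with row-∈⁻ y _ xs k
  ... | inj₁ (x , i , e) = x , y , i , here refl , e
  ... | inj₂ k′ with crossWith-∈⁻ xs ys k′
  ...   | x , y′ , i , i′ , e = x , y′ , i , there i′ , e

  crossWith-∈⁺ : ∀ {xs ys x y} → x ∈ xs → y ∈ ys → f x y ∈ crossWith f xs ys
  crossWith-∈⁺ {xs} i (here refl) = row-∈ˡ _ i
  crossWith-∈⁺ {xs} i (there i′)  = row-∈ʳ _ xs (crossWith-∈⁺ i i′)

iterateᵖ-suc : ∀ {X : Set} k (f : X → X) x → iterateᵖ (suc k) f x ≡ f (iterateᵖ k f x)
iterateᵖ-suc zero    f x = refl
iterateᵖ-suc (suc k) f x = iterateᵖ-suc k f (f x)

longer : Tuple → List Tuple → List Tuple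
longer X As = [] ∷ crossWith _∷_ X As

tuples : Tuple → ℕ → List Tuple
tuples X k = iterateᵖ k (longer X) ([] ∷ [])

tuples-∈⁺ : ∀ X k {A} → length A ≤ k → All (_∈ X) A → A ∈ tuples X k
tuples-∈⁺ X zero {[]} _ _ = here refl
tuples-∈⁺ X (suc k) le h rewrite iterateᵖ-suc k (longer X) ([] ∷ []) with le | h
... | _     | []     = here refl
... | s≤s l | x ∷ xs = there (crossWith-∈⁺ _∷_ x (tuples-∈⁺ X k l xs))

tuples-∈⁻ : ∀ X k {A} → A ∈ tuples X k → length A ≤ k × All (_∈ X) A
tuples-∈⁻ X zero (here refl) = z≤n , []
tuples-∈⁻ X (suc k) i rewrite iterateᵖ-suc k (longer X) ([] ∷ []) with i
... | here refl = z≤n , []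
... | there i′ with crossWith-∈⁻ _∷_ X (tuples X k) i′
...   | x , A , x∈ , A∈ , refl with tuples-∈⁻ X k A∈
...     | l , h = s≤s l , x∈ ∷ h

longer-length : ∀ X As {i} → length As ≤ suc (length X) ^ i → length (longer X As) ≤ suc (length X) ^ suc i
longer-length X As {i} le = begin
  suc (length (crossWith _∷_ X As)) ≡⟨ cong suc (crossWith-length _∷_ X As) ⟩
  suc (length As * length X) ≤⟨ s≤s (ℕ.*-monoˡ-≤ (length X) le) ⟩
  1 + suc (length X) ^ i * length X ≤⟨ ℕ.+-monoˡ-≤ _ (ℕ.m^n>0 (suc (length X)) i) ⟩
  suc (length X) ^ i + suc (length X) ^ i * length X ≡⟨ ℕ.*-suc (suc (length X) ^ i) (length X) ⟨
  suc (length X) ^ i * suc (length X) ≡⟨ ℕ.*-comm (suc (length X) ^ i) (suc (length X)) ⟩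
  suc (length X) ^ suc i                               ∎
  where open ℕ.≤-Reasoning

tuples-length : ∀ X k → length (tuples X k) ≤ suc (length X) ^ k
tuples-length X zero = ℕ.≤-refl
tuples-length X (suc k) = subst (λ As → length As ≤ suc (length X) ^ suc k) (sym (iterateᵖ-suc k (longer X) ([] ∷ [])))
  (longer-length X (tuples X k) {k} (tuples-length X k))

range : ℕ → List ℤ
range K = val rangeC (ℤ.+ K ∷ [])

private
  bump : List ℤ → List ℤ
  bump l = 0ℤ ∷ foldr (λ i l′ → (i ℤ.+ 1ℤ) ∷ l′) [] l

range-suc : ∀ K → range (suc K) ≡ 0ℤ ∷ map (ℤ._+ 1ℤ) (range K)
range-suc K = trans (iterateᵖ-suc K bump (0ℤ ∷ [])) (cong (0ℤ ∷_) (foldr-cons (ℤ._+ 1ℤ) (range K)))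

range-length : ∀ K → length (range K) ≡ suc K
range-length zero    = refl
range-length (suc K) rewrite range-suc K = cong suc (trans (List.length-map _ (range K)) (range-length K))

range-∈⁺ : ∀ {K c} → c ≤ K → ℤ.+ c ∈ range K
range-∈⁺ {zero}  z≤n = here refl
range-∈⁺ {suc K} {c} le rewrite range-suc K with c | le
... | zero   | _     = here refl
... | suc c′ | s≤s l = there (subst (_∈ map (ℤ._+ 1ℤ) (range K)) (cong ℤ.+_ (ℕ.+-comm c′ 1)) (∈-map⁺ (ℤ._+ 1ℤ) (range-∈⁺ l)))

range-∈⁻ : ∀ K {i} → i ∈ range K → ∃[ c ] i ≡ ℤ.+ c
range-∈⁻ zero (here refl) = 0 , refl
range-∈⁻ (suc K) k rewrite range-suc K with k
... | here refl = 0 , refl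
... | there k′ with ∈-map⁻ (ℤ._+ 1ℤ) k′
...   | i , i∈ , refl with range-∈⁻ K i∈
...     | c , refl = c + 1 , refl

improve : List Tuple → Table → Table
improve As T = map (λ e → proj₁ e , best T As (proj₁ e)) T

-- `P` constrains the states reached after the start: nothing for soundness, membership in the
-- universe for completeness. The start itself is exempt, since the initial state is not in the
-- universe. The index k bounds the number of active slots.
data Run (P : State → Set) (As : List Tuple) : ℕ → State → List (ℤ × Tuple) → ℚ → Set where
  stop : ∀ {k u} → Run P As k u [] 0ℚ
  process   : ∀ {k u A π W} → A ∈ As → valid u A ≡ true → P (successor u A) → Run P As k (successor u A) π W →
         Run P As (suc k) u ((slotAfter u A , A) ∷ π) (gain u A ℚ.+ W)

module _ (I : Instance) where
  open Instance I
  open Spec I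

  module _ {U : List State} {As : List Tuple} (U-wf : ∀ {u} → u ∈ U → WellFormed u)
           (As-tuples : ∀ {A} → A ∈ As → ∃[ T ] A ≡ tuple T) where

    -- A sound value is attained by some run, whatever states this run visits; a complete value is
    -- at least that of each run inside `U`. The asymmetry is what allows a failed lookup to return
    -- the empty continuation.
    Sound Complete : ℕ → State → Value → Set
    Sound k u v    = ∃[ π ] (Run (λ _ → ⊤) As k u π (proj₁ v) × proj₂ v ≡ emit π)
    Complete k u v = ∀ π W → Run (_∈ U) As k u π W → W ℚ.≤ proj₁ v

    record Correct (k : ℕ) (T : Table) : Set where
      field
        keys     : map proj₁ T ≡ U
        sound    : ∀ {e} → e ∈ T → Sound k (proj₁ e) (proj₂ e)
        complete : ∀ {e} → e ∈ T → Complete k (proj₁ e) (proj₂ e)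

    lookup-cases : ∀ T u → (∃[ e ] (e ∈ T × sameState (proj₁ e) u ≡ true × lookup T u ≡ proj₂ e))
                   ⊎ (lookup T u ≡ worthless × (∀ e → e ∈ T → sameState (proj₁ e) u ≡ false))
    lookup-cases [] u = inj₂ (lookup-[] u , λ _ ())
    lookup-cases (e ∷ T) u rewrite lookup-∷ e T u with sameState (proj₁ e) u in eq
    ... | true = inj₁ (e , here refl , eq , refl)
    ... | false with lookup-cases T u
    ...   | inj₁ (e′ , i , same , l) = inj₁ (e′ , there i , same , l)
    ...   | inj₂ (l , none) = inj₂ (l , λ { _ (here refl) → eq ; e′ (there i) → none e′ i })

    module _ {k T} (C : Correct k T) where
      open Correct C

      private
        key∈U : ∀ {e} → e ∈ T → proj₁ e ∈ U
        key∈U i = subst (_ ∈_) keys (∈-map⁺ proj₁ i)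

      lookup-sound : ∀ {u} → WellFormed u → Sound k u (lookup T u)
      lookup-sound {u} wf with lookup-cases T u
      ... | inj₂ (l , _) rewrite l = [] , stop , refl
      ... | inj₁ (e , i , same , l) rewrite l =
        subst (λ v → Sound k v (proj₂ e)) (sameState-sound (U-wf (key∈U i)) wf same) (sound i)

      lookup-complete : ∀ {u} → u ∈ U → Complete k u (lookup T u)
      lookup-complete {u} u∈U with lookup-cases T u
      ... | inj₁ (e , i , same , l) rewrite l =
        subst (λ v → Complete k v (proj₂ e)) (sameState-sound (U-wf (key∈U i)) (U-wf u∈U) same) (complete i)
      ... | inj₂ (_ , none) with ∈-map⁻ proj₁ (subst (u ∈_) (sym keys) u∈U)
      ...   | e , i , refl = ⊥-elim (false≢true (trans (sym (none e i)) (sameState-refl (U-wf u∈U))))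

      candidate-sound : ∀ {u A} → WellFormed u → A ∈ As → Sound (suc k) u (candidate T u A)
      candidate-sound {u} {A} wf i with valid u A in v
      ... | false rewrite candidate-invalid T u A v = [] , stop , refl
      ... | true rewrite candidate-valid T u A v with As-tuples i
      ...   | S , refl with lookup-sound (successor-wellFormed {u} {S} wf v)
      ...     | π , run , e = (slotAfter u A , A) ∷ π , process i v tt run , cong (emitSlot (slotAfter u A) A) e

      best-sound : ∀ {u} Bs → WellFormed u → (∀ {A} → A ∈ Bs → A ∈ As) → Sound (suc k) u (best T Bs u)
      best-sound {u} [] wf sub rewrite best-[] T u = [] , stop , refl
      best-sound {u} (A ∷ Bs) wf sub rewrite best-∷ T A Bs u
        with better-cases (best T Bs u) (candidate T u A)
      ... | inj₂ e = subst (Sound (suc k) u) (sym e) (candidate-sound wf (sub (here refl)))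
      ... | inj₁ e = subst (Sound (suc k) u) (sym e) (best-sound Bs wf (sub ∘ there))

      best-≥0 : ∀ u Bs → 0ℚ ℚ.≤ proj₁ (best T Bs u)
      best-≥0 u [] rewrite best-[] T u = ℚ.≤-refl
      best-≥0 u (A ∷ Bs) rewrite best-∷ T A Bs u =
        ℚ.≤-trans (best-≥0 u Bs) (better-≥ˡ (best T Bs u) (candidate T u A))

      best-≥ : ∀ u {Bs A} → A ∈ Bs → proj₁ (candidate T u A) ℚ.≤ proj₁ (best T Bs u)
      best-≥ u {A ∷ Bs} (here refl) rewrite best-∷ T A Bs u = better-≥ʳ (best T Bs u) (candidate T u A)
      best-≥ u {A ∷ Bs} (there i) rewrite best-∷ T A Bs u =
        ℚ.≤-trans (best-≥ u i) (better-≥ˡ (best T Bs u) (candidate T u A))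

      -- Only successors are looked up, and the run provides their membership in `U`. So u may be
      -- the initial state.
      best-complete : ∀ u → Complete (suc k) u (best T As u)
      best-complete u _ _ stop = best-≥0 u As
      best-complete u _ _ (process {A = A} {π = π} {W = W} i v inU run) = begin
        gain u A ℚ.+ W ≤⟨ ℚ.+-monoʳ-≤ (gain u A) (lookup-complete inU π W run) ⟩
        gain u A ℚ.+ proj₁ (lookup T (successor u A))
                                        ≡⟨ cong proj₁ (candidate-valid T u A v) ⟨
        proj₁ (candidate T u A) ≤⟨ best-≥ u i ⟩
        proj₁ (best T As u)             ∎
        where open ℚ.≤-Reasoning

      improve-correct : Correct (suc k) (improve As T)
      improve-correct = record
        { keys     = trans (sym (List.map-∘ T)) keys
        ; sound    = λ i → let e , j , eq = ∈-map⁻ _ i in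
                     subst (λ x → Sound (suc k) (proj₁ x) (proj₂ x)) (sym eq) (best-sound As (U-wf (key∈U j)) id)
        ; complete = λ i → let e , j , eq = ∈-map⁻ _ i in
                     subst (λ x → Complete (suc k) (proj₁ x) (proj₂ x)) (sym eq) (best-complete (proj₁ e))
        }

    initial-correct : Correct 0 (map (_, worthless) U)
    initial-correct = record
      { keys     = trans (sym (List.map-∘ U)) (List.map-id U)
      ; sound    = λ i → let u , _ , eq = ∈-map⁻ _ i in
                   subst (λ x → Sound 0 (proj₁ x) (proj₂ x)) (sym eq) ([] , stop , refl)
      ; complete = λ i → let u , _ , eq = ∈-map⁻ _ i in
                   subst (λ x → Complete 0 (proj₁ x) (proj₂ x)) (sym eq) λ { _ _ stop → ℚ.≤-refl }
      }

    iterate-correct : ∀ k → Correct k (iterateᵖ k (improve As) (map (_, worthless) U))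
    iterate-correct zero    = initial-correct
    iterate-correct (suc k) = subst (Correct (suc k)) (sym (iterateᵖ-suc k (improve As) _))
                                (improve-correct (iterate-correct k))

-- Denotation of the assembled program

map-crossWith : ∀ {X Y Z W : Set} (g : Z → W) (f : X → Y → Z) xs ys →
                crossWith (λ x y → g (f x y)) xs ys ≡ map g (crossWith f xs ys)
map-crossWith g f xs []       = refl
map-crossWith g f xs (y ∷ ys) = trans (cong (λ out → foldr (λ x out′ → g (f x y) ∷ out′) out xs) (map-crossWith g f xs ys))
                                  (row xs)
  where
  row : ∀ zs → foldr (λ x out′ → g (f x y) ∷ out′) (map g (crossWith f xs ys)) zs ≡
               map g (foldr (λ x out′ → f x y ∷ out′) (crossWith f xs ys) zs)
  row []       = refl
  row (z ∷ zs) = cong (g (f z y) ∷_) (row zs)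

iterateᵖ-cong : ∀ {X : Set} {f g : X → X} → (∀ x → f x ≡ g x) → ∀ k x → iterateᵖ k f x ≡ iterateᵖ k g x
iterateᵖ-cong h zero    x = refl
iterateᵖ-cong {g = g} h (suc k) x = trans (iterateᵖ-cong h k _) (cong (iterateᵖ k g) (h x))

count-tabulate : ∀ {n} (f : Fin n → ⟦ jobTy ⟧) → val countC (tabulate f ∷ []) ≡ ℤ.+ n
count-tabulate {zero}  f = refl
count-tabulate {suc n} f = trans (cong (ℤ._+ 1ℤ) (count-tabulate (f ∘ suc))) (cong ℤ.+_ (ℕ.+-comm n 1))

private
  number : ⟦ jobTy ⟧ → List ⟦ indexedTy ⟧ × ℤ → List ⟦ indexedTy ⟧ × ℤ
  number x s = (proj₂ s , x) ∷ proj₁ s , proj₂ s ℤ.- 1ℤ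

  -- The offset o makes the induction work: the tail is numbered from o + 1, while the counter still
  -- starts from the same total.
  number-tabulate : ∀ {n} o (f : Fin n → ⟦ jobTy ⟧) →
    foldr number ([] , ℤ.+ (o + n) ℤ.- 1ℤ) (tabulate f) ≡ (tabulate (λ j → ℤ.+ (o + toℕ j) , f j) , ℤ.+ o ℤ.- 1ℤ)
  number-tabulate {zero}  o f = cong (λ k → [] , ℤ.+ k ℤ.- 1ℤ) (ℕ.+-identityʳ o)
  number-tabulate {suc n} o f =
    trans (cong (λ k → number (f zero) (foldr number ([] , ℤ.+ k ℤ.- 1ℤ) (tabulate (f ∘ suc)))) (ℕ.+-suc o n))
      (trans (cong (number (f zero)) (number-tabulate (suc o) (f ∘ suc)))
        (cong₂ (λ h t → (ℤ.+ h , f zero) ∷ t , ℤ.+ o ℤ.- 1ℤ) (sym (ℕ.+-identityʳ o))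
          (List.tabulate-cong (λ j → cong (λ k → ℤ.+ k , f (suc j)) (sym (ℕ.+-suc o (toℕ j)))))))

index-tabulate : ∀ {n} (f : Fin n → ⟦ jobTy ⟧) → val indexC (tabulate f ∷ []) ≡ tabulate (λ j → ℤ.+ toℕ j , f j)
index-tabulate {n} f = trans
  (cong (λ k → proj₁ (foldr number ([] , k ℤ.- 1ℤ) (tabulate f))) (count-tabulate f))
  (cong proj₁ (number-tabulate 0 f))

improveWith-≡ : ∀ b T As → val (improveWith b) (T ∷ As ∷ []) ≡ map (λ e → proj₁ e , val b (T ∷ As ∷ proj₁ e ∷ [])) T
improveWith-≡ b T As = foldr-cons _ T

-- The subroutines are variables, so that checking `refl` expands none of them; their values enter
-- only through the equations.
solveWith-≡ : ∀ tup uni ini run X (c : ℤ) J (k e : ℤ) S₁ S₂ T u out →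
  val tup (X ∷ (c ℤ.+ c ℤ.+ (c ℤ.+ c) ℤ.+ 1ℤ) ∷ []) ≡ S₁ → val tup (X ∷ c ∷ []) ≡ S₂ → val uni (X ∷ S₁ ∷ J ∷ []) ≡ T →
  val ini (J ∷ e ∷ []) ≡ u → val run (T ∷ S₂ ∷ u ∷ k ∷ []) ≡ out →
  val (solveWith tup uni ini run) (X ∷ c ∷ J ∷ k ∷ e ∷ []) ≡ out
solveWith-≡ tup uni ini run X c J k e _ _ _ _ _ refl refl refl refl refl = refl

mainWith-≡ : ∀ idx rng opt cnt slv (e : ℤ) jobs (c k : ℤ) J l X c₀ out →
  val idx (jobs ∷ []) ≡ J → val rng (k ∷ []) ≡ l → val opt (J ∷ l ∷ []) ≡ X →
  (if does (c ℤ.≤? val cnt (jobs ∷ [])) then c else val cnt (jobs ∷ [])) ≡ c₀ →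
  val slv (X ∷ c₀ ∷ J ∷ k ∷ e ∷ []) ≡ out →
  val (mainWith idx rng opt cnt slv) (e ∷ jobs ∷ c ∷ k ∷ []) ≡ out
mainWith-≡ idx rng opt cnt slv e jobs c k _ _ _ _ _ refl refl refl refl refl = refl

opaque
  unfolding slotAfter

  improveC-≡ : ∀ As T → val improveC (T ∷ As ∷ []) ≡ improve As T
  improveC-≡ As T = improveWith-≡ bestC T As

  bestC-≡ : ∀ T As u → val bestC (T ∷ As ∷ u ∷ []) ≡ best T As u
  bestC-≡ T As u = refl

clamp-pred : ∀ {k} → 1 ≤ k → clamp (ℤ.+ k ℤ.- 1ℤ) ≡ k ∸ 1
clamp-pred {suc zero}    _ = refl
clamp-pred {suc (suc k)} _ = refl

-- A record rather than a bare equation: comparing the denotations of whole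
-- programs by unfolding them is infeasible.
record Computes {Γ A} (c : Code Γ A) (f : Env Γ → ⟦ A ⟧) : Set where
  constructor computes
  field at : ∀ ρ → val c ρ ≡ f ρ

open Computes

tuplesF : Env (tupleTy ∷ int ∷ []) → List Tuple
tuplesF (X ∷ k ∷ []) = tuples X (clamp k)

tuplesC-computes : Computes tuplesC tuplesF
tuplesC-computes = computes λ { (X ∷ k ∷ []) → refl }

universeF : Env (tupleTy ∷ list tupleTy ∷ list indexedTy ∷ []) → Table
universeF (X ∷ Ts ∷ J ∷ []) = map (_, worthless) (crossWith (λ A x → val stateC (x ∷ A ∷ J ∷ [])) Ts X)

universeC-computes : Computes universeC universeF
universeC-computes = computes λ { (X ∷ Ts ∷ J ∷ []) →
    trans (shape stateC X Ts J) (map-crossWith (_, worthless) (λ A x → val stateC (x ∷ A ∷ J ∷ [])) Ts X) }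
  where
  shape : ∀ (s : Code (optionTy ∷ tupleTy ∷ list indexedTy ∷ []) stateTy) X Ts J →
          val (fold v0 nil# (fold v3 v1 ((call s (i2 ∷ i0 ∷ i6 ∷ []) ,# worthless#) ∷# v1))) (X ∷ Ts ∷ J ∷ []) ≡
          crossWith (λ A x → val s (x ∷ A ∷ J ∷ []) , worthless) Ts X
  shape s X Ts J = refl

initialF : Env (list indexedTy ∷ int ∷ []) → State
initialF = val initialC

initialC-computes : Computes initialC initialF
initialC-computes = computes λ _ → refl

runF : Env (tableTy ∷ list tupleTy ∷ stateTy ∷ int ∷ []) → List (ℤ × ℤ)
runF (T ∷ As ∷ u ∷ k ∷ []) = proj₂ (best (iterateᵖ (clamp (k ℤ.- 1ℤ)) (improve As) T) As u)

bestF : Env (tableTy ∷ list tupleTy ∷ stateTy ∷ []) → Value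
bestF (T ∷ As ∷ u ∷ []) = best T As u

improveF : Env (tableTy ∷ list tupleTy ∷ []) → Table
improveF (T ∷ As ∷ []) = improve As T

bestC-computes : Computes bestC bestF
bestC-computes = computes λ { (T ∷ As ∷ u ∷ []) → bestC-≡ T As u }

improveC-computes : Computes improveC improveF
improveC-computes = computes λ { (T ∷ As ∷ []) → improveC-≡ As T }

runWith-computes : ∀ {i b} → Computes i improveF → Computes b bestF → Computes (runWith i b) runF
runWith-computes {i} {b} ci cb = computes λ { (T ∷ As ∷ u ∷ k ∷ []) →
  cong proj₂ (trans (at cb (iterateᵖ (clamp (k ℤ.- 1ℤ)) (λ T′ → val i (T′ ∷ As ∷ [])) T ∷ As ∷ u ∷ []))
    (cong (λ T′ → best T′ As u) (iterateᵖ-cong (λ T′ → at ci (T′ ∷ As ∷ [])) (clamp (k ℤ.- 1ℤ)) T))) }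

runC-computes : Computes runC runF
runC-computes = runWith-computes improveC-computes bestC-computes

solveF : Env (tupleTy ∷ int ∷ list indexedTy ∷ int ∷ int ∷ []) → List (ℤ × ℤ)
solveF (X ∷ c ∷ J ∷ k ∷ e ∷ []) =
  runF (universeF (X ∷ tuplesF (X ∷ (c ℤ.+ c ℤ.+ (c ℤ.+ c) ℤ.+ 1ℤ) ∷ []) ∷ J ∷ []) ∷ tuplesF (X ∷ c ∷ []) ∷
        initialF (J ∷ e ∷ []) ∷ k ∷ [])

solveWith-computes : ∀ {tup uni ini run} → Computes tup tuplesF → Computes uni universeF → Computes ini initialF →
                     Computes run runF → Computes (solveWith tup uni ini run) solveF
solveWith-computes {tup} {uni} {ini} {run} ct cu ci cr = computes λ { (X ∷ c ∷ J ∷ k ∷ e ∷ []) →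
  solveWith-≡ tup uni ini run X c J k e _ _ _ _ _ (at ct _) (at ct _) (at cu _) (at ci _) (at cr _) }

solveC-computes : Computes solveC solveF
solveC-computes = solveWith-computes tuplesC-computes universeC-computes initialC-computes runC-computes

rangeF : Env (int ∷ []) → List ℤ
rangeF = val rangeC

rangeC-computes : Computes rangeC rangeF
rangeC-computes = computes λ _ → refl

optionsF : Env (list indexedTy ∷ list int ∷ []) → Tuple
optionsF (J ∷ l ∷ []) = crossWith (λ c j → j , c) l J

optionsC-computes : Computes optionsC optionsF
optionsC-computes = computes λ { (J ∷ l ∷ []) → refl }

indexF : Env (list jobTy ∷ []) → List ⟦ indexedTy ⟧
indexF = val indexC

indexC-computes : Computes indexC indexF
indexC-computes = computes λ _ → refl

countF : Env (list jobTy ∷ []) → ℤ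
countF = val countC

countC-computes : Computes countC countF
countC-computes = computes λ _ → refl

capacityF : ℤ → ℤ → ℤ
capacityF c k = if does (c ℤ.≤? k) then c else k

mainF : Env mainCtx → List (ℤ × ℤ)
mainF (e ∷ jobs ∷ c ∷ k ∷ []) =
  solveF (optionsF (indexF (jobs ∷ []) ∷ rangeF (k ∷ []) ∷ []) ∷ capacityF c (countF (jobs ∷ [])) ∷
          indexF (jobs ∷ []) ∷ k ∷ e ∷ [])

mainWith-computes : ∀ {idx rng opt cnt slv} → Computes idx indexF → Computes rng rangeF → Computes opt optionsF →
                    Computes cnt countF → Computes slv solveF → Computes (mainWith idx rng opt cnt slv) mainF
mainWith-computes {idx} {rng} {opt} {cnt} {slv} ci cr co cc cs = computes λ { (e ∷ jobs ∷ c ∷ k ∷ []) →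
  mainWith-≡ idx rng opt cnt slv e jobs c k _ _ _ _ _ (at ci _) (at cr _) (at co _)
    (cong (capacityF c) (at cc (jobs ∷ []))) (at cs _) }

mainC-computes : Computes mainC mainF
mainC-computes = mainWith-computes indexC-computes rangeC-computes optionsC-computes countC-computes solveC-computes

-- States and tables of an instance

module Solution (I : Instance) where
  open Instance I
  open Spec I

  -- Since c₀ ≤ n K, the program takes constant time if n K = 1, whatever m is.
  c₀ : ℕ
  c₀ = m ⊓ n

  -- The partial jobs and the last finished job.
  L : ℕ
  L = c₀ + c₀ + (c₀ + c₀) + 1

  -- Numbers up to K suffice for both uses of an option: a partial job has at most K units to come,
  -- one per active slot, and the clock is at most K past some release time.
  X : Tuple
  X = crossWith (λ c j → j , c) (range K) jobs

  As : List Tuple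
  As = tuples X c₀

  U : List State
  U = crossWith (λ A x → val stateC (x ∷ A ∷ jobs ∷ [])) (tuples X L) X

  X-∈⁺ : ∀ j {c} → c ≤ K → entry (j , c) ∈ X
  X-∈⁺ j le = crossWith-∈⁺ (λ c j → j , c) (range-∈⁺ le) (∈-tabulate⁺ j)

  X-∈⁻ : ∀ {x} → x ∈ X → ∃[ e ] x ≡ entry e
  X-∈⁻ i with crossWith-∈⁻ (λ c j → j , c) (range K) jobs i
  ... | i , y , i∈ , y∈ , refl with range-∈⁻ K i∈ | ∈-tabulate⁻ y∈
  ...   | c , refl | j , refl = (j , c) , refl

  X-tuple : ∀ {A} → All (_∈ X) A → ∃[ T ] A ≡ tuple T
  X-tuple []       = [] , refl
  X-tuple (x ∷ xs) with X-∈⁻ x | X-tuple xs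
  ... | e , refl | T , refl = e ∷ T , refl

  tuple-∈ : ∀ T k → length T ≤ k → (∀ {j c} → (j , c) ∈ T → c ≤ K) → tuple T ∈ tuples X k
  tuple-∈ T k le h = tuples-∈⁺ X k (subst (_≤ k) (sym (List.length-map entry T)) le)
    (All.tabulate λ i → let (j , c) , i′ , e = ∈-map⁻ entry i in subst (_∈ X) (sym e) (X-∈⁺ j (h i′)))

  As-tuples : ∀ {A} → A ∈ As → ∃[ T ] A ≡ tuple T
  As-tuples i = X-tuple (proj₂ (tuples-∈⁻ X c₀ i))

  defaultWork : List (Fin n × ℕ) → Fin n → ℕ
  defaultWork T j = foldr (λ e y → if does (ℤ.+ proj₂ e ℤ.≤? 0ℤ) then (if before j (proj₁ e) then 0 else y) else y) (p j) T

  describe : List (Fin n × ℕ) → Fin n → ℕ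
  describe T j = foldr (λ e y → if δ (proj₁ e) j then proj₂ e else y) (defaultWork T j) T

  remainingC-≡ : ∀ T j → val remainingC (job j ∷ tuple T ∷ []) ≡ ℤ.+ describe T j
  remainingC-≡ T j = trans (cong (λ z → foldr pick z (tuple T)) (default T)) (scan T)
    where
    pick : ⟦ optionTy ⟧ → ℤ → ℤ
    pick x y = if proj₁ (proj₁ x) == ℤ.+ toℕ j then proj₂ x else y
    default : ∀ S → foldr (λ x y → if does (proj₂ x ℤ.≤? 0ℤ) then (if val (before# v0 v1) (job j ∷ proj₁ x ∷ []) then 0ℤ else y) else y)
                      (ℤ.+ p j) (tuple S) ≡ ℤ.+ defaultWork S j
    default [] = refl
    default ((i , c) ∷ S) rewrite default S with does (ℤ.+ c ℤ.≤? 0ℤ) | before j i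
    ... | true  | true  = refl
    ... | true  | false = refl
    ... | false | _     = refl
    scan : ∀ S → foldr pick (ℤ.+ defaultWork T j) (tuple S) ≡
               ℤ.+ foldr (λ e y → if δ (proj₁ e) j then proj₂ e else y) (defaultWork T j) S
    scan [] = refl
    scan ((i , c) ∷ S) rewrite scan S | ==-toℕ i j with δ i j
    ... | true  = refl
    ... | false = refl

  stateC-≡ : ∀ j c T → val stateC (entry (j , c) ∷ tuple T ∷ jobs ∷ []) ≡ (r j ℤ.+ ℤ.+ c , encode (describe T))
  stateC-≡ j c T = cong (r j ℤ.+ ℤ.+ c ,_) (trans (foldr-cons _ jobs) (trans (List.map-tabulate job _)
    (List.tabulate-cong (λ i → cong (job i ,_) (remainingC-≡ T i)))))

  U-wf : ∀ {u} → u ∈ U → WellFormed u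
  U-wf i with crossWith-∈⁻ (λ A x → val stateC (x ∷ A ∷ jobs ∷ [])) (tuples X L) X i
  ... | A , x , A∈ , x∈ , refl with X-tuple (proj₂ (tuples-∈⁻ X L A∈)) | X-∈⁻ x∈
  ...   | T , refl | (j , c) , refl = describe T , cong proj₂ (stateC-≡ j c T)

  U-∈ : ∀ {t R} j c T → c ≤ K → length T ≤ L → (∀ {i c′} → (i , c′) ∈ T → c′ ≤ K) →
        t ≡ r j ℤ.+ ℤ.+ c → (∀ i → R i ≡ describe T i) → (t , encode R) ∈ U
  U-∈ j c T c≤K le h refl e = subst (_∈ U)
    (trans (stateC-≡ j c T) (cong (_ ,_) (List.tabulate-cong (λ i → cong (λ k → entry (i , k)) (sym (e i))))))
    (crossWith-∈⁺ (λ A x → val stateC (x ∷ A ∷ jobs ∷ [])) (tuple-∈ T L le h) (X-∈⁺ j c≤K))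

  earliest : ℤ → ℤ
  earliest i = val earliestC (jobs ∷ i ∷ [])

  private
    minimum : ∀ {k} → (Fin k → ℤ) → ℤ → ℤ
    minimum f i = foldr (λ x y → if does (x ℤ.≤? y) then x else y) i (tabulate f)

    minimum-≤ : ∀ {k} (f : Fin k → ℤ) i j → minimum f i ℤ.≤ f j
    minimum-≤ f i zero with f zero ℤ.≤? minimum (f ∘ suc) i
    ... | yes le = ℤ.≤-refl
    ... | no nle = ℤ.<⇒≤ (ℤ.≰⇒> nle)
    minimum-≤ f i (suc j) with f zero ℤ.≤? minimum (f ∘ suc) i
    ... | yes le = ℤ.≤-trans le (minimum-≤ (f ∘ suc) i j)
    ... | no nle = minimum-≤ (f ∘ suc) i j

    minimum-∈ : ∀ {k} (f : Fin k → ℤ) i → minimum f i ≡ i ⊎ (∃[ j ] minimum f i ≡ f j)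
    minimum-∈ {zero}  f i = inj₁ refl
    minimum-∈ {suc k} f i with f zero ℤ.≤? minimum (f ∘ suc) i
    ... | yes _ = inj₂ (zero , refl)
    ... | no _ with minimum-∈ (f ∘ suc) i
    ...   | inj₁ e       = inj₁ e
    ...   | inj₂ (j , e) = inj₂ (suc j , e)

    earliest-minimum : ∀ i → earliest i ≡ minimum r i
    earliest-minimum i = scan job r (λ _ → refl)
      where
      scan : ∀ {k} (g : Fin k → ⟦ indexedTy ⟧) (f : Fin k → ℤ) → (∀ j → proj₁ (proj₂ (g j)) ≡ f j) →
           foldr (λ x y → if does (proj₁ (proj₂ x) ℤ.≤? y) then proj₁ (proj₂ x) else y) i (tabulate g) ≡ minimum f i
      scan {zero}  g f h = refl
      scan {suc k} g f h rewrite scan (g ∘ suc) (f ∘ suc) (h ∘ suc) | h zero = refl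

  earliest-≤ : ∀ i j → earliest i ℤ.≤ r j
  earliest-≤ i j = subst (ℤ._≤ r j) (sym (earliest-minimum i)) (minimum-≤ r i j)

  earliest-∈ : ∀ j₀ → ∃[ j ] earliest (r j₀) ≡ r j
  earliest-∈ j₀ with minimum-∈ r (r j₀)
  ... | inj₁ e       = j₀ , trans (earliest-minimum (r j₀)) e
  ... | inj₂ (j , e) = j , trans (earliest-minimum (r j₀)) e

  initial : ℤ → State
  initial i = earliest i ℤ.- 1ℤ , encode p

  initialC-≡ : ∀ i → val initialC (jobs ∷ i ∷ []) ≡ initial i
  initialC-≡ i = cong (earliest i ℤ.- 1ℤ ,_) (trans (foldr-cons (λ x → x , proj₁ (proj₂ (proj₂ (proj₂ x)))) jobs)
                   (List.map-tabulate job _))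

  table : ℕ → Table
  table k = iterateᵖ k (improve As) (map (_, worthless) U)

  solution : ℤ → Value
  -- The K-th round is performed for the initial state alone, which has no entry in the table.
  solution i = best (table (K ∸ 1)) As (initial i)

  capacity-≡ : capacityF (ℤ.+ m) (ℤ.+ n) ≡ ℤ.+ c₀
  capacity-≡ with does (ℤ.+ m ℤ.≤? ℤ.+ n) in e
  ... | true  = cong ℤ.+_ (sym (ℕ.m≤n⇒m⊓n≡m (ℤ.drop‿+≤+ (does⁻ (ℤ.+ m ℤ.≤? ℤ.+ n) e))))
  ... | false = cong ℤ.+_ (sym (ℕ.m≥n⇒m⊓n≡n (ℕ.<⇒≤ (ℕ.≰⇒> λ le →
                  false≢true (trans (sym e) (does⁺ (ℤ.+ m ℤ.≤? ℤ.+ n) (ℤ.+≤+ le)))))))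

  inputJobs : List ⟦ jobTy ⟧
  inputJobs = tabulate (λ j → r j , d j , ℤ.+ p j , w j)

  inputJobs-index : indexF (inputJobs ∷ []) ≡ jobs
  inputJobs-index = index-tabulate (λ j → r j , d j , ℤ.+ p j , w j)

  inputJobs-capacity : capacityF (ℤ.+ m) (countF (inputJobs ∷ [])) ≡ ℤ.+ c₀
  inputJobs-capacity = trans (cong (capacityF (ℤ.+ m)) (count-tabulate (λ j → r j , d j , ℤ.+ p j , w j))) capacity-≡

  mainF-≡ : ∀ i → 1 ≤ K → mainF (i ∷ inputJobs ∷ ℤ.+ m ∷ ℤ.+ K ∷ []) ≡ proj₂ (solution i)
  mainF-≡ i 1≤K = trans
    (cong₂ (λ J c → solveF (optionsF (J ∷ range K ∷ []) ∷ c ∷ J ∷ ℤ.+ K ∷ i ∷ [])) inputJobs-index inputJobs-capacity)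
    (cong₂ (λ u k → proj₂ (best (table k) As u)) (initialC-≡ i) (clamp-pred 1≤K))

-- Soundness

unique-length : ∀ {X : Set} {xs ys : List X} → Unique xs → (∀ {x} → x ∈ xs → x ∈ ys) → length xs ≤ length ys
unique-length [] h = z≤n
unique-length {xs = x ∷ xs} (x∉ ∷ u) h with ∈-∃++ (h (here refl))
... | as , bs , refl = ℕ.≤-trans (s≤s (unique-length u smaller)) (ℕ.≤-reflexive lengths)
  where
  smaller : ∀ {y} → y ∈ xs → y ∈ as ++ bs
  smaller i with ∈-++⁻ as (h (there i))
  ... | inj₁ k            = ∈-++⁺ˡ k
  ... | inj₂ (there k)    = ∈-++⁺ʳ as k
  ... | inj₂ (here refl)  = ⊥-elim (All.lookup x∉ i refl)
  lengths : suc (length (as ++ bs)) ≡ length (as ++ x ∷ bs)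
  lengths = trans (cong suc (List.length-++ as)) (trans (sym (ℕ.+-suc (length as) (length bs))) (sym (List.length-++ as)))

∣∣-∥∥ : ∀ {n} (A : Subset n) → ∣ A ∣ ≡ ∥ Vec.lookup A ∥
∣∣-∥∥ A = trans (go A) (sym (∥∥-sum (Vec.lookup A)))
  where
  go : ∀ {n} (A : Subset n) → ∣ A ∣ ≡ Σℕ.sum (ι ∘ Vec.lookup A)
  go Vec.[] = refl
  go (true Vec.∷ A)  = cong suc (go A)
  go (false Vec.∷ A) = go A

module _ (I : Instance) where
  open Instance I

  slots-∈⁺ : ∀ {j t} → Window j t → t ∈ slots j
  slots-∈⁺ {j} {t} (r≤t , t≤d) = subst (_∈ slots j) r+k≡t (∈-map⁺ (λ k → r j ℤ.+ ℤ.+ k) (∈-upTo⁺ k<))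
    where
    k : ℕ
    k = ℤ.∣ t ℤ.- r j ∣
    e : ℤ
    e = d j ℤ.- r j ℤ.+ 1ℤ
    +k : ℤ.+ k ≡ t ℤ.- r j
    +k = ℤ.0≤i⇒+∣i∣≡i (ℤ.i≤j⇒0≤j-i r≤t)
    cancel : ∀ a b → a ℤ.+ (b ℤ.- a) ≡ b
    cancel = solve-∀
    r+k≡t : r j ℤ.+ ℤ.+ k ≡ t
    r+k≡t = trans (cong (λ i → r j ℤ.+ i) +k) (cancel (r j) t)
    k< : k < clamp e
    k< = ℤ.drop‿+<+ (begin-strict
      ℤ.+ k ≡⟨ +k ⟩
      t ℤ.- r j ≤⟨ ℤ.+-monoˡ-≤ (ℤ.- r j) t≤d ⟩
      d j ℤ.- r j <⟨ ℤ.suc[i]≤j⇒i<j (ℤ.≤-reflexive (ℤ.+-comm 1ℤ (d j ℤ.- r j))) ⟩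
      e ≤⟨ ℤ.i≤j⊔i 0ℤ e ⟩
      0ℤ ℤ.⊔ e ≡⟨ ℤ.0≤i⇒+∣i∣≡i (ℤ.i≤i⊔j 0ℤ e) ⟨
      ℤ.+ clamp e       ∎)
      where open ℤ.≤-Reasoning

  slots-unique : ∀ j → Unique (slots j)
  slots-unique j = Unique.map⁺ (λ e → ℤ.+-injective (ℤGroup.∙-cancelˡ (r j) _ _ e)) (Unique.upTo⁺ _)

  throughput-sum : ∀ A → throughput A ≡ Σℚ.sum (λ j → if does (completed? A j) then w j else 0ℚ)
  throughput-sum A = go (completed? A) w id
    where
    go : ∀ {k} {X : Set} {P : X → Set} (P? : ∀ x → Dec (P x)) (v : X → ℚ) (f : Fin k → X) →
         foldr ℚ._+_ 0ℚ (map v (filter P? (tabulate f))) ≡ Σℚ.sum (λ j → if does (P? (f j)) then v (f j) else 0ℚ)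
    go {zero}  P? v f = refl
    go {suc k} P? v f with does (P? (f zero))
    ... | true  = cong (v (f zero) ℚ.+_) (go P? v (f ∘ suc))
    ... | false = trans (go P? v (f ∘ suc)) (sym (ℚ.+-identityˡ _))

  open Spec I
  open Solution I

  -- `Run` on decoded data. Membership in `As` is reduced to the length bound, which is all that the
  -- capacity constraint requires.
  data AbsRun : ℤ → (Fin n → ℕ) → List (ℤ × List (Fin n × ℕ)) → ℚ → Set where
    stop : ∀ {t R} → AbsRun t R [] 0ℚ
    process   : ∀ {t R T ρ W} → length T ≤ c₀ → Valid (nextSlot t T) R T → AbsRun (nextSlot t T) (next R T) ρ W →
           AbsRun t R ((nextSlot t T , T) ∷ ρ) (Σℚ.sum (gains R T) ℚ.+ W)

  concrete : List (ℤ × List (Fin n × ℕ)) → List (ℤ × Tuple)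
  concrete = map (λ s → proj₁ s , tuple (proj₂ s))

  abstractRun : ∀ {k t R π W} → Run (λ _ → ⊤) As k (t , encode R) π W →
                ∃[ ρ ] (AbsRun t R ρ W × π ≡ concrete ρ × length ρ ≤ k)
  abstractRun stop = [] , stop , refl , z≤n
  abstractRun {t = t} {R} (process {A = A} A∈ v _ run) with As-tuples A∈
  ... | T , refl with valid⁻ t R T v
  ... | ok rewrite successor-≡ t R T ok | slotAfter-≡ t (encode R) T | gain-≡ t R T with abstractRun run
  ... | ρ , arun , refl , le = (nextSlot t T , T) ∷ ρ ,
        process (subst (_≤ c₀) (List.length-map entry T) (proj₁ (tuples-∈⁻ X c₀ A∈))) ok arun , refl , s≤s le

  sets : List (ℤ × List (Fin n × ℕ)) → List (Slot n)
  sets = map (λ s → proj₁ s , mem (proj₂ s))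

  private
    -- What a job with remaining work R can still earn from c units. With R = 0 it earns nothing:
    -- its weight has been paid, or the job was closed.
    reward : ℕ → ℕ → ℚ → ℚ
    reward R c v = if does (1 ℕ.≤? R) then (if does (R ℕ.≤? c) then v else 0ℚ) else 0ℚ

  reward-≥0 : ∀ R c j → 0ℚ ℚ.≤ reward R c (w j)
  reward-≥0 R c j with does (1 ℕ.≤? R) | does (R ℕ.≤? c)
  ... | true  | true  = w≥0 j
  ... | true  | false = ℚ.≤-refl
  ... | false | _     = ℚ.≤-refl

  -- A unit lowers R and c alike, so the reward persists or, at the last unit, is paid out as gain.
  -- Closing a job can only forfeit its reward, hence the inequality.
  reward-step : ∀ {t} R T j c → Valid t R T →
                gains R T j ℚ.+ reward (next R T j) c (w j) ℚ.≤ reward (R j) (ι (mem T j) + c) (w j)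
  reward-step R T j c v with mem T j in e
  reward-step R T j c v | true with R j | proj₁ (v j e)
  ... | suc zero    | _ = ℚ.≤-reflexive (ℚ.+-identityʳ (w j))
  ... | suc (suc k) | _ = ℚ.≤-reflexive (ℚ.+-identityˡ _)
  reward-step R T j c v | false with closes R T j
  ... | true  = subst (ℚ._≤ reward (R j) c (w j)) (sym (ℚ.+-identityˡ 0ℚ)) (reward-≥0 (R j) c j)
  ... | false = ℚ.≤-reflexive (ℚ.+-identityˡ _)

  run-reward : ∀ {t R ρ W} → AbsRun t R ρ W → W ℚ.≤ Σℚ.sum (λ j → reward (R j) (count j (sets ρ)) (w j))
  run-reward {R = R} stop = subst (ℚ._≤ Σℚ.sum (λ j → reward (R j) 0 (w j))) (Σℚ.sum-replicate-zero n)
                     (sumℚ-mono (λ j → reward-≥0 (R j) 0 j))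
  run-reward {R = R} (process {t} {R} {T} {ρ} {W} _ v run) = begin
    Σℚ.sum (gains R T) ℚ.+ W
      ≤⟨ ℚ.+-monoʳ-≤ (Σℚ.sum (gains R T)) (run-reward run) ⟩
    Σℚ.sum (gains R T) ℚ.+ Σℚ.sum (λ j → reward (next R T j) (count j (sets ρ)) (w j))
      ≡⟨ Σℚ.∑-distrib-+ (gains R T) (λ j → reward (next R T j) (count j (sets ρ)) (w j)) ⟨
    Σℚ.sum (λ j → gains R T j ℚ.+ reward (next R T j) (count j (sets ρ)) (w j))
      ≤⟨ sumℚ-mono (λ j → reward-step R T j (count j (sets ρ)) v) ⟩
    Σℚ.sum (λ j → reward (R j) (ι (mem T j) + count j (sets ρ)) (w j)) ∎
    where open ℚ.≤-Reasoning

  run-later : ∀ {t R ρ W} → AbsRun t R ρ W → All (λ s → t ℤ.< proj₁ s) ρ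
  run-later stop = []
  run-later (process {t} {R} {T} _ _ run) = nextSlot-> t T ∷ All.map (ℤ.<-trans (nextSlot-> t T)) (run-later run)

  run-increasing : ∀ {t R ρ W} → AbsRun t R ρ W → AllPairs (λ s s′ → proj₁ s ℤ.< proj₁ s′) ρ
  run-increasing stop         = []
  run-increasing (process _ _ run) = run-later run ∷ run-increasing run

  run-slot : ∀ {t R ρ W s T} → AbsRun t R ρ W → (s , T) ∈ ρ →
             length T ≤ c₀ × (∀ j → mem T j ≡ true → Window j s)
  run-slot (process {t} {T = T} le v run) (here refl) = le , λ j m → nextSlot-released t T m , proj₂ (v j m)
  run-slot (process _ _ run) (there i) = run-slot run i

  emit-∈⁻ : ∀ ρ {t j} → (t , ℤ.+ toℕ j) ∈ emit (concrete ρ) → ∃[ T ] ((t , T) ∈ ρ × mem T j ≡ true)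
  emit-∈⁻ ((s , T) ∷ ρ) {t} {j} = scan T id
    where
    scan : ∀ S → (∀ {e} → e ∈ S → e ∈ T) → (t , ℤ.+ toℕ j) ∈ emitSlot s (tuple S) (emit (concrete ρ)) →
           ∃[ T′ ] ((t , T′) ∈ ((s , T) ∷ ρ) × mem T′ j ≡ true)
    scan [] sub k with emit-∈⁻ ρ k
    ... | T′ , i , m = T′ , there i , m
    scan ((i , c) ∷ S) sub (there k) = scan S (sub ∘ there) k
    scan ((i , c) ∷ S) sub (here eq) with Fin.toℕ-injective (ℤ.+-injective (cong proj₂ eq)) | cong proj₁ eq
    ... | refl | refl = T , here refl , mem-∈ (sub (here refl))

  emit-∈⁺ : ∀ ρ {t j T} → (t , T) ∈ ρ → mem T j ≡ true → (t , ℤ.+ toℕ j) ∈ emit (concrete ρ)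
  emit-∈⁺ ((s , T) ∷ ρ) {j = j} (here refl) m = scan T (proj₂ (mem-∈⁻ T m))
    where
    scan : ∀ S {c} → (j , c) ∈ S → (s , ℤ.+ toℕ j) ∈ emitSlot s (tuple S) (emit (concrete ρ))
    scan (_ ∷ S) (here refl) = here refl
    scan (_ ∷ S) (there k)   = there (scan S k)
  emit-∈⁺ ((s , T) ∷ ρ) {t} {j} (there i) m = scan T
    where
    scan : ∀ S → (t , ℤ.+ toℕ j) ∈ emitSlot s (tuple S) (emit (concrete ρ))
    scan []      = emit-∈⁺ ρ i m
    scan (_ ∷ S) = there (scan S)

  module _ {t₀ ρ W} (run : AbsRun t₀ p ρ W) (short : length ρ ≤ K) where

    schedule : Schedule
    schedule t = Vec.tabulate (λ j → does ((t , ℤ.+ toℕ j) ∈? emit (concrete ρ)))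

    schedule-∈⁻ : ∀ {t j} → j ∈ₛ schedule t → ∃[ T ] ((t , T) ∈ ρ × mem T j ≡ true)
    schedule-∈⁻ {t} {j} i = emit-∈⁻ ρ (does⁻ ((t , ℤ.+ toℕ j) ∈? emit (concrete ρ))
      (trans (sym (Vec.lookup∘tabulate _ j)) (Vec.[]=⇒lookup i)))

    schedule-∈⁺ : ∀ {t j T} → (t , T) ∈ ρ → mem T j ≡ true → j ∈ₛ schedule t
    schedule-∈⁺ {t} {j} i m = Vec.lookup⇒[]= j (schedule t)
      (trans (Vec.lookup∘tabulate _ j) (does⁺ ((t , ℤ.+ toℕ j) ∈? emit (concrete ρ)) (emit-∈⁺ ρ i m)))

    private
      same-slot : ∀ {ρ : List (ℤ × List (Fin n × ℕ))} {t T T′} → AllPairs (λ s s′ → proj₁ s ℤ.< proj₁ s′) ρ →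
                  (t , T) ∈ ρ → (t , T′) ∈ ρ → T ≡ T′
      same-slot (_ ∷ _)  (here refl) (here refl) = refl
      same-slot (h ∷ _)  (here refl) (there i)   = ⊥-elim (ℤ.<-irrefl refl (All.lookup h i))
      same-slot (h ∷ _)  (there i)   (here refl) = ⊥-elim (ℤ.<-irrefl refl (All.lookup h i))
      same-slot (_ ∷ ps) (there i)   (there k)   = same-slot ps i k

      at-slot : ∀ t → (∃[ T ] (t , T) ∈ ρ) ⊎ (∀ {T} → ¬ ((t , T) ∈ ρ))
      at-slot t = search ρ
        where
        search : ∀ ρ → (∃[ T ] (t , T) ∈ ρ) ⊎ (∀ {T} → ¬ ((t , T) ∈ ρ))
        search [] = inj₂ λ ()
        search ((s , T) ∷ ρ) with t ℤ.≟ s | search ρ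
        ... | yes refl | _            = inj₁ (T , here refl)
        ... | no _     | inj₁ (T′ , i) = inj₁ (T′ , there i)
        ... | no t≢s   | inj₂ none    = inj₂ λ { (here refl) → t≢s refl ; (there i) → none i }

    schedule-capacity : ∀ t → ∣ schedule t ∣ ≤ m
    schedule-capacity t with at-slot t
    ... | inj₁ (T , i) = begin
      ∣ schedule t ∣ ≡⟨ ∣∣-∥∥ (schedule t) ⟩
      ∥ Vec.lookup (schedule t) ∥ ≤⟨ ∥∥-mono {B = mem T} member ⟩
      ∥ mem T ∥ ≤⟨ mem-size T ⟩
      length T ≤⟨ proj₁ (run-slot run i) ⟩
      c₀ ≤⟨ ℕ.m⊓n≤m m n ⟩
      m                             ∎
      where
      open ℕ.≤-Reasoning
      member : ∀ j → Vec.lookup (schedule t) j ≡ true → mem T j ≡ true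
      member j h with schedule-∈⁻ (Vec.lookup⇒[]= j (schedule t) h)
      ... | T′ , i′ , h′ = subst (λ S → mem S j ≡ true) (same-slot (run-increasing run) i′ i) h′
    ... | inj₂ none = begin
      ∣ schedule t ∣ ≡⟨ ∣∣-∥∥ (schedule t) ⟩
      ∥ Vec.lookup (schedule t) ∥ ≤⟨ ∥∥-mono {B = λ _ → false} empty ⟩
      ∥ (λ (_ : Fin n) → false) ∥ ≡⟨ sum-zero {n} (λ _ → refl) ⟩
      0 ≤⟨ z≤n ⟩
      m                             ∎
      where
      open ℕ.≤-Reasoning
      empty : ∀ j → Vec.lookup (schedule t) j ≡ true → false ≡ true
      empty j h with schedule-∈⁻ (Vec.lookup⇒[]= j (schedule t) h)
      ... | _ , i , _ = ⊥-elim (none i)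

    schedule-feasible : Feasible schedule
    schedule-feasible = record
      { capacity = schedule-capacity
      ; window   = λ t j i → let _ , k , h = schedule-∈⁻ i in proj₂ (run-slot run k) j h
      ; budget   = map proj₁ ρ , subst (_≤ K) (sym (List.length-map proj₁ ρ)) short ,
                   λ t (j , i) → let _ , k , _ = schedule-∈⁻ i in ∈-map⁺ proj₁ k
      }

    private
      runs? : ∀ j (s : ℤ × List (Fin n × ℕ)) → Dec (mem (proj₂ s) j ≡ true)
      runs? j s = mem (proj₂ s) j Bool.≟ true

      times : Fin n → List ℤ
      times j = map proj₁ (filter (runs? j) ρ)

      times-length : ∀ j → length (times j) ≡ count j (sets ρ)
      times-length j = trans (List.length-map proj₁ (filter (runs? j) ρ)) (scan ρ)
        where
        scan : ∀ ρ → length (filter (runs? j) ρ) ≡ count j (sets ρ)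
        scan [] = refl
        scan ((t , T) ∷ ρ) with mem T j
        ... | true  = cong suc (scan ρ)
        ... | false = scan ρ

      times-unique : ∀ j → Unique (times j)
      times-unique j = AllPairs.map⁺ (AllPairs.filter⁺ (runs? j) (AP.map ℤ.<⇒≢ (run-increasing run)))

    -- The times of a run strictly increase, so those at which j is processed are distinct elements
    -- of `slots j`, and distinct elements can be counted by inclusion.
    schedule-units : ∀ j → count j (sets ρ) ≤ units schedule j
    schedule-units j = subst (_≤ units schedule j) (times-length j) (unique-length (times-unique j) inside)
      where
      inside : ∀ {t} → t ∈ times j → t ∈ filter (λ t → j ∈ₛ? schedule t) (slots j)
      inside i with ∈-map⁻ proj₁ i
      ... | s , k , refl with ∈-filter⁻ (runs? j) {xs = ρ} k
      ...   | k′ , h = ∈-filter⁺ (λ t → j ∈ₛ? schedule t) (slots-∈⁺ {j} (proj₂ (run-slot run k′) j h)) (schedule-∈⁺ k′ h)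

    schedule-throughput : W ℚ.≤ throughput schedule
    schedule-throughput = begin
      W ≤⟨ run-reward run ⟩
      Σℚ.sum (λ j → reward (p j) (count j (sets ρ)) (w j)) ≤⟨ sumℚ-mono pointwise ⟩
      Σℚ.sum (λ j → if does (completed? schedule j) then w j else 0ℚ) ≡⟨ throughput-sum schedule ⟨
      throughput schedule                                      ∎
      where
      open ℚ.≤-Reasoning
      pointwise : ∀ j → reward (p j) (count j (sets ρ)) (w j) ℚ.≤ (if does (completed? schedule j) then w j else 0ℚ)
      pointwise j with does (1 ℕ.≤? p j) | does (p j ℕ.≤? count j (sets ρ)) in e
      ... | true | true rewrite does⁺ (completed? schedule j) (ℕ.≤-trans (does⁻ (p j ℕ.≤? count j (sets ρ)) e) (schedule-units j)) = ℚ.≤-refl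
      ... | true | false with does (completed? schedule j)
      ...   | true  = w≥0 j
      ...   | false = ℚ.≤-refl
      pointwise j | false | _ with does (completed? schedule j)
      ...   | true  = w≥0 j
      ...   | false = ℚ.≤-refl

-- Completeness

count-∈⁺ : ∀ {n} {j : Fin n} {s π} → s ∈ π → proj₂ s j ≡ true → 1 ≤ count j π
count-∈⁺ {j = j} {s} {_ ∷ π} (here refl) h rewrite h = s≤s z≤n
count-∈⁺ {j = j} {π = s ∷ π} (there i) h = ℕ.≤-trans (count-∈⁺ i h) (ℕ.m≤n+m _ (ι (proj₂ s j)))

firstWith : ∀ {n} → Fin n → List (Slot n) → JobSet n
firstWith j []            = λ _ → false
firstWith j ((_ , A) ∷ π) = if A j then A else firstWith j π

firstWith-∈ : ∀ {n} (j : Fin n) π → 1 ≤ count j π → ∃[ s ] (s ∈ π × proj₂ s ≡ firstWith j π × proj₂ s j ≡ true)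
firstWith-∈ j ((t , A) ∷ π) h with A j in e
... | true  = (t , A) , here refl , refl , e
... | false with firstWith-∈ j π h
...   | s , i , e′ , h′ = s , there i , e′ , h′

firstWith-size : ∀ {n c} (j : Fin n) {π} → All (λ s → ∥ proj₂ s ∥ ≤ c) π → ∥ firstWith j π ∥ ≤ c
firstWith-size {n} j [] = subst (_≤ _) (sym (sum-zero {n} (λ _ → refl))) z≤n
firstWith-size j {(t , A) ∷ π} (h ∷ hs) with A j
... | true  = h
... | false = firstWith-size j hs

filter-length : ∀ {k} {X : Set} {P : X → Set} (P? : ∀ x → Dec (P x)) (f : Fin k → X) →
                length (filter P? (tabulate f)) ≡ ∥ (λ j → does (P? (f j))) ∥
filter-length {zero}  P? f = refl
filter-length {suc k} P? f with does (P? (f zero))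
... | true  = cong suc (filter-length P? (f ∘ suc))
... | false = filter-length P? (f ∘ suc)

module _ {n} (order : StrictTotalOrderᵇ n) where
  open StrictTotalOrderᵇ order

  greatest : ∀ {P : Fin n → Set} → (∀ i → Dec (P i)) →
             (∃[ g ] (P g × (∀ i → P i → i ≡ g ⊎ i ≺ g))) ⊎ (∀ i → ¬ P i)
  greatest {P} P? with scan (allFin n)
    where
    scan : ∀ xs → (∃[ g ] (P g × (∀ i → i ∈ xs → P i → i ≡ g ⊎ i ≺ g))) ⊎ (∀ i → i ∈ xs → ¬ P i)
    scan [] = inj₂ λ _ ()
    scan (x ∷ xs) with P? x | scan xs
    ... | no ¬Px | inj₁ (g , Pg , h) = inj₁ (g , Pg , λ { _ (here refl) Px → ⊥-elim (¬Px Px) ; i (there k) → h i k })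
    ... | no ¬Px | inj₂ none = inj₂ λ { _ (here refl) → ¬Px ; i (there k) → none i k }
    ... | yes Px | inj₂ none = inj₁ (x , Px , λ { _ (here refl) _ → inj₁ refl ; i (there k) Pi → ⊥-elim (none i k Pi) })
    ... | yes Px | inj₁ (g , Pg , h) with total x g
    ...   | inj₁ refl       = inj₁ (g , Pg , λ { _ (here refl) _ → inj₁ refl ; i (there k) → h i k })
    ...   | inj₂ (inj₁ x≺g) = inj₁ (g , Pg , λ { _ (here refl) _ → inj₂ x≺g ; i (there k) → h i k })
    ...   | inj₂ (inj₂ g≺x) = inj₁ (x , Px , λ { _ (here refl) _ → inj₁ refl ; i (there k) Pi → inj₂ (below i (h i k Pi)) })
      where
      below : ∀ i → i ≡ g ⊎ i ≺ g → i ≺ x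
      below i (inj₁ refl) = g≺x
      below i (inj₂ i≺g)  = ≺-trans i g x i≺g g≺x
  ... | inj₁ (g , Pg , h) = inj₁ (g , Pg , λ i → h i (∈-allFin i))
  ... | inj₂ none         = inj₂ λ i → none i (∈-allFin i)

  Cross : List (Slot n) → List (Slot n) → Set
  Cross α β = ∀ {s s′} → s ∈ α → s′ ∈ β → Tidy (proj₂ s) (proj₂ s′)

  Partial : List (Slot n) → List (Slot n) → Fin n → Set
  Partial α β j = 1 ≤ count j α × 1 ≤ count j β

  partial? : ∀ α β → Decidable (Partial α β)
  partial? α β j = (1 ℕ.≤? count j α) ×-dec (1 ℕ.≤? count j β)

  -- Pick for every partial job a slot of α and a slot of β in which it runs.
  -- Of two partial jobs, one runs in a slot picked for the other; but each
  -- of the 2k picked slots holds at most c jobs, so k² ≤ 2 · k · 2c.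
  partial-bound : ∀ {c α β} → Cross α β → All (λ s → ∥ proj₂ s ∥ ≤ c) α → All (λ s → ∥ proj₂ s ∥ ≤ c) β →
                  ∥ (λ j → does (partial? α β j)) ∥ ≤ c + c + (c + c)
  partial-bound {c} {α} {β} cross sα sβ = cancel k refl
    where
    open +-*-Solver
    q : Fin n → ℕ
    q j = ι (does (partial? α β j))
    X Y : Fin n → JobSet n
    X j = firstWith j α
    Y j = firstWith j β
    f : Fin n → Fin n → ℕ
    f a b = ι (X a b) + ι (Y a b)
    k : ℕ
    k = Σℕ.sum q

    Xself : ∀ {j} → 1 ≤ count j α → X j j ≡ true
    Xself {j} h with firstWith-∈ j α h
    ... | s , _ , e , h′ rewrite sym e = h′

    -- Let a ≺ b. If the slot of α picked for b omits a, then tidiness forces every slot of β with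
    -- a, in particular the one picked for a, to run b too.
    ordered : ∀ {a b} → Partial α β a → Partial α β b → a ≺ b → X b a ≡ true ⊎ Y a b ≡ true
    ordered {a} {b} (_ , βa) (αb , _) a≺b with X b a in e
    ... | true  = inj₁ refl
    ... | false with firstWith-∈ b α αb | firstWith-∈ a β βa
    ...   | s , i , es , hs | s′ , i′ , es′ , hs′ = inj₂ (subst (λ S → S b ≡ true) es′
            (cross i i′ a b a≺b hs (subst (λ S → S a ≡ false) (sym es) e) hs′))

    pairs : ∀ a b → Partial α β a → Partial α β b → 1 ≤ f a b + f b a
    pairs a b pa pb with total a b
    ... | inj₁ refl rewrite Xself (proj₁ pa) = s≤s z≤n
    ... | inj₂ (inj₁ a≺b) with ordered pa pb a≺b
    ...   | inj₁ h rewrite h = ℕ.≤-trans (s≤s z≤n) (ℕ.m≤n+m _ (f a b))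
    ...   | inj₂ h rewrite h = ℕ.≤-trans (ℕ.m≤n+m 1 (ι (X a b))) (ℕ.m≤m+n _ _)
    pairs a b pa pb | inj₂ (inj₂ b≺a) with ordered pb pa b≺a
    ...   | inj₁ h rewrite h = s≤s z≤n
    ...   | inj₂ h rewrite h = ℕ.≤-trans (ℕ.m≤n+m 1 (ι (X b a))) (ℕ.m≤n+m _ (f a b))

    pointwise : ∀ a b → q a * q b ≤ q a * f a b + q b * f b a
    pointwise a b with does (partial? α β a) in ea | does (partial? α β b) in eb
    ... | true  | true  = subst₂ (λ x y → 1 ≤ x + y) (sym (ℕ.+-identityʳ (f a b))) (sym (ℕ.+-identityʳ (f b a)))
                            (pairs a b (does⁻ (partial? α β a) ea) (does⁻ (partial? α β b) eb))
    ... | true  | false = z≤n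
    ... | false | _     = z≤n

    total-f : Σℕ.sum (λ a → Σℕ.sum (λ b → q a * f a b)) ≤ k * (c + c)
    total-f = begin
      Σℕ.sum (λ a → Σℕ.sum (λ b → q a * f a b)) ≤⟨ sum-mono (λ a → begin
          Σℕ.sum (λ b → q a * f a b) ≡⟨ sum-*ˡ (f a) (q a) ⟩
          q a * Σℕ.sum (f a) ≡⟨ cong (q a *_) (Σℕ.∑-distrib-+ (ι ∘ X a) (ι ∘ Y a)) ⟩
          q a * (Σℕ.sum (ι ∘ X a) + Σℕ.sum (ι ∘ Y a))
            ≡⟨ cong₂ (λ x y → q a * (x + y)) (∥∥-sum (X a)) (∥∥-sum (Y a)) ⟨
          q a * (∥ X a ∥ + ∥ Y a ∥) ≤⟨ ℕ.*-monoʳ-≤ (q a) (ℕ.+-mono-≤ (firstWith-size a sα) (firstWith-size a sβ)) ⟩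
          q a * (c + c)                            ∎) ⟩
      Σℕ.sum (λ a → q a * (c + c)) ≡⟨ sum-*ʳ q (c + c) ⟩
      k * (c + c)                                 ∎
      where open ℕ.≤-Reasoning

    squared : k * k ≤ k * (c + c + (c + c))
    squared = begin
      k * k ≡⟨ sum-*ʳ q k ⟨
      Σℕ.sum (λ a → q a * k) ≡⟨ Σℕ.sum-cong-≗ (λ a → sum-*ˡ q (q a)) ⟨
      Σℕ.sum (λ a → Σℕ.sum (λ b → q a * q b)) ≤⟨ sum-mono (λ a → sum-mono (pointwise a)) ⟩
      Σℕ.sum (λ a → Σℕ.sum (λ b → q a * f a b + q b * f b a))
        ≡⟨ Σℕ.sum-cong-≗ (λ a → Σℕ.∑-distrib-+ (λ b → q a * f a b) (λ b → q b * f b a)) ⟩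
      Σℕ.sum (λ a → Σℕ.sum (λ b → q a * f a b) + Σℕ.sum (λ b → q b * f b a))
        ≡⟨ Σℕ.∑-distrib-+ (λ a → Σℕ.sum (λ b → q a * f a b)) (λ a → Σℕ.sum (λ b → q b * f b a)) ⟩
      Σℕ.sum (λ a → Σℕ.sum (λ b → q a * f a b)) + Σℕ.sum (λ a → Σℕ.sum (λ b → q b * f b a))
        ≡⟨ cong (Σℕ.sum (λ a → Σℕ.sum (λ b → q a * f a b)) +_) (Σℕ.∑-comm (λ a b → q b * f b a)) ⟩
      Σℕ.sum (λ a → Σℕ.sum (λ b → q a * f a b)) + Σℕ.sum (λ b → Σℕ.sum (λ a → q b * f b a))
        ≤⟨ ℕ.+-mono-≤ total-f total-f ⟩
      k * (c + c) + k * (c + c) ≡⟨ ℕ.*-distribˡ-+ k (c + c) (c + c) ⟨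
      k * (c + c + (c + c))                                       ∎
      where open ℕ.≤-Reasoning

    cancel : ∀ k′ → k ≡ k′ → ∥ (λ j → does (partial? α β j)) ∥ ≤ c + c + (c + c)
    cancel zero    e = ℕ.≤-trans (ℕ.≤-reflexive (trans (∥∥-sum (λ j → does (partial? α β j))) e)) z≤n
    cancel (suc k′) e = ℕ.≤-trans (ℕ.≤-reflexive (trans (∥∥-sum (λ j → does (partial? α β j))) e))
      (ℕ.*-cancelˡ-≤ (suc k′) (subst (λ x → x * x ≤ x * (c + c + (c + c))) e squared))

count-≤-length : ∀ {n} (j : Fin n) π → count j π ≤ length π
count-≤-length j []            = z≤n
count-≤-length j ((_ , A) ∷ π) with A j
... | true  = s≤s (count-≤-length j π)
... | false = ℕ.m≤n⇒m≤1+n (count-≤-length j π)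

-- States of canonical schedules

module CanonicalStates (I : Instance) where
  open Instance I
  open Spec I
  open Solution I
  open StrictTotalOrderᵇ order using (_≺_; ≺-trans; Tidy)
  open Exchange order r d

  Finished Closed : List (Slot n) → List (Slot n) → Fin n → Set
  Finished α β i = 1 ≤ count i α × count i β ≡ 0
  Closed α β j   = ∃[ i ] (Finished α β i × (j ≡ i ⊎ j ≺ i))

  finished? : ∀ α β i → Dec (Finished α β i)
  finished? α β i = (1 ℕ.≤? count i α) ×-dec (count i β ℕ.≟ 0)

  -- After the slots α of a canonical schedule, with the slots β still to come.
  Remaining : List (Slot n) → List (Slot n) → (Fin n → ℕ) → Set
  Remaining α β R = ∀ j → (1 ≤ count j β × R j ≡ count j β) ⊎
                    (count j β ≡ 0 × ((Closed α β j × R j ≡ 0) ⊎ (¬ Closed α β j × R j ≡ p j)))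

  -- In a balanced schedule, a job that has run and has no slot left is complete, and a job that has
  -- yet to start still needs all of its p_j units. The latter is why `describe` can fall back on
  -- p_j.
  Balanced : List (Slot n) → List (Slot n) → Set
  Balanced α β = ∀ j → count j α + count j β ≡ 0 ⊎ count j α + count j β ≡ p j

  next-mem : ∀ R T {j} → mem T j ≡ true → next R T j ≡ R j ∸ 1
  next-mem R T = if-true

  next-keep : ∀ R T {j} → mem T j ≡ false → closes R T j ≡ false → next R T j ≡ R j
  next-keep R T h c = trans (if-false h) (if-false c)

  next-close : ∀ R T {j} → mem T j ≡ false → closes R T j ≡ true → next R T j ≡ 0
  next-close R T h c = trans (if-false h) (if-true c)

  module _ {α t A β R T} (mem≡ : ∀ j → mem T j ≡ A j) (tidy : All (λ s → Tidy A (proj₂ s)) β)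
           (rem : Remaining α ((t , A) ∷ β) R) where

    running : ∀ {j} → A j ≡ true → R j ≡ suc (count j β)
    running {j} h with A j | rem j
    running refl | true | inj₁ (_ , e) = e

    private
      finishing : ∀ {i} → A i ≡ true → R i ≤ 1 → count i β ≡ 0
      finishing h le = ℕ.n≤0⇒n≡0 (ℕ.≤-pred (subst (_≤ 1) (running h) le))

      -- If some i after j finished in A, then by tidiness each later slot with j would also run i,
      -- which has just received its last unit.
      not-closing : ∀ {j} → A j ≡ false → 1 ≤ count j β → closes R T j ≡ false
      not-closing {j} Aj ge = Bool.¬-not λ c → absurd (closes⁻ R T j c)
        where
        absurd : ¬ (∃[ i ] (mem T i ≡ true × R i ≤ 1 × j ≺ i))
        absurd (i , mi , le , lt) with trans (sym (mem≡ i)) mi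
        ... | Ai with firstWith-∈ j β ge
        ...   | s , k , _ , h = ℕ.<⇒≢ (count-∈⁺ k (All.lookup tidy k j i lt Ai Aj h)) (sym (finishing Ai le))

      closed-∷ : ∀ {j} → Closed α ((t , A) ∷ β) j → Closed ((t , A) ∷ α) β j
      closed-∷ (i , (ge , z) , lt) = i , (ℕ.≤-trans ge (ℕ.m≤n+m _ (ι (A i))) , ℕ.m+n≡0⇒n≡0 (ι (A i)) z) , lt

      closed-new : ∀ {i} → A i ≡ true → count i β ≡ 0 → Finished ((t , A) ∷ α) β i
      closed-new h z rewrite h = s≤s z≤n , z

      not-closed : ∀ {j} → A j ≡ false → ¬ Closed α ((t , A) ∷ β) j → closes R T j ≡ false →
                   ¬ Closed ((t , A) ∷ α) β j
      not-closed {j} Aj ncl nc (i , (ge , z) , lt) with A i in Ai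
      ... | false = ncl (i , (ge , trans (cong (λ b → ι b + count i β) Ai) z) , lt)
      ... | true with lt
      ...   | inj₁ refl = false≢true (trans (sym Aj) Ai)
      ...   | inj₂ j≺i  = false≢true (trans (sym nc) (closes⁺ R T (trans (mem≡ i) Ai)
                            (ℕ.≤-reflexive (trans (running Ai) (cong suc z))) j≺i))

    -- A running job loses one unit and with its last one becomes finished, closing itself. A
    -- waiting job with slots to come is left alone by `not-closing`. Any other job becomes closed
    -- exactly when a job after it finishes now, the condition tested by `closesC`.
    next-remaining : Remaining ((t , A) ∷ α) β (next R T)
    next-remaining j with A j in Aj | rem j
    ... | true | inj₁ (_ , e) = continue (count j β) refl
      where
      value : next R T j ≡ count j β
      value = trans (next-mem R T (trans (mem≡ j) Aj)) (cong (_∸ 1) e)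
      continue : ∀ k → count j β ≡ k → (1 ≤ count j β × next R T j ≡ count j β) ⊎
        (count j β ≡ 0 × ((Closed ((t , A) ∷ α) β j × next R T j ≡ 0) ⊎ (¬ Closed ((t , A) ∷ α) β j × next R T j ≡ p j)))
      continue zero    z = inj₂ (z , inj₁ ((j , closed-new Aj z , inj₁ refl) , trans value z))
      continue (suc k) z = inj₁ (subst (1 ≤_) (sym z) (s≤s z≤n) , value)
    ... | false | inj₁ (ge , e) =
      inj₁ (ge , trans (next-keep R T (trans (mem≡ j) Aj) (not-closing Aj ge)) e)
    ... | false | inj₂ (z , inj₁ (cl , e)) = inj₂ (z , inj₁ (closed-∷ cl , value (closes R T j) refl))
      where
      value : ∀ b → closes R T j ≡ b → next R T j ≡ 0
      value true  c = next-close R T (trans (mem≡ j) Aj) c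
      value false c = trans (next-keep R T (trans (mem≡ j) Aj) c) e
    ... | false | inj₂ (z , inj₂ (ncl , e)) = inj₂ (z , cases (closes R T j) refl)
      where
      cases : ∀ b → closes R T j ≡ b →
              (Closed ((t , A) ∷ α) β j × next R T j ≡ 0) ⊎ (¬ Closed ((t , A) ∷ α) β j × next R T j ≡ p j)
      cases false c = inj₂ (not-closed Aj ncl c , trans (next-keep R T (trans (mem≡ j) Aj) c) e)
      cases true  c with closes⁻ R T j c
      ... | i , mi , le , lt = inj₁ ((i , closed-new Ai (finishing Ai le) , inj₂ lt) ,
                                     next-close R T (trans (mem≡ j) Aj) c)
        where
        Ai : A i ≡ true
        Ai = trans (sym (mem≡ i)) mi

  pick : Fin n → Fin n × ℕ → ℕ → ℕ
  pick j e y = if δ (proj₁ e) j then proj₂ e else y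

  pick-∈ : ∀ {j v z} S → (∀ {c} → (j , c) ∈ S → c ≡ v) → ∃[ c ] (j , c) ∈ S → foldr (pick j) z S ≡ v
  pick-∈ {j} ((i , c) ∷ S) h k with δ i j in e
  ... | true  rewrite δ-true {i = i} e = h (here refl)
  pick-∈ {j} ((i , c) ∷ S) h (_ , here refl) | false = ⊥-elim (false≢true (trans (sym e) (δ-refl i)))
  pick-∈ {j} ((i , c) ∷ S) h (c′ , there k)  | false = pick-∈ S (λ k → h (there k)) (c′ , k)

  pick-default : ∀ {j v z} S → (∀ {c} → (j , c) ∈ S → c ≡ v) → z ≡ v → foldr (pick j) z S ≡ v
  pick-default [] h e = e
  pick-default {j} ((i , c) ∷ S) h e with δ i j in eq
  ... | true  rewrite δ-true {i = i} eq = h (here refl)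
  ... | false = pick-default S (λ k → h (there k)) e

  pick-∉ : ∀ {j z} S → (∀ {c} → ¬ ((j , c) ∈ S)) → foldr (pick j) z S ≡ z
  pick-∉ S h = pick-default S (λ k → ⊥-elim (h k)) refl

  defaultWork-0 : ∀ {j i} S → (i , 0) ∈ S → j ≺ i → defaultWork S j ≡ 0
  defaultWork-0 (_ ∷ S) (here refl) lt = if-true lt
  defaultWork-0 {j} ((i′ , c) ∷ S) (there k) lt with does (ℤ.+ c ℤ.≤? 0ℤ) | before j i′
  ... | true  | true  = refl
  ... | true  | false = defaultWork-0 S k lt
  ... | false | _     = defaultWork-0 S k lt

  defaultWork-p : ∀ {j} S → (∀ {i c} → (i , c) ∈ S → c ≤ 0 → ¬ (j ≺ i)) → defaultWork S j ≡ p j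
  defaultWork-p [] h = refl
  defaultWork-p {j} ((i , c) ∷ S) h with does (ℤ.+ c ℤ.≤? 0ℤ) in e | before j i in e′
  ... | true  | true  = ⊥-elim (h (here refl) (ℤ.drop‿+≤+ (does⁻ (ℤ.+ c ℤ.≤? 0ℤ) e)) e′)
  ... | true  | false = defaultWork-p S (λ k → h (there k))
  ... | false | _     = defaultWork-p S (λ k → h (there k))

  module _ {α β R} (bal : Balanced α β) (cross : Cross order α β) (rem : Remaining α β R)
           (sα : All (λ s → ∥ proj₂ s ∥ ≤ c₀) α) (sβ : All (λ s → ∥ proj₂ s ∥ ≤ c₀) β) where

    private
      partials : List (Fin n)
      partials = filter (partial? order α β) (allFin n)

      Q : List (Fin n × ℕ)
      Q = map (λ j → j , count j β) partials

      Q-∈⁻ : ∀ {j c} → (j , c) ∈ Q → Partial order α β j × c ≡ count j β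
      Q-∈⁻ k with ∈-map⁻ _ k
      ... | j , i , refl = proj₂ (∈-filter⁻ (partial? order α β) {xs = allFin n} i) , refl

      Q-∈⁺ : ∀ {j} → Partial order α β j → (j , count j β) ∈ Q
      Q-∈⁺ {j} pj = ∈-map⁺ _ (∈-filter⁺ (partial? order α β) (∈-allFin j) pj)

      Q-length : length Q ≤ c₀ + c₀ + (c₀ + c₀)
      Q-length = ℕ.≤-trans
        (ℕ.≤-reflexive (trans (List.length-map (λ j → j , count j β) partials) (filter-length (partial? order α β) id)))
        (partial-bound order cross sα sβ)

      unstarted : ∀ {j} → ¬ Partial order α β j → 1 ≤ count j β → count j α ≡ 0
      unstarted {j} np ge with count j α
      ... | zero  = refl
      ... | suc _ = ⊥-elim (np (s≤s z≤n , ge))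

      unstarted-work : ∀ {j} → 1 ≤ count j β → count j α ≡ 0 → count j β ≡ p j
      unstarted-work {j} ge z with bal j
      ... | inj₁ e = ⊥-elim (ℕ.<⇒≢ ge (sym (ℕ.m+n≡0⇒n≡0 (count j α) e)))
      ... | inj₂ e = trans (cong (_+ count j β) (sym z)) e

      -- If j preceded g, then a slot of α with g lacks the unstarted j, so by tidiness a slot of β
      -- with j would run g, which is finished.
      finished-first : ∀ {j g} → Finished α β g → 1 ≤ count j β → count j α ≡ 0 → ¬ (j ≺ g)
      finished-first {j} {g} (ge , z) geβ zα j≺g with firstWith-∈ g α ge | firstWith-∈ j β geβ
      ... | s , k , _ , gs | s′ , k′ , _ , js′ =
        ℕ.<⇒≢ (count-∈⁺ k′ (cross k k′ j g j≺g gs (Bool.¬-not (λ js → ℕ.<⇒≢ (count-∈⁺ k js) (sym zα))) js′)) (sym z)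

      -- `G` is the greatest finished job with work 0, or empty if no job is finished; `G-top`
      -- covers both cases. Together with the partial jobs `Q` it forms the tuple that describes the
      -- state.
      module _ (G : List (Fin n × ℕ)) (G-∈⁻ : ∀ {i c} → (i , c) ∈ G → Finished α β i × c ≡ 0)
               (G-top : ∀ i → Finished α β i → ∃[ g ] ((g , 0) ∈ G × (i ≡ g ⊎ i ≺ g))) where

        T-∈⁻ : ∀ {j c} → (j , c) ∈ G ++ Q → (Finished α β j × c ≡ 0) ⊎ (Partial order α β j × c ≡ count j β)
        T-∈⁻ k with ∈-++⁻ G k
        ... | inj₁ k′ = inj₁ (G-∈⁻ k′)
        ... | inj₂ k′ = inj₂ (Q-∈⁻ k′)

        default-p : ∀ {j} → (∀ i → Finished α β i → ¬ (j ≺ i)) → defaultWork (G ++ Q) j ≡ p j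
        default-p {j} none = defaultWork-p (G ++ Q) avoid
          where
          avoid : ∀ {i c} → (i , c) ∈ G ++ Q → c ≤ 0 → ¬ (j ≺ i)
          avoid k le with T-∈⁻ k
          ... | inj₁ (fin , _)         = none _ fin
          ... | inj₂ ((_ , ge) , refl) = ⊥-elim (ℕ.<⇒≢ (ℕ.≤-trans ge le) refl)

        -- Partial jobs are read off `Q`. Unstarted jobs with slots to come follow all finished jobs
        -- by `finished-first`, and unclosed jobs do so by definition; both get the default p_j. A
        -- closed job is the greatest finished job itself or precedes it, and gets 0.
        described : ∀ j → R j ≡ describe (G ++ Q) j
        described j with partial? order α β j | rem j
        ... | yes pj | inj₂ (z , _) = ⊥-elim (ℕ.<⇒≢ (proj₂ pj) (sym z))
        ... | yes pj | inj₁ (_ , e) = trans e (sym (pick-∈ (G ++ Q) only (_ , ∈-++⁺ʳ G (Q-∈⁺ pj))))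
          where
          only : ∀ {c} → (j , c) ∈ G ++ Q → c ≡ count j β
          only k with T-∈⁻ k
          ... | inj₁ ((_ , z) , _) = ⊥-elim (ℕ.<⇒≢ (proj₂ pj) (sym z))
          ... | inj₂ (_ , e)       = e
        ... | no np | inj₁ (ge , e) = trans e (trans (unstarted-work ge (unstarted np ge)) (sym
            (trans (pick-∉ (G ++ Q) absent) (default-p (λ i fin → finished-first fin ge (unstarted np ge))))))
          where
          absent : ∀ {c} → ¬ ((j , c) ∈ G ++ Q)
          absent k with T-∈⁻ k
          ... | inj₁ ((_ , z) , _) = ℕ.<⇒≢ ge (sym z)
          ... | inj₂ (pj , _)      = np pj
        ... | no np | inj₂ (_ , inj₂ (nc , e)) = trans e (sym
            (trans (pick-∉ (G ++ Q) absent) (default-p (λ i fin lt → nc (i , fin , inj₂ lt)))))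
          where
          absent : ∀ {c} → ¬ ((j , c) ∈ G ++ Q)
          absent k with T-∈⁻ k
          ... | inj₁ (fin , _) = nc (j , fin , inj₁ refl)
          ... | inj₂ (pj , _)  = np pj
        ... | no np | inj₂ (_ , inj₁ ((i , fi , j≼i) , e)) with G-top i fi
        ...   | g , g∈ , i≼g = trans e (sym (zero-work (below j≼i i≼g)))
          where
          below : j ≡ i ⊎ j ≺ i → i ≡ g ⊎ i ≺ g → j ≡ g ⊎ j ≺ g
          below (inj₁ refl) i≼g       = i≼g
          below (inj₂ lt) (inj₁ refl) = inj₂ lt
          below (inj₂ lt) (inj₂ lt′)  = inj₂ (≺-trans j i g lt lt′)
          only : ∀ {c} → (j , c) ∈ G ++ Q → c ≡ 0
          only k with T-∈⁻ k
          ... | inj₁ (_ , z)  = z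
          ... | inj₂ (pj , _) = ⊥-elim (np pj)
          zero-work : j ≡ g ⊎ j ≺ g → describe (G ++ Q) j ≡ 0
          zero-work (inj₁ refl) = pick-∈ (G ++ Q) only (0 , ∈-++⁺ˡ g∈)
          zero-work (inj₂ lt)   = pick-default (G ++ Q) only (defaultWork-0 (G ++ Q) (∈-++⁺ˡ g∈) lt)

        listed-∈U : ∀ {t} j c → length G ≤ 1 → c ≤ K → length β ≤ K → t ≡ r j ℤ.+ ℤ.+ c → (t , encode R) ∈ U
        listed-∈U j c G≤1 c≤K len e = U-∈ j c (G ++ Q) c≤K short (small ∘ T-∈⁻) e described
          where
          short : length (G ++ Q) ≤ L
          short = ℕ.≤-trans (ℕ.≤-reflexive (trans (List.length-++ G) (ℕ.+-comm (length G) (length Q))))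
                    (ℕ.+-mono-≤ Q-length G≤1)
          small : ∀ {i c} → (Finished α β i × c ≡ 0) ⊎ (Partial order α β i × c ≡ count i β) → c ≤ K
          small (inj₁ (_ , refl)) = z≤n
          small (inj₂ (_ , refl)) = ℕ.≤-trans (count-≤-length _ β) len

    state-∈U : ∀ {t} j c → c ≤ K → length β ≤ K → t ≡ r j ℤ.+ ℤ.+ c → (t , encode R) ∈ U
    state-∈U j c with greatest order (finished? α β)
    ... | inj₂ none = listed-∈U [] (λ ()) (λ i fi → ⊥-elim (none i fi)) j c z≤n
    ... | inj₁ (g , fin , max) = listed-∈U ((g , 0) ∷ []) (λ { (here refl) → fin , refl })
                                   (λ i fi → g , here refl , max i fi) j c (s≤s z≤n)

-- From a feasible schedule to a run in the universe

slotTimes : List ℤ → List ℤ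
slotTimes ts = sort (deduplicate ℤ._≟_ ts)

slotTimes-∈⁺ : ∀ {t ts} → t ∈ ts → t ∈ slotTimes ts
slotTimes-∈⁺ i = ∈-resp-↭ (↭-sym (sort-↭ _)) (∈-deduplicate⁺ ℤ._≟_ i)

slotTimes-unique : ∀ ts → Unique (slotTimes ts)
slotTimes-unique ts = Unique-resp-↭ (↭⇒↭ₛ (↭-sym (sort-↭ (deduplicate ℤ._≟_ ts)))) (deduplicate-! ts)

slotTimes-length : ∀ ts → length (slotTimes ts) ≤ length ts
slotTimes-length ts = unique-length (slotTimes-unique ts) λ i → ∈-deduplicate⁻ ℤ._≟_ ts (∈-resp-↭ (sort-↭ _) i)

slotTimes-increasing : ∀ ts → AllPairs ℤ._<_ (slotTimes ts)
slotTimes-increasing ts = AP.zipWith (λ (le , ne) → ℤ.≤∧≢⇒< le ne)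
  (Sorted⇒AllPairs ℤ.≤-totalOrder (sort-↗ (deduplicate ℤ._≟_ ts)) , slotTimes-unique ts)

∥∥-≤-n : ∀ {n} (A : JobSet n) → ∥ A ∥ ≤ n
∥∥-≤-n {zero}  A = z≤n
∥∥-≤-n {suc n} A = ℕ.+-mono-≤ (bit (A zero)) (∥∥-≤-n (A ∘ suc))
  where
  bit : ∀ b → ι b * 1 ≤ 1
  bit false = z≤n
  bit true  = s≤s z≤n

module Completeness (I : Instance) where
  open Instance I
  open Spec I
  open Solution I
  open CanonicalStates I
  open StrictTotalOrderᵇ order using (_≺_; ≺-trans; Tidy)
  open Exchange order r d

  -- The number in an entry has no meaning for a set of jobs; 0 is a filler that belongs to the
  -- options.
  listing : JobSet n → List (Fin n × ℕ)
  listing A = map (_, 0) (filter (λ j → A j Bool.≟ true) (allFin n))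

  listing-∈⁻ : ∀ A {j c} → (j , c) ∈ listing A → A j ≡ true × c ≡ 0
  listing-∈⁻ A k with ∈-map⁻ _ k
  ... | j , i , refl = proj₂ (∈-filter⁻ (λ j → A j Bool.≟ true) {xs = allFin n} i) , refl

  listing-mem : ∀ A j → mem (listing A) j ≡ A j
  listing-mem A j with A j in e
  ... | true  = mem-∈ {listing A} (∈-map⁺ (_, 0) (∈-filter⁺ (λ j → A j Bool.≟ true) (∈-allFin j) e))
  ... | false = Bool.¬-not λ h → false≢true (trans (sym e) (proj₁ (listing-∈⁻ A (proj₂ (mem-∈⁻ (listing A) h)))))

  listing-length : ∀ A → length (listing A) ≡ ∥ A ∥
  listing-length A = trans (List.length-map (_, 0) (filter (λ j → A j Bool.≟ true) (allFin n)))
    (trans (filter-length (λ j → A j Bool.≟ true) id)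
      (Σℕ.sum-cong-≗ (λ j → cong (λ b → ι b * 1) (does-≟ (A j)))))
    where
    does-≟ : ∀ b → does (b Bool.≟ true) ≡ b
    does-≟ true  = refl
    does-≟ false = refl

  -- For a suffix π of a balanced schedule, a job with a slot in π is completed within π, so this is
  -- the weight still to be gained from j.
  value : List (Slot n) → Fin n → ℚ
  value π j = if does (1 ℕ.≤? count j π) then w j else 0ℚ

  value-step : ∀ {α t A β R T} → (∀ j → mem T j ≡ A j) → All (λ s → Tidy A (proj₂ s)) β →
               Remaining α ((t , A) ∷ β) R → ∀ j → gains R T j ℚ.+ value β j ≡ value ((t , A) ∷ β) j
  value-step {α} {t} {A} {β} {R} {T} mem≡ tidy rem j = cases (A j) refl (count j β) refl
    where
    goal : ∀ a k → A j ≡ a → count j β ≡ k →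
           gains R T j ≡ (if a then (if does (1 ℕ.≤? k) then 0ℚ else w j) else 0ℚ)
    goal false k ea ek = if-false (trans (mem≡ j) ea)
    goal true  k ea ek = trans (if-true (trans (mem≡ j) ea)) (trans (cong (λ x → if does (ℤ.+ x ℤ.≤? 1ℤ) then w j else 0ℚ)
      (trans (running {α} {t} {A} {β} {R} {T} mem≡ tidy rem ea) (cong suc ek))) (last k))
      where
      last : ∀ k → (if does (ℤ.+ suc k ℤ.≤? 1ℤ) then w j else 0ℚ) ≡ (if does (1 ℕ.≤? k) then 0ℚ else w j)
      last zero    = refl
      last (suc k) = refl
    cases : ∀ a → A j ≡ a → ∀ k → count j β ≡ k → gains R T j ℚ.+ value β j ≡ value ((t , A) ∷ β) j
    cases a ea k ek rewrite goal a k ea ek | ea | ek = table-of a k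
      where
      table-of : ∀ a k → (if a then (if does (1 ℕ.≤? k) then 0ℚ else w j) else 0ℚ) ℚ.+ (if does (1 ℕ.≤? k) then w j else 0ℚ)
                 ≡ (if does (1 ℕ.≤? (ι a + k)) then w j else 0ℚ)
      table-of false k       = ℚ.+-identityˡ _
      table-of true  zero    = ℚ.+-identityʳ _
      table-of true  (suc k) = ℚ.+-identityˡ _

  -- The sets of jobs are kept, while each slot moves left as far as the clock and the release times
  -- allow. Since t′ ≤ s, deadlines still hold and the remaining slots stay later; canonicity
  -- concerns only the order of the sets. The invariant t + 1 = r_j + c with c + |β| ≤ K keeps the
  -- clock among the times of the universe.
  build : ∀ {α β t R j c k} → Balanced α β → Cross order α β → Canonical β → Increasing β → All InWindow β →
          All (λ s → ∥ proj₂ s ∥ ≤ c₀) α → All (λ s → ∥ proj₂ s ∥ ≤ c₀) β → All (λ s → t ℤ.< proj₁ s) β →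
          t ℤ.+ 1ℤ ≡ r j ℤ.+ ℤ.+ c → c + length β ≤ K → Remaining α β R → length β ≤ k →
          ∃[ π ] Run (_∈ U) As k (t , encode R) π (Σℚ.sum (value β))
  build {β = []} _ _ _ _ _ _ _ _ _ _ _ _ =
    [] , subst (Run (_∈ U) As _ _ []) (sym (Σℚ.sum-replicate-zero n)) stop
  build {α} {(s , A) ∷ β} {t} {R} {j} {c} {suc k} bal cross (tidy ∷ can) (later ∷ inc) (win ∷ wins) sα (size ∷ sβ) (t<s ∷ t<) e le rem (s≤s lk) =
    (slotAfter (t , encode R) (tuple T) , tuple T) ∷ proj₁ rest ,
      subst (Run (_∈ U) As (suc k) (t , encode R) _) gains≡
        (process A∈As (valid⁺ t R T ok) (subst (_∈ U) (sym succ≡) u∈U)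
          (subst (λ u → Run (_∈ U) As k u (proj₁ rest) (Σℚ.sum (value β))) (sym succ≡) (proj₂ rest)))
    where
    T : List (Fin n × ℕ)
    T = listing A
    t′ : ℤ
    t′ = nextSlot t T
    mem≡ : ∀ j → mem T j ≡ A j
    mem≡ = listing-mem A
    t′≤s : t′ ℤ.≤ s
    t′≤s = nextSlot-least T t<s (λ j m → proj₁ (win j (trans (sym (mem≡ j)) m)))
    ok : Valid t′ R T
    ok j m = ℕ.≤-trans (s≤s z≤n) (ℕ.≤-reflexive (sym (running {α} {s} {A} {β} {R} {T} mem≡ tidy rem (trans (sym (mem≡ j)) m)))) ,
             ℤ.≤-trans t′≤s (proj₂ (win j (trans (sym (mem≡ j)) m)))
    succ≡ : successor (t , encode R) (tuple T) ≡ (t′ , encode (next R T))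
    succ≡ = successor-≡ t R T ok
    A∈As : tuple T ∈ As
    A∈As = tuple-∈ T c₀ (subst (_≤ c₀) (sym (listing-length A)) size)
             (λ i → subst (_≤ K) (sym (proj₂ (listing-∈⁻ A i))) z≤n)
    bal′ : Balanced ((s , A) ∷ α) β
    bal′ i = subst (λ x → x ≡ 0 ⊎ x ≡ p i) (rotate (count i α) (ι (A i)) (count i β)) (bal i)
      where
      open +-*-Solver
      rotate : ∀ a b c → a + (b + c) ≡ b + a + c
      rotate = solve 3 (λ a b c → a :+ (b :+ c) := b :+ a :+ c) refl
    cross′ : Cross order ((s , A) ∷ α) β
    cross′ (here refl) i′ = All.lookup tidy i′
    cross′ (there i) i′   = cross i (there i′)
    rem′ : Remaining ((s , A) ∷ α) β (next R T)
    rem′ = next-remaining {α} {s} {A} {β} {R} {T} mem≡ tidy rem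
    -- In the slot t + 1 the offset is c; at a release time it falls to 0. The recursive call starts
    -- from offset b + 1, paid for by having one slot fewer to come.
    clock : ∃[ i ] ∃[ b ] (t′ ≡ r i ℤ.+ ℤ.+ b × b ≤ c)
    clock with nextSlot-cases t T
    ... | inj₁ e′       = j , c , trans e′ e , ℕ.≤-refl
    ... | inj₂ (i , e′) = i , 0 , trans e′ (sym (ℤ.+-identityʳ (r i))) , z≤n
    i′ : Fin n
    i′ = proj₁ clock
    b : ℕ
    b = proj₁ (proj₂ clock)
    t′≡ : t′ ≡ r i′ ℤ.+ ℤ.+ b
    t′≡ = proj₁ (proj₂ (proj₂ clock))
    b+ : suc b + length β ≤ K
    b+ = ℕ.≤-trans (ℕ.≤-reflexive (sym (ℕ.+-suc b (length β))))
           (ℕ.≤-trans (ℕ.+-monoˡ-≤ (suc (length β)) (proj₂ (proj₂ (proj₂ clock)))) le)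
    u∈U : (t′ , encode (next R T)) ∈ U
    u∈U = state-∈U bal′ cross′ rem′ (size ∷ sα) sβ i′ b
            (ℕ.≤-trans (ℕ.≤-trans (ℕ.n≤1+n b) (ℕ.m≤m+n (suc b) (length β))) b+)
            (ℕ.≤-trans (ℕ.m≤n+m (length β) (suc b)) b+) t′≡
    rest : ∃[ π ] Run (_∈ U) As k (t′ , encode (next R T)) π (Σℚ.sum (value β))
    rest = build bal′ cross′ can inc wins (size ∷ sα) sβ (All.map (ℤ.≤-<-trans t′≤s) later)
             (trans (cong (ℤ._+ 1ℤ) t′≡) (trans (ℤ.+-assoc (r i′) (ℤ.+ b) 1ℤ) (cong (λ x → r i′ ℤ.+ ℤ.+ x) (ℕ.+-comm b 1))))
             b+ rem′ lk
    gains≡ : gain (t , encode R) (tuple T) ℚ.+ Σℚ.sum (value β) ≡ Σℚ.sum (value ((s , A) ∷ β))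
    gains≡ = trans (cong (ℚ._+ Σℚ.sum (value β)) (gain-≡ t R T))
      (trans (sym (Σℚ.∑-distrib-+ (gains R T) (value β)))
        (Σℚ.sum-cong-≗ (value-step {α} {s} {A} {β} {R} {T} mem≡ tidy rem)))

  module _ (B : Schedule) where

    -- Cuts each job down to its quota: incomplete jobs have quota 0 and vanish, completed ones lose
    -- their surplus beyond p_j. This makes the schedule balanced.
    trim : (Fin n → ℕ) → List ℤ → List (Slot n)
    trim q []       = []
    trim q (t ∷ ts) = (t , A) ∷ trim (λ j → q j ∸ ι (A j)) ts
      where
      A : JobSet n
      A j = if does (1 ℕ.≤? q j) then does (j ∈ₛ? B t) else false

    trim-times : ∀ q ts → map proj₁ (trim q ts) ≡ ts
    trim-times q []       = refl
    trim-times q (t ∷ ts) = cong (t ∷_) (trim-times _ ts)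

    trim-∈ : ∀ q ts → All (λ s → ∀ j → proj₂ s j ≡ true → j ∈ₛ B (proj₁ s)) (trim q ts)
    trim-∈ q []       = []
    trim-∈ q (t ∷ ts) = member ∷ trim-∈ _ ts
      where
      member : ∀ j → (if does (1 ℕ.≤? q j) then does (j ∈ₛ? B t) else false) ≡ true → j ∈ₛ B t
      member j h = does⁻ (j ∈ₛ? B t) (proj₂ (if-and {does (1 ℕ.≤? q j)} h))

    processed : Fin n → List ℤ → ℕ
    processed j ts = length (filter (λ t → j ∈ₛ? B t) ts)

    trim-count : ∀ q ts j → q j ≤ processed j ts → count j (trim q ts) ≡ q j
    trim-count q []       j le = sym (ℕ.n≤0⇒n≡0 le)
    trim-count q (t ∷ ts) j le = cases (q j) (does (j ∈ₛ? B t)) refl refl le (trim-count _ ts j)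
      where
      q′ : Fin n → ℕ
      q′ i = q i ∸ ι (if does (1 ℕ.≤? q i) then does (i ∈ₛ? B t) else false)
      cases : ∀ x b → q j ≡ x → does (j ∈ₛ? B t) ≡ b → q j ≤ processed j (t ∷ ts) →
              (q′ j ≤ processed j ts → count j (trim q′ ts) ≡ q′ j) → count j (trim q (t ∷ ts)) ≡ q j
      cases x b ex eb le ih rewrite ex | eb with x | b
      ... | zero  | true  = ih z≤n
      ... | zero  | false = ih z≤n
      ... | suc y | true  = cong suc (ih (ℕ.≤-pred le))
      ... | suc y | false = ih le

    module _ (proper : ProperIntervals) (feas : Feasible B) (j₀ : Fin n) where
      open Feasible feas

      -- If d_j < d_i, then the window of j lies in that of i but misses d_i. The slot t in the
      -- window of j guarantees r_i ≤ d_i, so that d_i really belongs to the window of i.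
      agreeable : ∀ {i j t} → i ≺ j → r j ℤ.≤ t → t ℤ.≤ d j → r i ℤ.≤ r j × d i ℤ.≤ d j
      agreeable {i} {j} {t} lt rj dj = ri≤rj , ℤ.≮⇒≥ λ dj<di → proper j i
        ((λ (a , b) → ℤ.≤-trans ri≤rj a , ℤ.≤-trans b (ℤ.<⇒≤ dj<di)) ,
         λ sub → ℤ.<⇒≱ dj<di (proj₂ (sub (ℤ.≤-trans ri≤rj (ℤ.≤-trans rj (ℤ.≤-trans dj (ℤ.<⇒≤ dj<di))) , ℤ.≤-refl))))
        where
        ri≤rj : r i ℤ.≤ r j
        ri≤rj with before⁻ i j lt
        ... | inj₁ x       = ℤ.<⇒≤ x
        ... | inj₂ (e , _) = ℤ.≤-reflexive e

      -- The budget witness may be unsorted, contain repetitions and name idle times. Those before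
      -- every release time are dropped so that all slots come after the initial clock; other idle
      -- times become slots with an empty set.
      ts : List ℤ
      ts = filter (earliest (r j₀) ℤ.≤?_) (slotTimes (proj₁ budget))

      quota : Fin n → ℕ
      quota j = if does (completed? B j) then p j else 0

      π₀ : List (Slot n)
      π₀ = trim quota ts

      units-processed : ∀ j → units B j ≤ processed j ts
      units-processed j = unique-length (Unique.filter⁺ (λ t → j ∈ₛ? B t) (slots-unique I j)) λ {t} i →
        let _ , member = ∈-filter⁻ (λ t → j ∈ₛ? B t) {xs = slots j} i in
        ∈-filter⁺ (λ t → j ∈ₛ? B t)
          (∈-filter⁺ (earliest (r j₀) ℤ.≤?_) (slotTimes-∈⁺ (proj₂ (proj₂ budget) t (j , member)))
            (ℤ.≤-trans (earliest-≤ (r j₀) j) (proj₁ (window t j member)))) member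

      quota-count : ∀ j → count j π₀ ≡ quota j
      quota-count j = trim-count quota ts j (enough (does (completed? B j)) refl)
        where
        enough : ∀ b → does (completed? B j) ≡ b → (if b then p j else 0) ≤ processed j ts
        enough true  e = ℕ.≤-trans (does⁻ (completed? B j) e) (units-processed j)
        enough false e = z≤n

      π₀-increasing : Increasing π₀
      π₀-increasing = AllPairs.map⁻ (subst (AllPairs ℤ._<_) (sym (trim-times quota ts))
        (AllPairs.filter⁺ (earliest (r j₀) ℤ.≤?_) (slotTimes-increasing (proj₁ budget))))

      π₀-sizes : All (λ s → ∥ proj₂ s ∥ ≤ c₀) π₀
      π₀-sizes = All.map (λ {s} h → ℕ.⊓-glb
          (ℕ.≤-trans (∥∥-mono {B = Vec.lookup (B (proj₁ s))} (λ j e → Vec.[]=⇒lookup (h j e)))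
            (ℕ.≤-trans (ℕ.≤-reflexive (sym (∣∣-∥∥ (B (proj₁ s))))) (capacity (proj₁ s))))
          (∥∥-≤-n (proj₂ s))) (trim-∈ quota ts)

      -- Trimming and exchanging preserve the completed jobs, so the value of the canonical schedule
      -- at the start is the throughput of B. The run that `build` makes of it is one of those the
      -- solution dominates.
      complete : 1 ≤ K → throughput B ℚ.≤ proj₁ (solution (r j₀))
      complete 1≤K with canonicalise agreeable c₀ π₀ π₀-increasing
                             (All.map (λ h j e → window _ j (h j e)) (trim-∈ quota ts)) π₀-sizes
      ... | π , R = begin
        throughput B ≡⟨ throughput-sum I B ⟩
        Σℚ.sum (λ j → if does (completed? B j) then w j else 0ℚ)
                                                        ≡⟨ Σℚ.sum-cong-≗ completed-value ⟩
        Σℚ.sum (value π) ≤⟨ optimal ⟩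
        proj₁ (solution (r j₀))                         ∎
        where
        open ℚ.≤-Reasoning
        open Rearranged R
        counts-quota : ∀ j → count j π ≡ quota j
        counts-quota j = trans (counts j) (quota-count j)
        completed-value : ∀ j → (if does (completed? B j) then w j else 0ℚ) ≡ value π j
        completed-value j rewrite counts-quota j with does (completed? B j)
        ... | true  = sym (if-true (does⁺ (1 ℕ.≤? p j) (p>0 j)))
        ... | false = refl
        times≡ : map proj₁ π ≡ ts
        times≡ = trans times (trim-times quota ts)
        short : length π ≤ K
        short = ℕ.≤-trans (ℕ.≤-reflexive (trans (sym (List.length-map proj₁ π)) (cong length times≡)))
                  (ℕ.≤-trans (List.length-filter (earliest (r j₀) ℤ.≤?_) (slotTimes (proj₁ budget)))
                    (ℕ.≤-trans (slotTimes-length (proj₁ budget)) (proj₁ (proj₂ budget))))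
        balanced : Balanced [] π
        balanced j rewrite counts-quota j with does (completed? B j)
        ... | true  = inj₂ refl
        ... | false = inj₁ refl
        remaining : Remaining [] π p
        remaining j with count j π in e | balanced j
        ... | suc _ | inj₂ e′ = inj₁ (s≤s z≤n , sym e′)
        ... | zero  | _       = inj₂ (refl , inj₂ ((λ { (_ , (() , _) , _) }) , refl))
        t₀ : ℤ
        t₀ = earliest (r j₀) ℤ.- 1ℤ
        t₀+1 : t₀ ℤ.+ 1ℤ ≡ earliest (r j₀)
        t₀+1 = trans (ℤ.+-assoc (earliest (r j₀)) (ℤ.- 1ℤ) 1ℤ) (ℤ.+-identityʳ _)
        t₀-before : All (λ s → t₀ ℤ.< proj₁ s) π
        t₀-before = All.tabulate λ i → ℤ.suc[i]≤j⇒i<j (ℤ.≤-trans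
          (ℤ.≤-reflexive (trans (ℤ.+-comm 1ℤ t₀) t₀+1))
          (proj₂ (∈-filter⁻ (earliest (r j₀) ℤ.≤?_) {xs = slotTimes (proj₁ budget)} (subst (_ ∈_) times≡ (∈-map⁺ proj₁ i)))))
        run : ∃[ ρ ] Run (_∈ U) As K (initial (r j₀)) ρ (Σℚ.sum (value π))
        run = build {j = proj₁ (earliest-∈ j₀)} {c = 0} balanced (λ ()) canonical increasing windows [] sizes t₀-before
                (trans t₀+1 (trans (proj₂ (earliest-∈ j₀)) (sym (ℤ.+-identityʳ _)))) short remaining short
        optimal : Σℚ.sum (value π) ℚ.≤ proj₁ (solution (r j₀))
        optimal = at-least K 1≤K run
          where
          at-least : ∀ k → 1 ≤ k → ∃[ ρ ] Run (_∈ U) As k (initial (r j₀)) ρ (Σℚ.sum (value π)) →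
                     Σℚ.sum (value π) ℚ.≤ proj₁ (best (table (k ∸ 1)) As (initial (r j₀)))
          at-least (suc k) _ (ρ , ru) =
            best-complete I U-wf As-tuples (iterate-correct I U-wf As-tuples k) (initial (r j₀)) ρ _ ru

-- Running time

-- The invariant depends on the round, because the lists of `tuplesC` and `rangeC` grow with it.
IterSafe-intro : ∀ {X : Set} {S : X → Set} {f : X → X} (Inv : ℕ → X → Set) {k} →
                 (∀ {i x} → i < k → Inv i x → S x × Inv (suc i) (f x)) → ∀ {x} → Inv 0 x → IterSafe S f k x
IterSafe-intro {S = S} {f} Inv {k} step inv = scan 0 k (ℕ.≤-reflexive refl) inv
  where
  scan : ∀ i j {x} → i + j ≤ k → Inv i x → IterSafe S f j x
  scan i zero    le inv = tt
  scan i (suc j) le inv with step (ℕ.≤-trans (s≤s (ℕ.m≤m+n i j)) (ℕ.≤-trans (ℕ.≤-reflexive (sym (ℕ.+-suc i j))) le)) inv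
  ... | s , inv′ = s , scan (suc i) j (ℕ.≤-trans (ℕ.≤-reflexive (sym (ℕ.+-suc i j))) le) inv′

iterateᵖ-invariant : ∀ {X : Set} {f : X → X} (P : X → Set) → (∀ {x} → P x → P (f x)) → ∀ k {x} → P x → P (iterateᵖ k f x)
iterateᵖ-invariant P step zero    px = px
iterateᵖ-invariant P step (suc k) px = iterateᵖ-invariant P step k (step px)

module _ {N : ℕ} where

  memberC-safe : ∀ {j A} → length A ≤ N → Safe N memberC (j ∷ A ∷ [])
  memberC-safe h = safe ((h , λ _ _ _ → tt) , tt)

  remainingC-safe : ∀ {j A} → length A ≤ N → Safe N remainingC (j ∷ A ∷ [])
  remainingC-safe h = safe ((h , λ _ _ _ → tt) , (h , λ _ _ _ → tt) , tt)

  stateC-safe : ∀ {x A J} → length A ≤ N → length J ≤ N → Safe N stateC (x ∷ A ∷ J ∷ [])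
  stateC-safe h hJ = safe ((hJ , λ _ _ _ → remainingC-safe h , tt) , tt)

  nextSlotC-safe : ∀ {t A} → length A ≤ N → Safe N nextSlotC (t ∷ A ∷ [])
  nextSlotC-safe h = safe ((h , λ _ _ _ → tt) , tt)

  closesC-safe : ∀ {j R A} → length R ≤ N → length A ≤ N → Safe N closesC (j ∷ R ∷ A ∷ [])
  closesC-safe hR h = safe ((hR , λ _ _ _ → memberC-safe h , tt) , tt)

  successorC-safe : ∀ {t R A} → length R ≤ N → length A ≤ N → Safe N successorC (t ∷ R ∷ A ∷ [])
  successorC-safe hR h = safe ((hR , λ _ _ _ → memberC-safe h , closesC-safe hR h , tt) , tt)

  validC-safe : ∀ {t R A} → length R ≤ N → length A ≤ N → Safe N validC (t ∷ R ∷ A ∷ [])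
  validC-safe hR h = safe ((hR , λ _ _ _ → memberC-safe h , tt) , tt)

  gainC-safe : ∀ {R A} → length R ≤ N → length A ≤ N → Safe N gainC (R ∷ A ∷ [])
  gainC-safe hR h = safe ((hR , λ _ _ _ → memberC-safe h , tt) , tt)

  sameStateC-safe : ∀ {u v} → length (proj₂ u) ≤ N → length (proj₂ v) ≤ N → Safe N sameStateC (u ∷ v ∷ [])
  sameStateC-safe hu hv = safe ((hu , λ _ _ _ → (hv , λ _ _ _ → tt) , tt) , tt)

  SmallState : State → Set
  SmallState u = length (proj₂ u) ≤ N

  SmallTable : Table → Set
  SmallTable T = length T ≤ N × (∀ {e} → e ∈ T → SmallState (proj₁ e))

  SmallSets : List Tuple → Set
  SmallSets As = length As ≤ N × (∀ {A} → A ∈ As → length A ≤ N)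

  lookupC-safe : ∀ {T u} → SmallTable T → SmallState u → Safe N lookupC (T ∷ u ∷ [])
  lookupC-safe (hT , hs) hu = safe ((hT , λ _ i _ → sameStateC-safe (hs i) hu , tt) , tt)

  successorC-length : ∀ t R A → length (proj₂ (val successorC (t ∷ R ∷ A ∷ []))) ≡ length R
  successorC-length t R A = trans (cong length (foldr-cons _ R)) (List.length-map _ R)

  continueC-safe : ∀ {t R A T} → length R ≤ N → length A ≤ N → SmallTable T → Safe N continueC (t ∷ R ∷ A ∷ T ∷ [])
  continueC-safe {t} {R} {A} hR h hT = safe
    (validC-safe hR h , successorC-safe hR h ,
     lookupC-safe hT (ℕ.≤-trans (ℕ.≤-reflexive (successorC-length t R A)) hR) , gainC-safe hR h , (h , λ _ _ _ → tt) , tt)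

  candidateC-safe : ∀ {T u A} → SmallTable T → SmallState u → length A ≤ N → Safe N candidateC (T ∷ u ∷ A ∷ [])
  candidateC-safe hT hu h = safe (nextSlotC-safe h , continueC-safe hu h hT , tt)

  bestC-safe : ∀ {T As u} → SmallTable T → SmallSets As → SmallState u → Safe N bestC (T ∷ As ∷ u ∷ [])
  bestC-safe hT (hA , hs) hu = safe ((hA , λ _ i _ → candidateC-safe hT hu (hs i) , tt) , tt)

  improveC-safe : ∀ {T As} → SmallTable T → SmallSets As → Safe N improveC (T ∷ As ∷ [])
  improveC-safe hT hA = safe ((proj₁ hT , λ _ i _ → bestC-safe hT hA (proj₂ hT i) , tt) , tt)

  improve-small : ∀ {As T} → SmallTable T → SmallTable (improve As T)
  improve-small {As} {T} (h , hs) = subst (_≤ N) (sym (List.length-map _ T)) h ,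
    λ i → let e , k , eq = ∈-map⁻ _ i in subst (SmallState ∘ proj₁) (sym eq) (hs k)

  runWith-safe : ∀ {i b} → Computes i improveF →
    (∀ {T As} → SmallTable T → SmallSets As → Safe N i (T ∷ As ∷ [])) →
    (∀ {T As u} → SmallTable T → SmallSets As → SmallState u → Safe N b (T ∷ As ∷ u ∷ [])) →
    ∀ {T As u k} → clamp (k ℤ.- 1ℤ) ≤ N → SmallTable T → SmallSets As → SmallState u →
    Safe N (runWith i b) (T ∷ As ∷ u ∷ k ∷ [])
  runWith-safe {i} ci si sb {T} {As} {u} {k} hk hT hA hu = safe
    ((hk , IterSafe-intro (λ _ → SmallTable) (λ _ h → (si h hA , tt) , step h) hT) ,
     sb (iterateᵖ-invariant SmallTable step (clamp (k ℤ.- 1ℤ)) hT) hA hu , tt)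
    where
    step : ∀ {T′} → SmallTable T′ → SmallTable (val i (T′ ∷ As ∷ []))
    step {T′} h = subst SmallTable (sym (Computes.at ci (T′ ∷ As ∷ []))) (improve-small {As} h)

  runC-safe : ∀ {T As u k} → clamp (k ℤ.- 1ℤ) ≤ N → SmallTable T → SmallSets As → SmallState u →
              Safe N runC (T ∷ As ∷ u ∷ k ∷ [])
  runC-safe = runWith-safe improveC-computes improveC-safe bestC-safe

  tuplesC-safe : ∀ {X k} → length X ≤ N → clamp k ≤ N → suc (length X) ^ clamp k ≤ N → Safe N tuplesC (X ∷ k ∷ [])
  tuplesC-safe {X} {k} hX hk hN = safe
    ((hk , IterSafe-intro (λ i As → length As ≤ suc (length X) ^ i)
             (λ {i} {As} lt h → (safe ((ℕ.≤-trans h (ℕ.≤-trans (ℕ.^-monoʳ-≤ (suc (length X)) (ℕ.<⇒≤ lt)) hN) ,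
                                         λ _ _ _ → (hX , λ _ _ _ → tt) , tt) , tt) , tt) ,
                                 longer-length X As {i} h)
             (s≤s z≤n)) , tt)

  rangeC-safe : ∀ {K} → suc K ≤ N → Safe N rangeC (ℤ.+ K ∷ [])
  rangeC-safe {K} h = safe
    ((ℕ.≤-trans (ℕ.n≤1+n K) h ,
      IterSafe-intro (λ i l → length l ≡ suc i)
        (λ {i} {l} lt e → ((ℕ.≤-trans (ℕ.≤-reflexive e) (ℕ.≤-trans lt (ℕ.≤-trans (ℕ.n≤1+n K) h)) , λ _ _ _ → tt) , tt) ,
          cong suc (trans (cong length (foldr-cons _ l)) (trans (List.length-map _ l) e)))
        refl) , tt)

  optionsC-safe : ∀ {J l} → length J ≤ N → length l ≤ N → Safe N optionsC (J ∷ l ∷ [])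
  optionsC-safe hJ hl = safe ((hJ , λ _ _ _ → (hl , λ _ _ _ → tt) , tt) , tt)

  countC-safe : ∀ {J} → length J ≤ N → Safe N countC (J ∷ [])
  countC-safe h = safe ((h , λ _ _ _ → tt) , tt)

  indexC-safe : ∀ {J} → length J ≤ N → Safe N indexC (J ∷ [])
  indexC-safe h = safe (countC-safe h , (h , λ _ _ _ → tt) , tt)

  initialC-safe : ∀ {J e} → length J ≤ N → Safe N initialC (J ∷ e ∷ [])
  initialC-safe h = safe (safe ((h , λ _ _ _ → tt) , tt) , (h , λ _ _ _ → tt) , tt)

  universeC-safe : ∀ {X Ts J} → length X ≤ N → SmallSets Ts → length J ≤ N → Safe N universeC (X ∷ Ts ∷ J ∷ [])
  universeC-safe hX (hT , hs) hJ = safe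
    ((hX , λ _ _ _ → (hT , λ _ i _ → stateC-safe (hs i) hJ , tt) , tt) , tt)

  -- The safety of a later routine is asked for at the specified values of the earlier ones, so that
  -- lengths are bounded for `tuplesF` and the like and not for denotations of code.
  solveWith-safe : ∀ {tup uni ini run} → Computes tup tuplesF → Computes uni universeF → Computes ini initialF →
    ∀ {X} {c : ℤ} {J} {k e : ℤ} → let L = c ℤ.+ c ℤ.+ (c ℤ.+ c) ℤ.+ 1ℤ ; Ts = tuplesF (X ∷ L ∷ []) in
    Safe N tup (X ∷ L ∷ []) → Safe N uni (X ∷ Ts ∷ J ∷ []) → Safe N tup (X ∷ c ∷ []) → Safe N ini (J ∷ e ∷ []) →
    Safe N run (universeF (X ∷ Ts ∷ J ∷ []) ∷ tuplesF (X ∷ c ∷ []) ∷ initialF (J ∷ e ∷ []) ∷ k ∷ []) →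
    Safe N (solveWith tup uni ini run) (X ∷ c ∷ J ∷ k ∷ e ∷ [])
  solveWith-safe {tup} {uni} {ini} {run} ct cu ci {X} {c} {J} {k} {e} st su st′ si sr = safe
    (st , subst (λ Ts → Safe N uni (X ∷ Ts ∷ J ∷ [])) (sym (at ct _)) su , st′ , si ,
     subst₂ (λ T As → Safe N run (T ∷ As ∷ val ini (J ∷ e ∷ []) ∷ k ∷ []))
       (sym (trans (cong (λ Ts → val uni (X ∷ Ts ∷ J ∷ [])) (at ct _)) (at cu _))) (sym (at ct _))
       (subst (λ u → Safe N run (universeF (X ∷ tuplesF (X ∷ (c ℤ.+ c ℤ.+ (c ℤ.+ c) ℤ.+ 1ℤ) ∷ []) ∷ J ∷ []) ∷
                                tuplesF (X ∷ c ∷ []) ∷ u ∷ k ∷ [])) (sym (at ci _)) sr) , tt)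

  mainWith-safe : ∀ {idx rng opt cnt slv} → Computes idx indexF → Computes rng rangeF → Computes opt optionsF →
    Computes cnt countF → ∀ {e : ℤ} {jobs} {c k : ℤ} {J X} {c₀ : ℤ} →
    indexF (jobs ∷ []) ≡ J → optionsF (J ∷ rangeF (k ∷ []) ∷ []) ≡ X → capacityF c (countF (jobs ∷ [])) ≡ c₀ →
    Safe N idx (jobs ∷ []) → Safe N rng (k ∷ []) → Safe N opt (J ∷ rangeF (k ∷ []) ∷ []) → Safe N cnt (jobs ∷ []) →
    Safe N slv (X ∷ c₀ ∷ J ∷ k ∷ e ∷ []) →
    Safe N (mainWith idx rng opt cnt slv) (e ∷ jobs ∷ c ∷ k ∷ [])
  mainWith-safe {idx} {rng} {opt} {cnt} {slv} ci cr co cc {e} {jobs} {c} {k} refl refl refl si sr so sc ss = safe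
    (si , sr ,
     subst₂ (λ J l → Safe N opt (J ∷ l ∷ [])) (sym (at ci _)) (sym (at cr _)) so , sc ,
     subst₂ (λ X c₀ → Safe N slv (X ∷ c₀ ∷ val idx (jobs ∷ []) ∷ k ∷ e ∷ []))
       (sym (trans (cong₂ (λ J l → val opt (J ∷ l ∷ [])) (at ci _) (at cr _)) (at co _)))
       (sym (cong (capacityF c) (at cc _)))
       (subst (λ J → Safe N slv (optionsF (indexF (jobs ∷ []) ∷ rangeF (k ∷ []) ∷ []) ∷ capacityF c (countF (jobs ∷ [])) ∷ J ∷ k ∷ e ∷ []))
         (sym (at ci _)) ss) , tt)

-- The lengths of tuples and the numbers of rounds of `tuplesC` are iteration counts too; so the
-- exponents themselves have to be bounded by N.
k≤b^k : ∀ {b} k → 2 ≤ b → k ≤ b ^ k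
k≤b^k zero    le = z≤n
k≤b^k {b} (suc k) le = begin
  1 + k ≤⟨ ℕ.+-mono-≤ (ℕ.m^n>0 b ⦃ >-nonZero (ℕ.≤-trans (s≤s z≤n) le) ⦄ k) (k≤b^k k le) ⟩
  b ^ k + b ^ k ≡⟨ cong (b ^ k +_) (ℕ.+-identityʳ (b ^ k)) ⟨
  2 * b ^ k ≤⟨ ℕ.*-monoˡ-≤ (b ^ k) le ⟩
  b ^ suc k       ∎
  where open ℕ.≤-Reasoning

-- Opaque, so that the size and degree of the whole program are never computed; any fixed constants
-- serve.
opaque
  mainC-polynomial : ∃[ s ] ∃[ e ] (∀ N → 1 ≤ N → ⟦ cost mainC ⟧ᵖ N ≤ s * N ^ e)
  mainC-polynomial = size (cost mainC) , deg (cost mainC) , poly-bound (cost mainC)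

module Running (I : Instance) (1≤n : 1 ≤ Instance.n I) (1≤K : 1 ≤ Instance.K I) where
  open Instance I
  open Spec I
  open Solution I

  -- With b = 1 + n (K + 1) there are at most b^L tuples of length up to L. The clock contributes
  -- one more factor, so b^(L + 1) bounds the universe, the longest list of all.
  b N : ℕ
  b = suc (length X)
  N = b ^ suc L

  private
    jobs-length : length jobs ≡ n
    jobs-length = List.length-tabulate job

    X-length : length X ≡ n * suc K
    X-length = trans (crossWith-length (λ c j → j , c) (range K) jobs) (cong₂ _*_ jobs-length (range-length K))

    n≤X : n ≤ length X
    n≤X = ℕ.≤-trans (ℕ.m≤m*n n (suc K)) (ℕ.≤-reflexive (sym X-length))

    K<X : suc K ≤ length X
    K<X = ℕ.≤-trans (ℕ.m≤n*m (suc K) n ⦃ >-nonZero 1≤n ⦄) (ℕ.≤-reflexive (sym X-length))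

    2≤b : 2 ≤ b
    2≤b = s≤s (ℕ.≤-trans 1≤n n≤X)

    b^≤ : ∀ {k} → k ≤ suc L → b ^ k ≤ N
    b^≤ le = ℕ.^-monoʳ-≤ b le

    ≤N : ∀ {k} → k ≤ length X → k ≤ N
    ≤N le = ℕ.≤-trans (ℕ.≤-trans le (ℕ.n≤1+n _)) (subst (_≤ N) (ℕ.^-identityʳ b) (b^≤ (s≤s z≤n)))

    exponent≤N : ∀ {k} → k ≤ suc L → k ≤ N
    exponent≤N {k} le = ℕ.≤-trans (k≤b^k k 2≤b) (b^≤ le)

    c₀≤L : c₀ ≤ suc L
    c₀≤L = ℕ.≤-trans (ℕ.m≤m+n c₀ c₀) (ℕ.≤-trans (ℕ.m≤m+n (c₀ + c₀) (c₀ + c₀)) (ℕ.≤-trans (ℕ.m≤m+n _ 1) (ℕ.n≤1+n L)))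

    jobs≤N : length jobs ≤ N
    jobs≤N = ≤N (ℕ.≤-trans (ℕ.≤-reflexive jobs-length) n≤X)

    inputJobs≤N : length inputJobs ≤ N
    inputJobs≤N = ≤N (ℕ.≤-trans (ℕ.≤-reflexive (List.length-tabulate _)) n≤X)

    tuples-small : ∀ k → k ≤ suc L → SmallSets {N} (tuples X k)
    tuples-small k le = ℕ.≤-trans (tuples-length X k) (b^≤ le) , λ i → ℕ.≤-trans (proj₁ (tuples-∈⁻ X k i)) (exponent≤N le)

    tuples-safe : ∀ k → k ≤ suc L → Safe N tuplesC (X ∷ ℤ.+ k ∷ [])
    tuples-safe k le = tuplesC-safe (≤N ℕ.≤-refl) (exponent≤N le) (b^≤ le)

    universe-small : SmallTable {N} (map (_, worthless) U)
    universe-small = subst (_≤ N) (sym (List.length-map (_, worthless) U)) U≤N ,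
      λ i → let u , k , eq = ∈-map⁻ _ i in subst (SmallState {N} ∘ proj₁) (sym eq) (wf-small u (U-wf k))
      where
      U≤N : length U ≤ N
      U≤N = ℕ.≤-trans (ℕ.≤-reflexive (crossWith-length (λ A x → val stateC (x ∷ A ∷ jobs ∷ [])) (tuples X L) X))
              (ℕ.*-mono-≤ (ℕ.n≤1+n (length X)) (tuples-length X L))
      wf-small : ∀ u → WellFormed u → SmallState {N} u
      wf-small u (R , refl) = ≤N (ℕ.≤-trans (ℕ.≤-reflexive (List.length-tabulate _)) n≤X)

    initial-small : ∀ e → SmallState {N} (initialF (jobs ∷ e ∷ []))
    initial-small e = subst (SmallState {N}) (sym (initialC-≡ e))
      (≤N (ℕ.≤-trans (ℕ.≤-reflexive (List.length-tabulate _)) n≤X))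

    solve-safe : ∀ e → Safe N solveC (X ∷ ℤ.+ c₀ ∷ jobs ∷ ℤ.+ K ∷ e ∷ [])
    solve-safe e = solveWith-safe tuplesC-computes universeC-computes initialC-computes
      (tuples-safe L (ℕ.n≤1+n L)) (universeC-safe (≤N ℕ.≤-refl) (tuples-small L (ℕ.n≤1+n L)) jobs≤N)
      (tuples-safe c₀ c₀≤L) (initialC-safe jobs≤N)
      (runC-safe (ℕ.≤-trans (ℕ.≤-reflexive (clamp-pred 1≤K)) (≤N (ℕ.≤-trans (ℕ.m∸n≤m K 1) (ℕ.<⇒≤ K<X))))
        universe-small (tuples-small c₀ c₀≤L) (initial-small e))

  main-safe : ∀ e → Safe N mainC (e ∷ inputJobs ∷ ℤ.+ m ∷ ℤ.+ K ∷ [])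
  main-safe e = mainWith-safe indexC-computes rangeC-computes optionsC-computes countC-computes
    inputJobs-index refl inputJobs-capacity
    (indexC-safe inputJobs≤N) (rangeC-safe (≤N K<X))
    (optionsC-safe jobs≤N (ℕ.≤-trans (ℕ.≤-reflexive (range-length K)) (≤N K<X))) (countC-safe inputJobs≤N)
    (solve-safe e)

  private
    x : ℕ
    x = n * K

    1≤x : 1 ≤ x
    1≤x = ℕ.*-mono-≤ 1≤n 1≤K

    b≤3x : b ≤ 3 * x
    b≤3x = begin
      suc (length X) ≡⟨ cong suc X-length ⟩
      suc (n * suc K) ≡⟨ cong suc (ℕ.*-suc n K) ⟩
      1 + (n + x) ≤⟨ ℕ.+-mono-≤ 1≤x (ℕ.+-monoˡ-≤ x (ℕ.m≤m*n n K ⦃ >-nonZero 1≤K ⦄)) ⟩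
      x + (x + x) ≡⟨ cong (λ y → x + (x + y)) (ℕ.+-identityʳ x) ⟨
      3 * x               ∎
      where open ℕ.≤-Reasoning

    1≤c₀ : 1 ≤ c₀
    1≤c₀ = ℕ.⊓-glb m>0 1≤n

    L≤6c₀ : suc L ≤ c₀ * 6
    L≤6c₀ = begin
      suc L ≡⟨ solve 1 (λ c → con 1 :+ (c :+ c :+ (c :+ c) :+ con 1) := c :* con 4 :+ con 2) refl c₀ ⟩
      c₀ * 4 + 2 ≤⟨ ℕ.+-monoʳ-≤ (c₀ * 4) (ℕ.*-monoˡ-≤ 2 1≤c₀) ⟩
      c₀ * 4 + c₀ * 2 ≡⟨ ℕ.*-distribˡ-+ c₀ 4 2 ⟨
      c₀ * 6                                        ∎
      where
      open ℕ.≤-Reasoning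
      open +-*-Solver

    -- If n K = 1 then the effective capacity c₀ = min m n is 1; otherwise
    -- constant factors are powers of n K.
    constants : ∀ y c e → 1 ≤ y → c ≤ y → c ≤ m → (3 * y) ^ (c * e) ≤ 3 ^ e * y ^ (3 * e * m)
    constants y c e _ _ _ with y ℕ.≤? 1
    constants (suc zero) c e _ c≤1 _ | yes _ = begin
      3 ^ (c * e) ≤⟨ ℕ.^-monoʳ-≤ 3 (ℕ.*-monoˡ-≤ e c≤1) ⟩
      3 ^ (1 * e) ≡⟨ cong (3 ^_) (ℕ.*-identityˡ e) ⟩
      3 ^ e ≡⟨ ℕ.*-identityʳ (3 ^ e) ⟨
      3 ^ e * 1 ≡⟨ cong (3 ^ e *_) (ℕ.^-zeroˡ (3 * e * m)) ⟨
      3 ^ e * 1 ^ (3 * e * m)      ∎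
      where open ℕ.≤-Reasoning
    constants (suc (suc y)) c e _ _ _ | yes (s≤s ())
    constants y c e 1≤y _ c≤m | no y≰1 = begin
      (3 * y) ^ (c * e) ≤⟨ ℕ.^-monoˡ-≤ (c * e) 3y≤ ⟩
      (y ^ 3) ^ (c * e) ≡⟨ ℕ.^-*-assoc y 3 (c * e) ⟩
      y ^ (3 * (c * e)) ≤⟨ ℕ.^-monoʳ-≤ y ⦃ >-nonZero 1≤y ⦄ exponents ⟩
      y ^ (3 * e * m) ≤⟨ ℕ.m≤n*m (y ^ (3 * e * m)) (3 ^ e) ⦃ ℕ.m^n≢0 3 e ⦄ ⟩
      3 ^ e * y ^ (3 * e * m)           ∎
      where
      open ℕ.≤-Reasoning
      2≤y : 2 ≤ y
      2≤y = ℕ.≰⇒> y≰1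
      3y≤ : 3 * y ≤ y ^ 3
      3y≤ = begin
        3 * y ≤⟨ ℕ.*-monoˡ-≤ y (ℕ.≤-trans (ℕ.n≤1+n 3) (ℕ.*-mono-≤ 2≤y 2≤y)) ⟩
        y * y * y ≡⟨ solve 1 (λ y → y :* y :* y := y :* (y :* (y :* con 1))) refl y ⟩
        y ^ 3             ∎
        where open +-*-Solver
      exponents : 3 * (c * e) ≤ 3 * e * m
      exponents = begin
        3 * (c * e) ≡⟨ cong (3 *_) (ℕ.*-comm c e) ⟩
        3 * (e * c) ≡⟨ ℕ.*-assoc 3 e c ⟨
        3 * e * c ≤⟨ ℕ.*-monoʳ-≤ (3 * e) c≤m ⟩
        3 * e * m         ∎

  -- The exponent L + 1 = 4 c₀ + 2 is at most 6 c₀, and b ≤ 3 n K; `constants` then absorbs the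
  -- powers of 3 that grow with c₀.
  N-bound : ∀ e → N ^ e ≤ 3 ^ (6 * e) * (n * K) ^ (3 * (6 * e) * m)
  N-bound e = begin
    (b ^ suc L) ^ e ≡⟨ ℕ.^-*-assoc b (suc L) e ⟩
    b ^ (suc L * e) ≤⟨ ℕ.^-monoʳ-≤ b (ℕ.*-monoˡ-≤ e L≤6c₀) ⟩
    b ^ (c₀ * 6 * e) ≡⟨ cong (b ^_) (ℕ.*-assoc c₀ 6 e) ⟩
    b ^ (c₀ * (6 * e)) ≤⟨ ℕ.^-monoˡ-≤ (c₀ * (6 * e)) b≤3x ⟩
    (3 * x) ^ (c₀ * (6 * e)) ≤⟨ constants x c₀ (6 * e) 1≤x
                                                     (ℕ.≤-trans (ℕ.m⊓n≤n m n) (ℕ.m≤m*n n K ⦃ >-nonZero 1≤K ⦄)) (ℕ.m⊓n≤m m n) ⟩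
    3 ^ (6 * e) * (n * K) ^ (3 * (6 * e) * m)   ∎
    where open ℕ.≤-Reasoning

  1≤N : 1 ≤ N
  1≤N = ℕ.m^n>0 b (suc L)

-- Assembly of the program and its time bound

module _ (body : Tm bodyCtx (list (int ⊗ int))) where

  -- Since `body` is a variable, the evaluation around it reduces to the literal step counts 3, 7
  -- and 10 of the three cases.
  programWith-nil : ∀ c k → eval (programWith body) ([] ∷ c ∷ k ∷ []) ≡ ([] , 3)
  programWith-nil c k = refl

  programWith-zero : ∀ x xs c → eval (programWith body) ((x ∷ xs) ∷ c ∷ 0ℤ ∷ []) ≡ ([] , 7)
  programWith-zero x xs c = refl

  programWith-suc : ∀ x xs c k → eval (programWith body) ((x ∷ xs) ∷ c ∷ ℤ.+ suc k ∷ []) ≡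
    (proj₁ (eval body (proj₁ x ∷ x ∷ xs ∷ (x ∷ xs) ∷ c ∷ ℤ.+ suc k ∷ [])) ,
     10 + proj₂ (eval body (proj₁ x ∷ x ∷ xs ∷ (x ∷ xs) ∷ c ∷ ℤ.+ suc k ∷ [])))
  programWith-suc x xs c k = refl

module _ {c : Code mainCtx (list (int ⊗ int))} where

  body-value : ∀ {f} → Computes c f → ∀ e j xs J (m k : ℤ) →
               proj₁ (eval (bodyWith c) (e ∷ j ∷ xs ∷ J ∷ m ∷ k ∷ [])) ≡ f (e ∷ J ∷ m ∷ k ∷ [])
  body-value ci e j xs J m k = trans (compile-value (call c (i0 ∷ i3 ∷ i4 ∷ i5 ∷ [])) id {ρ} {ρ} (λ _ → refl)) (Computes.at ci _)
    where
    ρ : Env bodyCtx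
    ρ = e ∷ j ∷ xs ∷ J ∷ m ∷ k ∷ []

  body-cost : ∀ N e j xs J (m k : ℤ) → Safe N c (e ∷ J ∷ m ∷ k ∷ []) →
              proj₂ (eval (bodyWith c) (e ∷ j ∷ xs ∷ J ∷ m ∷ k ∷ [])) ≤ ⟦ cost c ⟧ᵖ N
  body-cost N e j xs J m k s = proj₁ (compile-cost N (call c (i0 ∷ i3 ∷ i4 ∷ i5 ∷ [])) id {ρ} {ρ} (λ _ → refl) (s , tt))
    where
    ρ : Env bodyCtx
    ρ = e ∷ j ∷ xs ∷ J ∷ m ∷ k ∷ []

module _ (I : Instance) where
  open Instance I

  scheduleOf : List (ℤ × ℤ) → Schedule
  scheduleOf out t = Vec.tabulate (λ j → does ((t , ℤ.+ toℕ j) ∈? out))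

  empty-optimal : (∀ B → Feasible B → ∀ j → ¬ Completed B j) → Optimal (scheduleOf [])
  empty-optimal none = feasible , λ B f → begin
      throughput B ≡⟨ throughput-sum I B ⟩
      Σℚ.sum (λ j → if does (completed? B j) then w j else 0ℚ)
                                  ≤⟨ sumℚ-mono (λ j → pointwise B f j) ⟩
      Σℚ.sum (λ j → if does (completed? (scheduleOf []) j) then w j else 0ℚ)
                                  ≡⟨ throughput-sum I (scheduleOf []) ⟨
      throughput (scheduleOf [])  ∎
    where
    open ℚ.≤-Reasoning
    inactive : ∀ t j → ¬ (j ∈ₛ scheduleOf [] t)
    inactive t j i = false≢true (trans (sym (Vec.lookup∘tabulate _ j)) (Vec.[]=⇒lookup i))
    pointwise : ∀ B → Feasible B → ∀ j → (if does (completed? B j) then w j else 0ℚ) ℚ.≤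
                (if does (completed? (scheduleOf []) j) then w j else 0ℚ)
    pointwise B f j rewrite dec-false (completed? B j) (none B f j) with does (completed? (scheduleOf []) j)
    ... | true  = w≥0 j
    ... | false = ℚ.≤-refl
    feasible : Feasible (scheduleOf [])
    feasible = record
      { capacity = λ t → ℕ.≤-trans (ℕ.≤-reflexive (∣∣-∥∥ (scheduleOf [] t)))
          (ℕ.≤-trans (∥∥-mono {B = λ _ → false} (λ j h → ⊥-elim (inactive t j (Vec.lookup⇒[]= j _ h))))
            (ℕ.≤-trans (ℕ.≤-reflexive (sum-zero {n} (λ _ → refl))) z≤n))
      ; window   = λ t j i → ⊥-elim (inactive t j i)
      ; budget   = [] , z≤n , λ t (j , i) → ⊥-elim (inactive t j i)
      }

  no-budget : K ≡ 0 → ∀ B → Feasible B → ∀ j → ¬ Completed B j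
  no-budget refl B f j done with Feasible.budget f
  ... | [] , _ , active = idle (filter (λ t → j ∈ₛ? B t) (slots j)) refl
    where
    idle : ∀ ts → filter (λ t → j ∈ₛ? B t) (slots j) ≡ ts → ⊥
    idle [] e = ℕ.<⇒≱ (p>0 j) (ℕ.≤-trans done (ℕ.≤-reflexive (cong length e)))
    idle (t ∷ ts) e with active t (j , proj₂ (∈-filter⁻ (λ t → j ∈ₛ? B t) {xs = slots j} (subst (t ∈_) (sym e) (here refl))))
    ... | ()

  open Spec I
  open Solution I

  solution-optimal : ProperIntervals → ∀ j₀ → 1 ≤ K → Optimal (scheduleOf (proj₂ (solution (r j₀))))
  solution-optimal proper j₀ 1≤K with sound K 1≤K
    where
    sound : ∀ k → 1 ≤ k → Sound I U-wf As-tuples k (initial (r j₀)) (best (table (k ∸ 1)) As (initial (r j₀)))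
    sound (suc k) _ = best-sound I U-wf As-tuples (iterate-correct I U-wf As-tuples k) As (p , refl) id
  ... | π , run , e with abstractRun I run
  ...   | ρ , arun , refl , short = subst (λ o → Optimal (scheduleOf o)) (sym e)
          (schedule-feasible I arun short ,
           λ B f → ℚ.≤-trans (Completeness.complete I B proper f j₀ 1≤K) (schedule-throughput I arun short))

  -- The base is at least 1 because instances with n = 0 or K = 0 still take a constant number of
  -- steps.
  timeBound : ℕ → ℕ → ℕ
  timeBound C c = C * (1 ⊔ n * K) ^ (c * m)

  constant-bound : ∀ {s C} c → s ≤ C → s ≤ timeBound C c
  constant-bound {s} {C} c le = ℕ.≤-trans le (ℕ.m≤m*n C ((1 ⊔ n * K) ^ (c * m))
    ⦃ ℕ.m^n≢0 (1 ⊔ n * K) (c * m) ⦃ >-nonZero (ℕ.m≤m⊔n 1 (n * K)) ⦄ ⦄)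

tabulate-cases : ∀ {n} {X : Set} (f : Fin n → X) →
                 (n ≡ 0 × tabulate f ≡ []) ⊎ (∃[ j ] ∃[ xs ] tabulate f ≡ f j ∷ xs)
tabulate-cases {zero}  f = inj₁ (refl , refl)
tabulate-cases {suc n} f = inj₂ (zero , _ , refl)

polySize polyDegree timeConstant timeExponent : ℕ
polySize   = proj₁ mainC-polynomial
polyDegree = proj₁ (proj₂ mainC-polynomial)
-- The 10 covers the steps around the body as well as the trivial cases of 3 and 7 steps; the powers
-- of 3 come from `N-bound`.
timeConstant       = 10 + polySize * 3 ^ (6 * polyDegree)
timeExponent       = 3 * (6 * polyDegree)

-- A record for the same reason as Computes.
record Implements (body : Tm bodyCtx (list (int ⊗ int)))
                  (c : Code mainCtx (list (int ⊗ int))) : Set where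
  field
    value≡ : ∀ e j xs J (m k : ℤ) → proj₁ (eval body (e ∷ j ∷ xs ∷ J ∷ m ∷ k ∷ [])) ≡ mainF (e ∷ J ∷ m ∷ k ∷ [])
    cost≤  : ∀ N e j xs J (m k : ℤ) → Safe N c (e ∷ J ∷ m ∷ k ∷ []) →
             proj₂ (eval body (e ∷ j ∷ xs ∷ J ∷ m ∷ k ∷ [])) ≤ ⟦ cost c ⟧ᵖ N

bodyWith-implements : ∀ {c} → Computes c mainF → Implements (bodyWith c) c
bodyWith-implements {c} ci = record { value≡ = body-value {c} ci ; cost≤ = body-cost {c} }

programWith-optimal : ∀ {body} → Implements body mainC →
                      SolvesProperWithin (programWith body) (λ I → timeBound I timeConstant timeExponent)
programWith-optimal {body} impl I proper = cases (tabulate-cases jobOf) K refl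
  where
  open Instance I
  open Solution I using (solution; mainF-≡)
  open Implements impl

  jobOf : Fin n → ⟦ jobTy ⟧
  jobOf j = r j , d j , ℤ.+ p j , w j

  Goal : Costed (List (ℤ × ℤ)) → Set
  Goal o = Optimal (scheduleOf I (proj₁ o)) × proj₂ o ≤ timeBound I timeConstant timeExponent

  main-case : ∀ j₀ xs k → tabulate jobOf ≡ jobOf j₀ ∷ xs → K ≡ suc k →
    Goal (proj₁ (eval body (r j₀ ∷ jobOf j₀ ∷ xs ∷ (jobOf j₀ ∷ xs) ∷ ℤ.+ m ∷ ℤ.+ suc k ∷ [])) ,
          10 + proj₂ (eval body (r j₀ ∷ jobOf j₀ ∷ xs ∷ (jobOf j₀ ∷ xs) ∷ ℤ.+ m ∷ ℤ.+ suc k ∷ [])))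
  main-case j₀ xs k e refl =
    subst (λ o → Optimal (scheduleOf I o)) (sym out) (solution-optimal I proper j₀ (s≤s z≤n)) , time
    where
    1≤n : 1 ≤ n
    1≤n = ℕ.≤-trans (s≤s z≤n) (Fin.toℕ<n j₀)
    open Running I 1≤n (s≤s z≤n)
    env : Env bodyCtx
    env = r j₀ ∷ jobOf j₀ ∷ xs ∷ (jobOf j₀ ∷ xs) ∷ ℤ.+ m ∷ ℤ.+ suc k ∷ []
    out : proj₁ (eval body env) ≡ proj₂ (solution (r j₀))
    out = trans (value≡ (r j₀) (jobOf j₀) xs (jobOf j₀ ∷ xs) (ℤ.+ m) (ℤ.+ suc k))
      (trans (cong (λ J → mainF (r j₀ ∷ J ∷ ℤ.+ m ∷ ℤ.+ suc k ∷ [])) (sym e)) (mainF-≡ (r j₀) (s≤s z≤n)))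
    time : 10 + proj₂ (eval body env) ≤ timeBound I timeConstant timeExponent
    time = begin
      10 + proj₂ (eval body env)
        ≤⟨ ℕ.+-monoʳ-≤ 10 (cost≤ N (r j₀) (jobOf j₀) xs (jobOf j₀ ∷ xs) (ℤ.+ m) (ℤ.+ suc k)
             (subst (λ J → Safe N mainC (r j₀ ∷ J ∷ ℤ.+ m ∷ ℤ.+ suc k ∷ [])) e (main-safe (r j₀)))) ⟩
      10 + ⟦ cost mainC ⟧ᵖ N
        ≤⟨ ℕ.+-monoʳ-≤ 10 (proj₂ (proj₂ mainC-polynomial) N 1≤N) ⟩
      10 + polySize * N ^ polyDegree
        ≤⟨ ℕ.+-monoʳ-≤ 10 (ℕ.*-monoʳ-≤ polySize (N-bound polyDegree)) ⟩
      10 + polySize * (3 ^ (6 * polyDegree) * (n * K) ^ (timeExponent * m))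
        ≡⟨ cong (10 +_) (ℕ.*-assoc polySize (3 ^ (6 * polyDegree)) ((n * K) ^ (timeExponent * m))) ⟨
      10 + polySize * 3 ^ (6 * polyDegree) * (n * K) ^ (timeExponent * m)
        ≤⟨ ℕ.+-mono-≤ (constant-bound I {10} {10} timeExponent ℕ.≤-refl)
             (ℕ.*-monoʳ-≤ (polySize * 3 ^ (6 * polyDegree)) (ℕ.^-monoˡ-≤ (timeExponent * m) (ℕ.m≤n⊔m 1 (n * K)))) ⟩
      10 * (1 ⊔ n * K) ^ (timeExponent * m) + polySize * 3 ^ (6 * polyDegree) * (1 ⊔ n * K) ^ (timeExponent * m)
        ≡⟨ ℕ.*-distribʳ-+ ((1 ⊔ n * K) ^ (timeExponent * m)) 10 (polySize * 3 ^ (6 * polyDegree)) ⟨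
      timeBound I timeConstant timeExponent ∎
      where open ℕ.≤-Reasoning

  small : ∀ {s} → s ≤ 10 → s ≤ timeBound I timeConstant timeExponent
  small le = constant-bound I {C = timeConstant} timeExponent (ℕ.≤-trans le (ℕ.m≤m+n 10 (polySize * 3 ^ (6 * polyDegree))))

  cases : (n ≡ 0 × tabulate jobOf ≡ []) ⊎ (∃[ j ] ∃[ xs ] tabulate jobOf ≡ jobOf j ∷ xs) → ∀ k → K ≡ k →
          Goal (eval (programWith body) (tabulate jobOf ∷ ℤ.+ m ∷ ℤ.+ K ∷ []))
  cases (inj₁ (n≡0 , e)) k _ = subst (λ J → Goal (eval (programWith body) (J ∷ ℤ.+ m ∷ ℤ.+ K ∷ []))) (sym e)
    (subst Goal (sym (programWith-nil body (ℤ.+ m) (ℤ.+ K)))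
      (empty-optimal I (λ _ _ j _ → Fin.¬Fin0 (subst Fin n≡0 j)) , small (ℕ.m≤m+n 3 7)))
  cases (inj₂ (j₀ , xs , e)) k K≡k = subst₂ (λ J K → Goal (eval (programWith body) (J ∷ ℤ.+ m ∷ ℤ.+ K ∷ []))) (sym e) (sym K≡k) (by k K≡k)
    where
    by : ∀ k → K ≡ k → Goal (eval (programWith body) ((jobOf j₀ ∷ xs) ∷ ℤ.+ m ∷ ℤ.+ k ∷ []))
    by zero K≡0 = subst Goal (sym (programWith-zero body (jobOf j₀) xs (ℤ.+ m)))
      (empty-optimal I (no-budget I K≡0) , small (ℕ.m≤m+n 7 3))
    by (suc k) K≡k = subst Goal (sym (programWith-suc body (jobOf j₀) xs (ℤ.+ m) k)) (main-case j₀ xs k e K≡k)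

program-optimal : SolvesProperWithin (programWith (bodyWith mainC)) (λ I → timeBound I timeConstant timeExponent)
program-optimal = programWith-optimal (bodyWith-implements mainC-computes)

base-bound : ∀ n K → 1 ⊔ n * K ≤ (1 + n + K) ^ 2
base-bound n K = ℕ.⊔-lub (ℕ.m^n>0 (1 + n + K) 2) (begin
  n * K ≤⟨ ℕ.*-mono-≤ (ℕ.≤-trans (ℕ.n≤1+n n) (ℕ.m≤m+n (1 + n) K)) (ℕ.m≤n+m K (1 + n)) ⟩
  (1 + n + K) * (1 + n + K) ≡⟨ cong ((1 + n + K) *_) (ℕ.*-identityʳ (1 + n + K)) ⟨
  (1 + n + K) ^ 2                 ∎)
  where open ℕ.≤-Reasoning

theorem3 : (Σ[ P ∈ Program ] Σ[ C ∈ ℕ ] Σ[ c ∈ ℕ ]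
    SolvesProperWithin P
    (λ I → let open Instance I in C * (1 ⊔ n * K) ^ (c * m)))
    × XPSolvable
theorem3 =
  (programWith (bodyWith mainC) , timeConstant , timeExponent , program-optimal) ,
  -- The exponent doubles since n K is bounded by the square of 1 + n + K.
  (programWith (bodyWith mainC) , (λ _ → timeConstant) , (λ m → 2 * (timeExponent * m)) , λ I proper → let open Instance I in
    proj₁ (program-optimal I proper) ,
    ℕ.≤-trans (proj₂ (program-optimal I proper))
      (ℕ.*-monoʳ-≤ timeConstant (ℕ.≤-trans (ℕ.^-monoˡ-≤ (timeExponent * m) (base-bound n K))
        (ℕ.≤-reflexive (ℕ.^-*-assoc (1 + n + K) 2 (timeExponent * m))))))
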